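{- Let $n \ge 18$ and let $\mathcal{F} \subseteq 2^{[n]}$ be an intersecting $B$-free family of subsets of $[n]=\{1,\dots,n\}$. Then \[ |\mathcal{F}| \le \Sigma_I(n,2). \] Equality holds if and only if: (i) for $n$ odd, $\mathcal{F} = \mathcal{H}_{0,n,2}=\binom{[n]}{\lfloor n/2\rfloor+1}\cup\binom{[n]}{\lfloor n/2\rfloor+2}$; (ii) for $n$ even, $\mathcal{F} = \mathcal{H}_{x,n,2}$ for some $x\in[n]$, where \[ \mathcal{H}_{x,n,2}=\{F\in\tbinom{[n]}{n/2}: x\in F\}\cup\tbinom{[n]}{n/2+1}\cup\{F\in\tbinom{[n]}{n/2+2}: x\notin F\}. \]
   Context: $\binom{[n]}{k}$ denotes the family of all $k$-element subsets of $[n]$. A family is intersecting if any two of its members have nonempty intersection. The butterfly poset $B$ has four elements $w,x,y,z$ with relations $w,x\le y,z$. A family $\mathcal{F}$ is $B$-free if it does not contain $B$ as a subposet (under inclusion), i.e. there are no four distinct sets $A_1,A_2,A_3,A_4\in\mathcal{F}$ with $A_1,A_2\subseteq A_3$ and $A_1,A_2\subseteq A_4$. Define \[ \Sigma_I(n,k)=\begin{cases}\sum_{i=(n+1)/2}^{(n+1)/2+k-1}\binom{n}{i}, & n \text{ odd},\\ \binom{n-1}{n/2-1}+\sum_{i=n/2+1}^{n/2+k-1}\binom{n}{i}+\binom{n-1}{n/2+k}, & n\text{ even}.\end{cases} \] -}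

module Defs where

open import Data.Nat using (ℕ; zero; suc; _+_; _∸_; _*_)
open import Data.Sum using (_⊎_)
open import Data.Empty using (⊥)
open import Data.Nat.Combinatorics using (_C_)
open import Data.Fin using (Fin)
open import Data.Fin.Subset using (Subset; _⊆_; _∩_; Nonempty; ∣_∣; _∈_; _∉_)
open import Data.List using (List)
import Data.List.Membership.Propositional as LM
open import Data.Product using (_×_)
open import Relation.Binary.PropositionalEquality using (_≡_; _≢_)

-- A family of subsets of [n] = Fin n is a duplicate-free list of subsets
-- (duplicate-freeness is imposed in the theorem via Unique); |F| = length.

_∈F_ : ∀ {n} → Subset n → List (Subset n) → Set
A ∈F 𝓕 = A LM.∈ 𝓕

-- intersecting: any two members meet (for F = F this says no member is empty,
-- consistent with the usual convention)
Intersecting : ∀ {n} → List (Subset n) → Set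
Intersecting 𝓕 = ∀ A B → A ∈F 𝓕 → B ∈F 𝓕 → Nonempty (A ∩ B)

ButterflyFree : ∀ {n} → List (Subset n) → Set
ButterflyFree 𝓕 =
  ∀ A₁ A₂ A₃ A₄ → A₁ ∈F 𝓕 → A₂ ∈F 𝓕 → A₃ ∈F 𝓕 → A₄ ∈F 𝓕 →
  A₁ ≢ A₂ → A₁ ≢ A₃ → A₁ ≢ A₄ → A₂ ≢ A₃ → A₂ ≢ A₄ → A₃ ≢ A₄ →
  A₁ ⊆ A₃ → A₂ ⊆ A₃ → A₁ ⊆ A₄ → A₂ ⊆ A₄ → ⊥

binomSum : ℕ → ℕ → ℕ → ℕ
binomSum n a zero = 0
binomSum n a (suc len) = n C a + binomSum n (suc a) len

ΣI-odd : ℕ → ℕ → ℕ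
ΣI-odd m k = binomSum (2 * m + 1) (m + 1) k

ΣI-even : ℕ → ℕ → ℕ
ΣI-even m k = (n ∸ 1) C (m ∸ 1) + binomSum n (m + 1) (k ∸ 1) + (n ∸ 1) C (m + k)
  where
    n = 2 * m

H-odd : (m : ℕ) → Subset (2 * m + 1) → Set
H-odd m F = (∣ F ∣ ≡ m + 1) ⊎ (∣ F ∣ ≡ m + 2)

H-even : (m : ℕ) → Fin (2 * m) → Subset (2 * m) → Set
H-even m x F = ((∣ F ∣ ≡ m) × (x ∈ F)) ⊎ ((∣ F ∣ ≡ m + 1) ⊎ ((∣ F ∣ ≡ m + 2) × (x ∉ F)))

module Submission where

{- Average over all orderings σ of the ground set. A set of size s is a given arc of length s in s! (n − s)! of the n!
orderings, so giving it the weight n choose s turns the average total weight of the members on a chain of arcs into |𝓕|.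
In a butterfly-free family a chain carries at most two members unless it contains a mid, a member with a member below it
and one above it; both are then unique, so a chain through a mid carries few other members on average.

For odd n, a chain of initial segments is compared with the complementary chain of final segments. For n = 2m, the
elements are placed on a circle, with n chains of arcs growing alternately to the left and to the right. At most one of
two complementary m-sets is a member; if one chain has members of sizes m and m + 1 then, unless weight is lost
elsewhere, the opposite chain has one of size m + 1 but none of size m. Walking around the circle from the first kind of
chain to the second and back, one meets at least two lossy chains, with fewer than two members or with a mid. This
loss is the difference between Σ_I(2m,2) and the bound obtained from complementary pairs alone. In the case of equality
every ordering has exactly two lossy chains, and orderings in which a member and a non-member of size m are
consecutive arcs then determine the family. -}

open import Defs
open import Data.Nat using (ℕ; zero; suc; _+_; _*_; _∸_; _!; _≤_; _<_; z≤n; s≤s; _≟_; _≤?_; _<?_; NonZero; ≢-nonZero⁻¹;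
    >-nonZero; ⌊_/2⌋; ⌈_/2⌉)
open import Data.Nat.Properties
open import Data.Nat.Combinatorics using (nCk≡n!/k![n-k]!; k![n∸k]!∣n!; nCk≡nC[n∸k]; nC1≡n) renaming (_C_ to _choose_)
open import Data.Nat.DivMod using (_%_; m/n*n≡m; m%n≤m; %-distribˡ-+; m<n⇒m%n≡m; [m+n]%n≡m%n)
open import Data.Nat.Tactic.RingSolver using (solve-∀)
open import Data.Bool as Bool using (Bool; true; false; T; not; if_then_else_)
open import Data.Unit using (tt)
open import Data.Empty using (⊥; ⊥-elim)
open import Data.Fin using (Fin; zero; suc)
import Data.Fin.Properties as Finₚ
open import Data.Fin.Subset using (Subset; _⊆_; ∣_∣; ⊤; ⁅_⁆; ∁) renaming (_∈_ to _∈ˢ_; _∉_ to _∉ˢ_)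
open import Data.Fin.Subset.Properties using (drop-∷-⊆; _⊆?_; p⊆q⇒∣p∣≤∣q∣; ⊆-antisym; ⊆⊤; x∈p∩q⁻; ∣p∣≤n; ∣p∣≡n⇒p≡⊤; ∈⊤;
    ∣⊤∣≡n; ∣⁅x⁆∣≡1; x∈⁅x⁆; x∈⁅y⁆⇒x≡y; ∣∁p∣≡n∸∣p∣; x∈p⇒x∉∁p; x∉p⇒x∈∁p) renaming (_∈?_ to _∈ˢ?_)
open import Data.List using (List; []; _∷_; _++_; map; concatMap; length)
open import Data.List.Membership.Propositional using (_∈_; find; lose)
open import Data.List.Membership.Propositional.Properties using (∈-concatMap⁻) renaming (∈-map⁻ to ∈ˡ-map⁻)
import Data.List.Membership.DecPropositional as DecMembership
open import Data.List.Relation.Unary.All as All using (All; []; _∷_)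
open import Data.List.Relation.Unary.AllPairs using ([]; _∷_)
open import Data.List.Relation.Unary.Any using (Any; here; there; any?)
open import Data.List.Relation.Unary.Unique.Propositional using (Unique)
open import Data.Product using (∃; ∃₂; _×_; _,_; proj₁; proj₂)
open import Data.Sum using (_⊎_; inj₁; inj₂; [_,_]′)
open import Data.Vec as Vec using (Vec; []; _∷_; lookup; tabulate; _[_]≔_)
import Data.Vec.Properties as Vecₚ
open import Function using (_∘_; id)
open import Function.Bundles using (_⇔_; mk⇔; module Equivalence)
open import Relation.Binary using (DecidableEquality; tri<; tri≈; tri>)
open import Relation.Binary.PropositionalEquality hiding (J)
open import Relation.Nullary using (Dec; yes; no; does; ¬_)
open import Relation.Nullary.Decidable using (dec-true; dec-false; decidable-stable; _×-dec_; _⊎-dec_)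

-- For even n the obstacle is that two lossy chains per circle are not enough when they are lossy
-- because of mids: other members around the mids can give the weight back. So the loss has to grow
-- with the number of mids. Adjacent lossy chains are counted on top of the two (`2 + adjacent`),
-- and a mid makes a chain next to its own lossy unless a partner of the mid lies there. On average
-- a mid of size s has at most n / (s (n - s)) other members on its own chain and as few on the
-- neighbouring one. They enter with factors 2 and 1, so one unit gained per mid outweighs them as
-- soon as s (n - s) > 3 n. This fails for s ≤ 3 and s ≥ n - 3, where the small weight of the mid
-- itself yields a second unit. The full set lies on every chain and escapes the averaging, so it is
-- treated apart. If it is a member, every other member strictly above some member is a mid, and a
-- chain has on average at most 3/2 members of sizes 1 to n - 1; this makes both bounds strict.

private variable
  A B Col : Set

-- Linear arithmetic: the equation is left to the ring solver, with d as the slack.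
farkas : ∀ {l r a b} d → a ≤ b → l + b + d ≡ r + a → l ≤ r
farkas {l} {r} {a} {b} d a≤b e = +-cancelʳ-≤ b l r
  (≤-trans (m≤m+n (l + b) d) (≤-trans (≤-reflexive e) (+-monoʳ-≤ r a≤b)))

-- Sums, permutations and colour patterns

𝟙 : {P : Set} → Dec P → ℕ
𝟙 (yes _) = 1
𝟙 (no _)  = 0

𝟙-yes : {P : Set} (d : Dec P) → P → 𝟙 d ≡ 1
𝟙-yes (yes _) _ = refl
𝟙-yes (no ¬p) p = ⊥-elim (¬p p)

𝟙-no : {P : Set} (d : Dec P) → ¬ P → 𝟙 d ≡ 0
𝟙-no (yes p) ¬p = ⊥-elim (¬p p)
𝟙-no (no _)  _  = refl

𝟙≤1 : {P : Set} (d : Dec P) → 𝟙 d ≤ 1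
𝟙≤1 (yes _) = s≤s z≤n
𝟙≤1 (no _)  = z≤n

𝟙-pos : {P : Set} (d : Dec P) → 1 ≤ 𝟙 d → P
𝟙-pos (yes p) _ = p

𝟙-mono : {P Q : Set} (d : Dec P) (e : Dec Q) → (P → Q) → 𝟙 d ≤ 𝟙 e
𝟙-mono (yes p) e f = ≤-reflexive (sym (𝟙-yes e (f p)))
𝟙-mono (no _)  e f = z≤n

𝟙-cong : {P Q : Set} (d : Dec P) (e : Dec Q) → (P → Q) → (Q → P) → 𝟙 d ≡ 𝟙 e
𝟙-cong d e f g = ≤-antisym (𝟙-mono d e f) (𝟙-mono e d g)

𝟙-× : {P Q R : Set} (d : Dec P) (e : Dec Q) (f : Dec R) → (P → Q × R) → (Q → R → P) → 𝟙 d ≡ 𝟙 e * 𝟙 f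
𝟙-× d (yes q) (yes r) g h = 𝟙-yes d (h q r)
𝟙-× d (yes q) (no ¬r) g h = 𝟙-no d (¬r ∘ proj₂ ∘ g)
𝟙-× d (no ¬q) f       g h = 𝟙-no d (¬q ∘ proj₁ ∘ g)

∑ : List A → (A → ℕ) → ℕ
∑ []       f = 0
∑ (x ∷ xs) f = f x + ∑ xs f

syntax ∑ xs (λ x → e) = ∑[ x ∈ xs ] e

∑-cong : ∀ (xs : List A) {f g} → (∀ {x} → x ∈ xs → f x ≡ g x) → ∑ xs f ≡ ∑ xs g
∑-cong []       h = refl
∑-cong (x ∷ xs) h = cong₂ _+_ (h (here refl)) (∑-cong xs (h ∘ there))

∑-mono : ∀ (xs : List A) {f g} → (∀ {x} → x ∈ xs → f x ≤ g x) → ∑ xs f ≤ ∑ xs g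
∑-mono []       h = z≤n
∑-mono (x ∷ xs) h = +-mono-≤ (h (here refl)) (∑-mono xs (h ∘ there))

∑-tight : ∀ (xs : List A) {f g} → (∀ {x} → x ∈ xs → f x ≤ g x) → ∑ xs g ≤ ∑ xs f →
          ∀ {x} → x ∈ xs → f x ≡ g x
∑-tight (y ∷ xs) {f} {g} h le (here refl) = ≤-antisym (h (here refl))
  (+-cancelʳ-≤ (∑ xs g) _ _ (≤-trans le (+-monoʳ-≤ (f y) (∑-mono xs (h ∘ there)))))
∑-tight (y ∷ xs) {f} {g} h le (there x∈) = ∑-tight xs (h ∘ there)
  (+-cancelˡ-≤ (g y) _ _ (≤-trans le (+-monoˡ-≤ (∑ xs f) (h (here refl))))) x∈

∑-member : ∀ (xs : List A) f {x} → x ∈ xs → f x ≤ ∑ xs f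
∑-member (y ∷ xs) f (here refl) = m≤m+n (f y) _
∑-member (y ∷ xs) f (there x∈)  = ≤-trans (∑-member xs f x∈) (m≤n+m _ (f y))

∑-find : ∀ (xs : List A) f → 1 ≤ ∑ xs f → ∃ λ x → x ∈ xs × 1 ≤ f x
∑-find (y ∷ xs) f le with 1 ≤? f y
... | yes p = y , here refl , p
... | no ¬p with x , x∈ , q ← ∑-find xs f (subst (λ z → 1 ≤ z + ∑ xs f) (n<1⇒n≡0 (≰⇒> ¬p)) le)
  = x , there x∈ , q

∑-zero : ∀ (xs : List A) {f} → (∀ {x} → x ∈ xs → f x ≡ 0) → ∑ xs f ≡ 0
∑-zero []       h = refl
∑-zero (x ∷ xs) h = cong₂ _+_ (h (here refl)) (∑-zero xs (h ∘ there))

+-interchange : ∀ a b c d → a + b + (c + d) ≡ a + c + (b + d)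
+-interchange = solve-∀

∑-+ : ∀ (xs : List A) f g → ∑[ x ∈ xs ] (f x + g x) ≡ ∑ xs f + ∑ xs g
∑-+ []       f g = refl
∑-+ (x ∷ xs) f g = trans (cong (f x + g x +_) (∑-+ xs f g)) (+-interchange (f x) (g x) _ _)

∑-*ˡ : ∀ c (xs : List A) f → ∑[ x ∈ xs ] (c * f x) ≡ c * ∑ xs f
∑-*ˡ c []       f = sym (*-zeroʳ c)
∑-*ˡ c (x ∷ xs) f = trans (cong (c * f x +_) (∑-*ˡ c xs f)) (sym (*-distribˡ-+ c (f x) _))

∑-*ʳ : ∀ c (xs : List A) f → ∑[ x ∈ xs ] (f x * c) ≡ ∑ xs f * c
∑-*ʳ c []       f = refl
∑-*ʳ c (x ∷ xs) f = trans (cong (f x * c +_) (∑-*ʳ c xs f)) (sym (*-distribʳ-+ c (f x) _))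

∑-swap : ∀ (xs : List A) (ys : List B) (f : A → B → ℕ) →
         ∑[ x ∈ xs ] ∑[ y ∈ ys ] f x y ≡ ∑[ y ∈ ys ] ∑[ x ∈ xs ] f x y
∑-swap []       ys f = sym (∑-zero ys (λ _ → refl))
∑-swap (x ∷ xs) ys f = trans (cong (∑ ys (f x) +_) (∑-swap xs ys f)) (sym (∑-+ ys (f x) _))

∑-++ : ∀ (xs ys : List A) f → ∑ (xs ++ ys) f ≡ ∑ xs f + ∑ ys f
∑-++ []       ys f = refl
∑-++ (x ∷ xs) ys f = trans (cong (f x +_) (∑-++ xs ys f)) (sym (+-assoc (f x) _ _))

∑-map : ∀ (h : A → B) xs f → ∑ (map h xs) f ≡ ∑ xs (f ∘ h)
∑-map h []       f = refl
∑-map h (x ∷ xs) f = cong (f (h x) +_) (∑-map h xs f)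

∑-concatMap : ∀ (h : A → List B) xs f → ∑ (concatMap h xs) f ≡ ∑[ x ∈ xs ] ∑ (h x) f
∑-concatMap h []       f = refl
∑-concatMap h (x ∷ xs) f = trans (∑-++ (h x) (concatMap h xs) f) (cong (∑ (h x) f +_) (∑-concatMap h xs f))

range : ℕ → ℕ → List ℕ
range a zero    = []
range a (suc n) = a ∷ range (suc a) n

∈-range⁻ : ∀ a n {s} → s ∈ range a n → a ≤ s × s < a + n
∈-range⁻ a (suc n) (here refl) = ≤-refl , m<m+n a (s≤s z≤n)
∈-range⁻ a (suc n) {s} (there s∈) with p , q ← ∈-range⁻ (suc a) n s∈ =
  <⇒≤ p , subst (s <_) (sym (+-suc a n)) q

∈-range⁺ : ∀ a n {s} → a ≤ s → s < a + n → s ∈ range a n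
∈-range⁺ a zero    p q = ⊥-elim (<⇒≱ (subst (_ <_) (+-identityʳ a) q) p)
∈-range⁺ a (suc n) {s} p q with a ≟ s
... | yes refl = here refl
... | no a≢s = there (∈-range⁺ (suc a) n (≤∧≢⇒< p a≢s) (subst (s <_) (+-suc a n) q))

∑-range-++ : ∀ a n k f → ∑ (range a (n + k)) f ≡ ∑ (range a n) f + ∑ (range (a + n) k) f
∑-range-++ a zero    k f = cong (λ b → ∑ (range b k) f) (sym (+-identityʳ a))
∑-range-++ a (suc n) k f = trans (cong (f a +_) (trans (∑-range-++ (suc a) n k f)
  (cong (λ b → ∑ (range (suc a) n) f + ∑ (range b k) f) (sym (+-suc a n))))) (sym (+-assoc (f a) _ _))

∑-range-suc : ∀ a n f → ∑ (range a n) (f ∘ suc) ≡ ∑ (range (suc a) n) f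
∑-range-suc a zero    f = refl
∑-range-suc a (suc n) f = cong (f (suc a) +_) (∑-range-suc (suc a) n f)

∑-range-+ : ∀ d a n f → ∑[ k ∈ range a n ] f (k + d) ≡ ∑ (range (a + d) n) f
∑-range-+ zero    a n f = trans (∑-cong (range a n) (λ {k} _ → cong f (+-identityʳ k)))
  (cong (λ b → ∑ (range b n) f) (sym (+-identityʳ a)))
∑-range-+ (suc d) a n f = trans (∑-cong (range a n) (λ {k} _ → cong f (+-suc k d)))
  (trans (∑-range-suc a n (λ k → f (k + d))) (trans (∑-range-+ d (suc a) n f)
    (cong (λ b → ∑ (range b n) f) (sym (+-suc a d)))))

-- Shifting the window by one drops `f a` and gains `f (a + n)`, which is the same number.
∑-rotate : ∀ n f → (∀ k → f (k + n) ≡ f k) → ∀ a → ∑ (range a n) f ≡ ∑ (range 0 n) f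
∑-rotate n f per zero    = refl
∑-rotate n f per (suc a) = trans (+-cancelˡ-≡ (f a) _ _ (begin
  f a + ∑ (range (suc a) n) f    ≡⟨ refl ⟩
  ∑ (range a (1 + n)) f          ≡⟨ cong (λ k → ∑ (range a k) f) (+-comm 1 n) ⟩
  ∑ (range a (n + 1)) f          ≡⟨ ∑-range-++ a n 1 f ⟩
  ∑ (range a n) f + (f (a + n) + 0) ≡⟨ cong (∑ (range a n) f +_) (trans (+-identityʳ _) (per a)) ⟩
  ∑ (range a n) f + f a          ≡⟨ +-comm _ (f a) ⟩
  f a + ∑ (range a n) f          ∎)) (∑-rotate n f per a)
  where open ≡-Reasoning

∑-𝟙< : ∀ a n b → b ≤ a + n → ∑[ p ∈ range a n ] 𝟙 (p <? b) ≡ b ∸ a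
∑-𝟙< a zero b le = sym (m≤n⇒m∸n≡0 (subst (b ≤_) (+-identityʳ a) le))
∑-𝟙< a (suc n) b le with a <? b
... | yes a<b = trans (cong suc (∑-𝟙< (suc a) n b (subst (b ≤_) (+-suc a n) le)))
                  (sym (trans (cong (_∸ a) (sym (m+[n∸m]≡n a<b))) (trans (cong (_∸ a) (sym (+-suc a _))) (m+n∸m≡n a _))))
... | no a≮b = trans (∑-𝟙< (suc a) n b (subst (b ≤_) (+-suc a n) le))
                  (trans (m≤n⇒m∸n≡0 (m≤n⇒m≤1+n (≮⇒≥ a≮b))) (sym (m≤n⇒m∸n≡0 (≮⇒≥ a≮b))))

∑-𝟙≟ : ∀ a n c (f : ℕ → ℕ) → a ≤ c → c < a + n → ∑[ s ∈ range a n ] (𝟙 (c ≟ s) * f s) ≡ f c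
∑-𝟙≟ a zero    c f p q = ⊥-elim (<⇒≱ (subst (c <_) (+-identityʳ a) q) p)
∑-𝟙≟ a (suc n) c f p q with c ≟ a
... | yes refl = trans (cong₂ _+_ (+-identityʳ (f c)) (∑-zero (range (suc a) n) (λ {s} s∈ →
        cong (_* f s) (𝟙-no (c ≟ s) (<⇒≢ (proj₁ (∈-range⁻ (suc a) n s∈))))))) (+-identityʳ (f c))
... | no c≢a = ∑-𝟙≟ (suc a) n c f (≤∧≢⇒< p (c≢a ∘ sym)) (subst (c <_) (+-suc a n) q)

-- The rest of the range is returned in the same form, so that repeated use produces the members of
-- a chain in increasing size.
first : ∀ a n (u : ℕ → ℕ) c → (∀ s → u s ≤ 1) → suc c ≤ ∑ (range a n) u →
        ∃₂ λ s n′ → a ≤ s × s < a + n × 1 ≤ u s × c ≤ ∑ (range (suc s) n′) u × suc s + n′ ≡ a + n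
first a (suc n) u c u≤1 le with 1 ≤? u a
... | yes p = a , n , ≤-refl , m<m+n a (s≤s z≤n) , p ,
              +-cancelˡ-≤ 1 _ _ (≤-trans le (+-monoˡ-≤ _ (u≤1 a))) , sym (+-suc a n)
... | no ¬p with s , n′ , q₁ , q₂ , q₃ , q₄ , q₅ ← first (suc a) n u c u≤1
                   (subst (λ z → suc c ≤ z + ∑ (range (suc a) n) u) (n<1⇒n≡0 (≰⇒> ¬p)) le)
  = s , n′ , <⇒≤ q₁ , subst (s <_) (sym (+-suc a n)) q₂ , q₃ , q₄ , trans q₅ (sym (+-suc a n))

-- A discrete intermediate value step: `k` ends the initial run on which `P` holds. It locates
-- changes of state on a circle as well as a member arc followed by a non-member arc.
last-true : (P : ℕ → Set) → (∀ k → Dec (P k)) → ∀ i d → P i → ¬ P (i + d) →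
            ∃ λ k → k ∈ range i d × P k × ¬ P (suc k)
last-true P P? i zero    p ¬p = ⊥-elim (¬p (subst P (sym (+-identityʳ i)) p))
last-true P P? i (suc d) p ¬p with P? (suc i)
... | no ¬q = i , here refl , p , ¬q
... | yes q with k , k∈ , r , s ← last-true P P? (suc i) d q (¬p ∘ subst P (sym (+-suc i d)))
  = k , there k∈ , r , s

-- Orderings counted by their colour patterns

picks : ∀ {n} → Vec A (suc n) → List (A × Vec A n)
picks {n = zero}  (x ∷ [])  = (x , []) ∷ []
picks {n = suc n} (x ∷ xs) = (x , xs) ∷ map (λ (z , r) → z , x ∷ r) (picks xs)

perms : ∀ {n} → Vec A n → List (Vec A n)
perms {n = zero}  xs = [] ∷ []
perms {n = suc n} xs = concatMap (λ (z , r) → map (z ∷_) (perms r)) (picks xs)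

∑-perms : ∀ {n} (xs : Vec A (suc n)) f →
          ∑ (perms xs) f ≡ ∑[ p ∈ picks xs ] ∑[ v ∈ perms (proj₂ p) ] f (proj₁ p ∷ v)
∑-perms xs f = trans (∑-concatMap _ (picks xs) f)
  (∑-cong (picks xs) (λ {p} _ → ∑-map (proj₁ p ∷_) (perms (proj₂ p)) f))

∈-perms⁻ : ∀ {n} (xs : Vec A (suc n)) {v} → v ∈ perms xs →
           ∃ λ z → ∃₂ λ r w → (z , r) ∈ picks xs × w ∈ perms r × v ≡ z ∷ w
∈-perms⁻ xs v∈ with (z , r) , p∈ , q ← find (∈-concatMap⁻ _ {xs = picks xs} v∈)
  with w , w∈ , refl ← ∈ˡ-map⁻ _ q = z , r , w , p∈ , w∈ , refl

module _ (_≟ᴷ_ : DecidableEquality Col) where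

  occ : ∀ {n} → Col → Vec Col n → ℕ
  occ κ []       = 0
  occ κ (x ∷ xs) = 𝟙 (κ ≟ᴷ x) + occ κ xs

  -- The product of the factorials of the colour multiplicities, built one entry at a time: this
  -- many permutations of a pool have a given colour pattern.
  arrangements : ∀ {n} → Vec Col n → ℕ
  arrangements []       = 1
  arrangements (κ ∷ t) = suc (occ κ t) * arrangements t

  arrangements>0 : ∀ {n} (t : Vec Col n) → 1 ≤ arrangements t
  arrangements>0 []       = s≤s z≤n
  arrangements>0 (κ ∷ t) = ≤-trans (arrangements>0 t) (m≤m+n _ _)

  _≟ⱽ_ : ∀ {n} → DecidableEquality (Vec Col n)
  _≟ⱽ_ = Vecₚ.≡-dec _≟ᴷ_

  module _ (col : A → Col) where

    occ-picks : ∀ {n} (xs : Vec A (suc n)) {z r} → (z , r) ∈ picks xs → ∀ κ →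
                occ κ (Vec.map col xs) ≡ 𝟙 (κ ≟ᴷ col z) + occ κ (Vec.map col r)
    occ-picks {n = zero}  (x ∷ []) (here refl) κ = refl
    occ-picks {n = suc n} (x ∷ xs) (here refl) κ = refl
    occ-picks {n = suc n} (x ∷ xs) (there p) κ with (z , r) , zr∈ , refl ← ∈ˡ-map⁻ _ p =
      trans (cong (𝟙 (κ ≟ᴷ col x) +_) (occ-picks xs zr∈ κ)) (comm (𝟙 (κ ≟ᴷ col x)) (𝟙 (κ ≟ᴷ col z)) (occ κ (Vec.map col r)))
      where comm : ∀ a b c → a + (b + c) ≡ b + (a + c)
            comm = solve-∀

    ∑-picks : ∀ {n} (xs : Vec A (suc n)) κ →
              ∑[ p ∈ picks xs ] 𝟙 (κ ≟ᴷ col (proj₁ p)) ≡ occ κ (Vec.map col xs)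
    ∑-picks {n = zero}  (x ∷ []) κ = refl
    ∑-picks {n = suc n} (x ∷ xs) κ = cong (𝟙 (κ ≟ᴷ col x) +_)
      (trans (∑-map _ (picks xs) _) (∑-picks xs κ))

    occ-perms : ∀ {n} (xs : Vec A n) {v} → v ∈ perms xs → ∀ κ →
                occ κ (Vec.map col v) ≡ occ κ (Vec.map col xs)
    occ-perms {n = zero}  [] (here refl) κ = refl
    occ-perms {n = suc n} xs v∈ κ
      with z , r , w , zr∈ , w∈ , refl ← ∈-perms⁻ xs v∈ =
      trans (cong (𝟙 (κ ≟ᴷ col z) +_) (occ-perms r w∈ κ)) (sym (occ-picks xs zr∈ κ))

    𝟙-∷ : ∀ {n} κ x (t u : Vec Col n) →
          𝟙 ((κ ∷ t) ≟ⱽ (x ∷ u)) ≡ 𝟙 (κ ≟ᴷ x) * 𝟙 (t ≟ⱽ u)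
    𝟙-∷ κ x t u = 𝟙-× (_ ≟ⱽ _) (κ ≟ᴷ x) (t ≟ⱽ u) Vecₚ.∷-injective (λ p q → cong₂ _∷_ p q)

    -- The first entry must have colour `κ`; there are `suc (occ κ t)` such picks, and each leaves a
    -- pool whose colours match those of `t`.
    ∑-colour : ∀ {n} (xs : Vec A n) t → (∀ κ → occ κ (Vec.map col xs) ≡ occ κ t) →
               ∑[ v ∈ perms xs ] 𝟙 (t ≟ⱽ Vec.map col v) ≡ arrangements t
    ∑-colour {n = zero}  [] [] h = refl
    ∑-colour {n = suc n} xs (κ ∷ t) h = begin
      ∑[ v ∈ perms xs ] 𝟙 ((κ ∷ t) ≟ⱽ Vec.map col v)
        ≡⟨ ∑-perms xs _ ⟩
      ∑[ p ∈ picks xs ] ∑[ v ∈ perms (proj₂ p) ] 𝟙 ((κ ∷ t) ≟ⱽ (col (proj₁ p) ∷ Vec.map col v))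
        ≡⟨ ∑-cong (picks xs) (λ {p} p∈ → trans (∑-cong (perms (proj₂ p)) (λ {v} _ → 𝟙-∷ κ (col (proj₁ p)) t (Vec.map col v)))
             (trans (∑-*ˡ (𝟙 (κ ≟ᴷ col (proj₁ p))) (perms (proj₂ p)) _) (step p p∈))) ⟩
      ∑[ p ∈ picks xs ] (𝟙 (κ ≟ᴷ col (proj₁ p)) * arrangements t)
        ≡⟨ ∑-*ʳ (arrangements t) (picks xs) _ ⟩
      ∑[ p ∈ picks xs ] 𝟙 (κ ≟ᴷ col (proj₁ p)) * arrangements t
        ≡⟨ cong (_* arrangements t) (trans (∑-picks xs κ) (trans (h κ) (cong (_+ occ κ t) (𝟙-yes (κ ≟ᴷ κ) refl)))) ⟩
      suc (occ κ t) * arrangements t ∎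
      where
      open ≡-Reasoning
      step : ∀ p → p ∈ picks xs →
             𝟙 (κ ≟ᴷ col (proj₁ p)) * ∑[ v ∈ perms (proj₂ p) ] 𝟙 (t ≟ⱽ Vec.map col v)
             ≡ 𝟙 (κ ≟ᴷ col (proj₁ p)) * arrangements t
      step (z , r) p∈ with κ ≟ᴷ col z
      ... | no _ = refl
      ... | yes κ≡ = cong (1 *_) (∑-colour r t λ κ′ → +-cancelˡ-≡ (𝟙 (κ′ ≟ᴷ κ)) _ _ (begin
        𝟙 (κ′ ≟ᴷ κ) + occ κ′ (Vec.map col r)     ≡⟨ cong (λ c → 𝟙 (κ′ ≟ᴷ c) + _) κ≡ ⟩
        𝟙 (κ′ ≟ᴷ col z) + occ κ′ (Vec.map col r) ≡⟨ occ-picks xs p∈ κ′ ⟨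
        occ κ′ (Vec.map col xs)                   ≡⟨ h κ′ ⟩
        𝟙 (κ′ ≟ᴷ κ) + occ κ′ t                    ∎))

    ∃-colour : ∀ {n} (xs : Vec A n) t → (∀ κ → occ κ (Vec.map col xs) ≡ occ κ t) →
               ∃ λ v → v ∈ perms xs × t ≡ Vec.map col v
    ∃-colour xs t h with v , v∈ , p ← ∑-find (perms xs) (λ v → 𝟙 (t ≟ⱽ Vec.map col v))
                            (subst (1 ≤_) (sym (∑-colour xs t h)) (arrangements>0 t))
      = v , v∈ , 𝟙-pos (_ ≟ⱽ _) p

∑-perms-const : ∀ {n} (xs : Vec A n) c → ∑[ v ∈ perms xs ] c ≡ n ! * c
∑-perms-const {n = zero}  [] c = refl
∑-perms-const {n = suc n} xs c = trans (∑-perms xs _)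
  (trans (∑-cong (picks xs) (λ {p} _ → ∑-perms-const (proj₂ p) c)) (trans (∑-picks-const xs (n ! * c))
      (sym (*-assoc (suc n) (n !) c))))
  where
  ∑-picks-const : ∀ {n} (xs : Vec A (suc n)) c → ∑[ p ∈ picks xs ] c ≡ suc n * c
  ∑-picks-const {n = zero}  (x ∷ []) c = refl
  ∑-picks-const {n = suc n} (x ∷ xs) c = cong (c +_) (trans (∑-map _ (picks xs) _) (∑-picks-const xs c))

-- Subsets, arcs and mids of a butterfly-free family

b2n : Bool → ℕ
b2n true  = 1
b2n false = 0

b2n-does : {P : Set} (d : Dec P) → b2n (does d) ≡ 𝟙 d
b2n-does (yes _) = refl
b2n-does (no _)  = refl

_≟ˢ_ : ∀ {n} (A B : Subset n) → Dec (A ≡ B)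
_≟ˢ_ = _≟ⱽ_ Bool._≟_

occ-true : ∀ {n} (A : Subset n) → occ Bool._≟_ true A ≡ ∣ A ∣
occ-true []          = refl
occ-true (true ∷ A)  = cong suc (occ-true A)
occ-true (false ∷ A) = occ-true A

occ-false : ∀ {n} (A : Subset n) → ∣ A ∣ + occ Bool._≟_ false A ≡ n
occ-false []          = refl
occ-false (true ∷ A)  = cong suc (occ-false A)
occ-false (false ∷ A) = trans (+-suc ∣ A ∣ _) (cong suc (occ-false A))

arrangements-Bool : ∀ {n} (A : Subset n) →
                    arrangements Bool._≟_ A ≡ (∣ A ∣) ! * (n ∸ ∣ A ∣) !
arrangements-Bool {n} A = trans (lem A) (cong (λ k → ∣ A ∣ ! * k !)
  (trans (sym (m+n∸m≡n ∣ A ∣ _)) (cong (_∸ ∣ A ∣) (occ-false A))))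
  where
  lem : ∀ {n} (A : Subset n) → arrangements Bool._≟_ A ≡ (∣ A ∣) ! * (occ Bool._≟_ false A) !
  lem []          = refl
  lem (true ∷ A)  = trans (cong₂ _*_ (cong suc (occ-true A)) (lem A)) (sym
      (*-assoc (suc ∣ A ∣) (∣ A ∣ !) (occ Bool._≟_ false A !)))
  lem (false ∷ A) = trans (cong (suc (occ Bool._≟_ false A) *_) (lem A)) (comm (suc (occ Bool._≟_ false A)) (∣ A ∣ !) _)
    where comm : ∀ a b c → a * (b * c) ≡ b * (a * c)
          comm = solve-∀

∈-map : ∀ {n} {J : ℕ → Bool} (σ : Vec ℕ n) {e} → J (lookup σ e) ≡ true → e ∈ˢ Vec.map J σ
∈-map {J = J} σ {e} h = Vecₚ.lookup⇒[]= e _ (trans (Vecₚ.lookup-map e J σ) h)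

∈-map⁻ : ∀ {n} {J : ℕ → Bool} (σ : Vec ℕ n) {e} → e ∈ˢ Vec.map J σ → J (lookup σ e) ≡ true
∈-map⁻ {J = J} σ {e} h = trans (sym (Vecₚ.lookup-map e J σ)) (Vecₚ.[]=⇒lookup h)

_⊑_ : (J Q : ℕ → Bool) → Set
J ⊑ Q = ∀ p → J p ≡ true → Q p ≡ true

map-⊆ : ∀ {n} {J Q : ℕ → Bool} (σ : Vec ℕ n) → J ⊑ Q → Vec.map J σ ⊆ Vec.map Q σ
map-⊆ σ J⊑Q e∈ = ∈-map σ (J⊑Q _ (∈-map⁻ σ e∈))

rangeⱽ : ℕ → ∀ n → Vec ℕ n
rangeⱽ a zero    = []
rangeⱽ a (suc n) = a ∷ rangeⱽ (suc a) n

-- The orderings of [n]: each element is mapped to its position.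
Ω : ∀ n → List (Vec ℕ n)
Ω n = perms (rangeⱽ 0 n)

size : ℕ → (ℕ → Bool) → ℕ
size n J = ∑[ p ∈ range 0 n ] b2n (J p)

∣map∣-rangeⱽ : ∀ a n (J : ℕ → Bool) → ∣ Vec.map J (rangeⱽ a n) ∣ ≡ ∑[ p ∈ range a n ] b2n (J p)
∣map∣-rangeⱽ a zero    J = refl
∣map∣-rangeⱽ a (suc n) J with J a
... | true  = cong suc (∣map∣-rangeⱽ (suc a) n J)
... | false = ∣map∣-rangeⱽ (suc a) n J

∣map∣ : ∀ {n} (J : ℕ → Bool) {σ} → σ ∈ Ω n → ∣ Vec.map J σ ∣ ≡ size n J
∣map∣ {n} J {σ} σ∈ = trans (sym (occ-true (Vec.map J σ))) (trans (occ-perms Bool._≟_ J (rangeⱽ 0 n) σ∈ true)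
  (trans (occ-true (Vec.map J (rangeⱽ 0 n))) (∣map∣-rangeⱽ 0 n J)))

same-size⇒occ : ∀ {n} (A B : Subset n) → ∣ A ∣ ≡ ∣ B ∣ → ∀ κ → occ Bool._≟_ κ A ≡ occ Bool._≟_ κ B
same-size⇒occ A B eq true  = trans (occ-true A) (trans eq (sym (occ-true B)))
same-size⇒occ A B eq false = +-cancelˡ-≡ ∣ A ∣ _ _
  (trans (occ-false A) (sym (trans (cong (_+ _) eq) (occ-false B))))

∑-Ω-set : ∀ {n} J (A : Subset n) → ∣ A ∣ ≡ size n J →
          ∑[ σ ∈ Ω n ] 𝟙 (A ≟ˢ Vec.map J σ) ≡ (∣ A ∣) ! * (n ∸ ∣ A ∣) !
∑-Ω-set {n} J A eq = trans (∑-colour Bool._≟_ J (rangeⱽ 0 n) A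
  (same-size⇒occ (Vec.map J (rangeⱽ 0 n)) A (trans (∣map∣-rangeⱽ 0 n J) (sym eq)))) (arrangements-Bool A)

∃-Ω-set : ∀ {n} J (A : Subset n) → ∣ A ∣ ≡ size n J → ∃ λ σ → σ ∈ Ω n × A ≡ Vec.map J σ
∃-Ω-set {n} J A eq = ∃-colour Bool._≟_ J (rangeⱽ 0 n) A
  (same-size⇒occ (Vec.map J (rangeⱽ 0 n)) A (trans (∣map∣-rangeⱽ 0 n J) (sym eq)))

-- A nested pair S ⊆ S′ encoded as a colouring: 2 on S, 1 on S′ ∖ S and 0 outside S′.
layers : ∀ {n} → Subset n → Subset n → Vec ℕ n
layers = Vec.zipWith (λ a b → b2n a + b2n b)

layers-occ : ∀ {n} (S S′ : Subset n) → S ⊆ S′ →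
  let o = λ κ → occ _≟_ κ (layers S S′) in
  o 2 ≡ ∣ S ∣ × ∣ S ∣ + o 1 ≡ ∣ S′ ∣ × ∣ S′ ∣ + o 0 ≡ n × (∀ κ → o (3 + κ) ≡ 0) ×
  arrangements _≟_ (layers S S′) ≡ o 2 ! * o 1 ! * o 0 !
layers-occ []          []          _  = refl , refl , refl , (λ _ → refl) , refl
layers-occ (true ∷ S)  (false ∷ S′) le with () ← le Vec.here
layers-occ (true ∷ S)  (true ∷ S′)  le
  with h₂ , h₁ , h₀ , h₃ , h ← layers-occ S S′ (drop-∷-⊆ le) =
  cong suc h₂ , cong suc h₁ , cong suc h₀ , h₃ , trans (cong (suc (occ _≟_ 2 (layers S S′)) *_) h)
      (assoc (suc (occ _≟_ 2 (layers S S′))) (occ _≟_ 2 (layers S S′) !) (occ _≟_ 1 (layers S S′) !) (occ _≟_ 0 (layers S S′) !))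
  where assoc : ∀ a b c d → a * (b * c * d) ≡ a * b * c * d
        assoc = solve-∀
layers-occ (false ∷ S) (true ∷ S′)  le
  with h₂ , h₁ , h₀ , h₃ , h ← layers-occ S S′ (drop-∷-⊆ le) =
  h₂ , trans (+-suc ∣ S ∣ _) (cong suc h₁) , cong suc h₀ , h₃ , trans (cong (suc (occ _≟_ 1 (layers S S′)) *_) h)
      (assoc (suc (occ _≟_ 1 (layers S S′))) (occ _≟_ 2 (layers S S′) !) (occ _≟_ 1 (layers S S′) !) (occ _≟_ 0 (layers S S′) !))
  where assoc : ∀ a b c d → a * (b * c * d) ≡ b * (a * c) * d
        assoc = solve-∀
layers-occ (false ∷ S) (false ∷ S′) le
  with h₂ , h₁ , h₀ , h₃ , h ← layers-occ S S′ (drop-∷-⊆ le) =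
  h₂ , h₁ , trans (+-suc ∣ S′ ∣ _) (cong suc h₀) , h₃ , trans (cong (suc (occ _≟_ 0 (layers S S′)) *_) h)
      (assoc (suc (occ _≟_ 0 (layers S S′))) (occ _≟_ 2 (layers S S′) !) (occ _≟_ 1 (layers S S′) !) (occ _≟_ 0 (layers S S′) !))
  where assoc : ∀ a b c d → a * (b * c * d) ≡ b * c * (a * d)
        assoc = solve-∀

map-layers : ∀ {n} (J Q : ℕ → Bool) (σ : Vec ℕ n) →
             Vec.map (λ p → b2n (J p) + b2n (Q p)) σ ≡ layers (Vec.map J σ) (Vec.map Q σ)
map-layers J Q []      = refl
map-layers J Q (p ∷ σ) = cong (_ ∷_) (map-layers J Q σ)

-- Prescribing both sets amounts to prescribing one pattern with three colours, and the orderings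
-- with that pattern are counted by the product of the three class factorials.
∑-Ω-nested : ∀ {n} J Q (S S′ : Subset n) → J ⊑ Q → S ⊆ S′ → ∣ S ∣ ≡ size n J → ∣ S′ ∣ ≡ size n Q →
  ∑[ σ ∈ Ω n ] (𝟙 (S ≟ˢ Vec.map J σ) * 𝟙 (S′ ≟ˢ Vec.map Q σ))
  ≤ (∣ S ∣) ! * (∣ S′ ∣ ∸ ∣ S ∣) ! * (n ∸ ∣ S′ ∣) !
∑-Ω-nested {n} J Q S S′ J⊑Q S⊆S′ eq eq′ = ≤-trans
  (∑-mono (Ω n) (λ {σ} _ → joint σ))
  (≤-reflexive (trans (∑-colour _≟_ _ (rangeⱽ 0 n) (layers S S′) occ-eq) count))
  where
  pool = rangeⱽ 0 n
  P = Vec.map J pool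
  P′ = Vec.map Q pool
  joint : ∀ σ → 𝟙 (S ≟ˢ Vec.map J σ) * 𝟙 (S′ ≟ˢ Vec.map Q σ) ≤
                𝟙 (_≟ⱽ_ _≟_ (layers S S′) (Vec.map (λ p → b2n (J p) + b2n (Q p)) σ))
  joint σ with S ≟ˢ Vec.map J σ | S′ ≟ˢ Vec.map Q σ
  ... | no _ | _ = z≤n
  ... | yes _ | no _ = z≤n
  ... | yes refl | yes refl = ≤-reflexive (sym (𝟙-yes (_≟ⱽ_ _≟_ _ _) (sym (map-layers J Q σ))))
  l = layers-occ S S′ S⊆S′
  l′ = layers-occ P P′ (map-⊆ pool J⊑Q)
  eS : ∣ P ∣ ≡ ∣ S ∣
  eS = trans (∣map∣-rangeⱽ 0 n J) (sym eq)
  eS′ : ∣ P′ ∣ ≡ ∣ S′ ∣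
  eS′ = trans (∣map∣-rangeⱽ 0 n Q) (sym eq′)
  lay : ∀ κ → occ _≟_ κ (layers P P′) ≡ occ _≟_ κ (layers S S′)
  lay 0 = +-cancelˡ-≡ ∣ S′ ∣ _ _ (trans (cong (_+ occ _≟_ 0 (layers P P′)) (sym eS′))
      (trans (proj₁ (proj₂ (proj₂ l′))) (sym (proj₁ (proj₂ (proj₂ l))))))
  lay 1 = +-cancelˡ-≡ ∣ S ∣ _ _ (trans (cong (_+ occ _≟_ 1 (layers P P′)) (sym eS))
      (trans (proj₁ (proj₂ l′)) (trans eS′ (sym (proj₁ (proj₂ l))))))
  lay 2 = trans (proj₁ l′) (trans eS (sym (proj₁ l)))
  lay (suc (suc (suc κ))) = trans (proj₁ (proj₂ (proj₂ (proj₂ l′))) κ) (sym (proj₁ (proj₂ (proj₂ (proj₂ l))) κ))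
  occ-eq : ∀ κ → occ _≟_ κ (Vec.map (λ p → b2n (J p) + b2n (Q p)) pool) ≡ occ _≟_ κ (layers S S′)
  occ-eq κ = trans (cong (occ _≟_ κ) (map-layers J Q pool)) (lay κ)
  diff : ∀ a b c → a + b ≡ c → b ≡ c ∸ a
  diff a b c h = trans (sym (m+n∸m≡n a b)) (cong (_∸ a) h)
  count : arrangements _≟_ (layers S S′) ≡ (∣ S ∣) ! * (∣ S′ ∣ ∸ ∣ S ∣) ! * (n ∸ ∣ S′ ∣) !
  count = trans (proj₂ (proj₂ (proj₂ (proj₂ l)))) (cong₂ _*_ (cong₂ _*_ (cong (λ k → k !) (proj₁ l))
    (cong (λ k → k !) (diff (∣ S ∣) (occ _≟_ 1 (layers S S′)) (∣ S′ ∣) (proj₁ (proj₂ l)))))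
    (cong (λ k → k !) (diff (∣ S′ ∣) (occ _≟_ 0 (layers S S′)) n (proj₁ (proj₂ (proj₂ l))))))

!*! : ∀ a b → (suc a) ! * (suc b) ! ≤ (suc (a + b)) !
!*! a zero = ≤-reflexive (trans (*-identityʳ _) (cong (λ k → suc k !) (sym (+-identityʳ a))))
!*! a (suc b) = begin
  suc a ! * (suc (suc b) * suc b !)  ≡⟨ comm (suc a !) (suc (suc b)) (suc b !) ⟩
  suc (suc b) * (suc a ! * suc b !)  ≤⟨ *-mono-≤ (s≤s (s≤s (m≤n+m b a))) (!*! a b) ⟩
  suc (suc (a + b)) * suc (a + b) !  ≡⟨ cong (λ k → suc k !) (sym (+-suc a b)) ⟩
  suc (a + suc b) ! ∎
  where
  open ≤-Reasoning
  comm : ∀ a b c → a * (b * c) ≡ b * (a * c)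
  comm = solve-∀

<⇒∃ : ∀ {m n} → m < n → ∃ λ k → n ≡ m + suc k
<⇒∃ {m} {n} m<n = n ∸ suc m , trans (sym (m+[n∸m]≡n m<n)) (sym (+-suc m _))

-- In other words, `s` choose `a` is at least `s`. Among the orderings that put an s-set on an arc,
-- this bounds by 1/s the share that put a fixed nonempty proper subset on a given smaller arc
-- inside it.
s*!*! : ∀ a s → 1 ≤ a → a < s → s * (a ! * (s ∸ a) !) ≤ s !
s*!*! (suc a) s _ a<s with k , refl ← <⇒∃ a<s = begin
  (suc a + suc k) * (suc a ! * (suc a + suc k ∸ suc a) !) ≡⟨ cong (λ z → (suc a + suc k) * (suc a ! * z !))
      (m+n∸m≡n (suc a) (suc k)) ⟩
  (suc a + suc k) * (suc a ! * suc k !)                    ≤⟨ *-monoʳ-≤ (suc a + suc k) (!*! a k) ⟩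
  (suc a + suc k) * suc (a + k) !                          ≡⟨ cong (λ z → (suc a + suc k) * z !) (sym (+-suc a k)) ⟩
  (suc a + suc k) ! ∎
  where
  open ≤-Reasoning

-- Cyclic arcs of positions

opaque

  -- The positions -a, ..., -a + s - 1 modulo `n`: raising `s` alone extends the arc to the right,
  -- raising `a` and `s` together extends it to the left.
  arc : ∀ n → .{{NonZero n}} → ℕ → ℕ → ℕ → Bool
  arc n a s p = does ((p + a) % n <? s)

  arc⁺ : ∀ {n} .{{_ : NonZero n}} {a s p} → (p + a) % n < s → arc n a s p ≡ true
  arc⁺ = dec-true (_ <? _)

  arc⁻ : ∀ {n} .{{_ : NonZero n}} {a s p} → arc n a s p ≡ true → (p + a) % n < s
  arc⁻ {n} {a} {s} {p} h = <ᵇ⇒< ((p + a) % n) s (subst T (sym h) tt)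

module _ {n} .{{_ : NonZero n}} where

  arc-⊑ : ∀ a {s t} → s ≤ t → arc n a s ⊑ arc n a t
  arc-⊑ a s≤t p h = arc⁺ {a = a} {p = p} (≤-trans (arc⁻ {a = a} {p = p} h) s≤t)

  arc-⊑-suc : ∀ a s → arc n a s ⊑ arc n (suc a) (suc s)
  arc-⊑-suc a s p h = arc⁺ {a = suc a} {p = p} (begin-strict
    (p + suc a) % n          ≡⟨ cong (_% n) (+-suc p a) ⟩
    (1 + (p + a)) % n        ≡⟨ %-distribˡ-+ 1 (p + a) n ⟩
    (1 % n + (p + a) % n) % n ≤⟨ m%n≤m _ n ⟩
    1 % n + (p + a) % n      ≤⟨ +-monoˡ-≤ _ (m%n≤m 1 n) ⟩
    1 + (p + a) % n          <⟨ s≤s (arc⁻ {a = a} {p = p} h) ⟩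
    suc s                    ∎)
    where open ≤-Reasoning

  -- The offset `a + (n ∸ s)` makes the second arc start right after the end of the first, and
  -- together they have at most `n` positions.
  arc-disjoint : ∀ a {s t p} → s + t ≤ n → arc n a s p ≡ true → arc n (a + (n ∸ s)) t p ≡ true → ⊥
  arc-disjoint a {s} {t} {p} s+t≤n h h′ = <⇒≱ (arc⁻ {a = a + (n ∸ s)} {p = p} h′) (begin
    t                              ≤⟨ t≤u ⟩
    u                              ≤⟨ m≤n+m u _ ⟩
    (p + a) % n + u                ≡⟨ m<n⇒m%n≡m r+u<n ⟨
    ((p + a) % n + u) % n          ≡⟨ cong (λ z → ((p + a) % n + z) % n) (m<n⇒m%n≡m u<n) ⟨
    ((p + a) % n + u % n) % n      ≡⟨ %-distribˡ-+ (p + a) u n ⟨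
    (p + a + u) % n                ≡⟨ cong (_% n) (+-assoc p a u) ⟩
    (p + (a + u)) % n              ∎)
    where
    open ≤-Reasoning
    u = n ∸ s
    r<s = arc⁻ {a = a} {p = p} h
    s≤n : s ≤ n
    s≤n = ≤-trans (m≤m+n s t) s+t≤n
    t≤u : t ≤ u
    t≤u = subst (_≤ u) (m+n∸m≡n s t) (∸-monoˡ-≤ s s+t≤n)
    r+u<n : (p + a) % n + u < n
    r+u<n = subst ((p + a) % n + u <_) (m+[n∸m]≡n s≤n) (+-monoˡ-< u r<s)
    u<n : u < n
    u<n = ≤-<-trans (m≤n+m u _) r+u<n

  opaque
    unfolding arc

    arc-period : ∀ a s p → arc n (a + n) s p ≡ arc n a s p
    arc-period a s p = cong (λ z → does (z <? s)) (trans (cong (_% n) (sym (+-assoc p a n))) ([m+n]%n≡m%n (p + a) n))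

  ∑-arc : ∀ a s → s ≤ n → ∑[ p ∈ range 0 n ] 𝟙 ((p + a) % n <? s) ≡ s
  ∑-arc a s s≤n = begin
    ∑[ p ∈ range 0 n ] 𝟙 ((p + a) % n <? s) ≡⟨ ∑-range-+ a 0 n (λ p → 𝟙 (p % n <? s)) ⟩
    ∑[ p ∈ range a n ] 𝟙 (p % n <? s)       ≡⟨ ∑-rotate n _ (λ p → cong (λ z → 𝟙 (z <? s)) ([m+n]%n≡m%n p n)) a ⟩
    ∑[ p ∈ range 0 n ] 𝟙 (p % n <? s)       ≡⟨ ∑-cong (range 0 n) (λ {p} p∈ → cong (λ z → 𝟙 (z <? s))
        (m<n⇒m%n≡m (proj₂ (∈-range⁻ 0 n p∈)))) ⟩
    ∑[ p ∈ range 0 n ] 𝟙 (p <? s)           ≡⟨ ∑-𝟙< 0 n s s≤n ⟩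
    s                                        ∎
    where open ≡-Reasoning

  opaque
    unfolding arc

    size-arc : ∀ a s → s ≤ n → size n (arc n a s) ≡ s
    size-arc a s s≤n = trans (∑-cong (range 0 n) (λ {p} _ → b2n-does ((p + a) % n <? s))) (∑-arc a s s≤n)

⌈/2⌉-+ : ∀ j x → ⌈ j + j + x /2⌉ ≡ j + ⌈ x /2⌉
⌈/2⌉-+ zero    x = refl
⌈/2⌉-+ (suc j) x = trans (cong (λ z → ⌈ suc z + x /2⌉) (+-suc j j)) (cong suc (⌈/2⌉-+ j x))

x∈𝓕-count : ∀ {n} (𝓕 : List (Subset n)) → Unique 𝓕 → ∀ B (d : Dec (B ∈ 𝓕)) → 𝟙 d ≡ ∑[ A ∈ 𝓕 ] 𝟙 (A ≟ˢ B)
x∈𝓕-count 𝓕 u B (no B∉) = sym (∑-zero 𝓕 (λ {A} A∈ → 𝟙-no (A ≟ˢ B) (λ { refl → B∉ A∈ })))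
x∈𝓕-count (A ∷ 𝓕) (A≢ ∷ u) B (yes (here refl)) = sym (cong₂ _+_ (𝟙-yes (A ≟ˢ A) refl)
  (∑-zero 𝓕 (λ {C} C∈ → 𝟙-no (C ≟ˢ A) (λ { refl → All.lookup A≢ C∈ refl }))))
x∈𝓕-count (A ∷ 𝓕) (A≢ ∷ u) B (yes (there B∈)) = trans (x∈𝓕-count 𝓕 u B (yes B∈))
  (sym (cong (_+ ∑ 𝓕 (λ C → 𝟙 (C ≟ˢ B))) (𝟙-no (A ≟ˢ B) (λ { refl → All.lookup A≢ B∈ refl }))))

-- Mids of a butterfly-free family

module Family {n : ℕ} (𝓕 : List (Subset n)) (unique : Unique 𝓕)
              (intersecting : Intersecting 𝓕) (free : ButterflyFree 𝓕) where

  _∈𝓕? : ∀ B → Dec (B ∈ 𝓕)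
  B ∈𝓕? = DecMembership._∈?_ _≟ˢ_ B 𝓕

  opaque

    x : Subset n → ℕ
    x B = 𝟙 (B ∈𝓕?)

    x≤1 : ∀ A → x A ≤ 1
    x≤1 A = 𝟙≤1 (A ∈𝓕?)

    x⇒∈ : ∀ {A} → 1 ≤ x A → A ∈ 𝓕
    x⇒∈ {A} = 𝟙-pos (A ∈𝓕?)

    ∈⇒x : ∀ {A} → A ∈ 𝓕 → x A ≡ 1
    ∈⇒x {A} = 𝟙-yes (A ∈𝓕?)

    ∉⇒x : ∀ {A} → ¬ A ∈ 𝓕 → x A ≡ 0
    ∉⇒x {A} = 𝟙-no (A ∈𝓕?)

    x-count : ∀ B → x B ≡ ∑[ A ∈ 𝓕 ] 𝟙 (A ≟ˢ B)
    x-count B = x∈𝓕-count 𝓕 unique B (B ∈𝓕?)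

  -- Strictness is measured by cardinality: it is decidable, as `Mid?` requires, and `size≢` reads
  -- distinctness off it when butterflies are built.
  Below Above : Subset n → Subset n → Set
  Below M A = A ⊆ M × ∣ A ∣ < ∣ M ∣
  Above M B = M ⊆ B × ∣ M ∣ < ∣ B ∣

  Mid : Subset n → Set
  Mid M = M ∈ 𝓕 × Any (Below M) 𝓕 × Any (Above M) 𝓕

  Mid? : ∀ M → Dec (Mid M)
  Mid? M = (M ∈𝓕?) ×-dec any? (λ A → (A ⊆? M) ×-dec (∣ A ∣ <? ∣ M ∣)) 𝓕
                     ×-dec any? (λ B → (M ⊆? B) ×-dec (∣ M ∣ <? ∣ B ∣)) 𝓕

  opaque
    unfolding x

    μ : Subset n → ℕ
    μ M = 𝟙 (Mid? M)

    μ≤1 : ∀ M → μ M ≤ 1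
    μ≤1 M = 𝟙≤1 (Mid? M)

    μ⇒Mid : ∀ {M} → 1 ≤ μ M → Mid M
    μ⇒Mid {M} = 𝟙-pos (Mid? M)

    Mid⇒μ : ∀ {M} → Mid M → μ M ≡ 1
    Mid⇒μ {M} = 𝟙-yes (Mid? M)

    ¬Mid⇒μ : ∀ {M} → ¬ Mid M → μ M ≡ 0
    ¬Mid⇒μ {M} = 𝟙-no (Mid? M)

    μ≤x : ∀ M → μ M ≤ x M
    μ≤x M = 𝟙-mono (Mid? M) (M ∈𝓕?) proj₁

  size≢ : ∀ {A B : Subset n} → ∣ A ∣ < ∣ B ∣ → A ≢ B
  size≢ lt refl = <-irrefl refl lt

  -- The two lower sets with the pair M ⊂ B, or the pair A ⊂ M with the two upper sets, form a butterfly.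
  lower-unique : ∀ {M A A′} → Mid M → A ∈ 𝓕 → A′ ∈ 𝓕 → Below M A → Below M A′ → A ≡ A′
  lower-unique {M} {A} {A′} (M∈ , _ , up) A∈ A′∈ (A⊆ , a<) (A′⊆ , a′<) with A ≟ˢ A′
  ... | yes e = e
  ... | no A≢ with B , B∈ , M⊆B , m< ← find up =
    ⊥-elim (free A A′ M B A∈ A′∈ M∈ B∈ A≢ (size≢ a<) (size≢ (<-trans a< m<)) (size≢ a′<) (size≢ (<-trans a′< m<)) (size≢ m<)
      A⊆ A′⊆ (M⊆B ∘ A⊆) (M⊆B ∘ A′⊆))

  upper-unique : ∀ {M B B′} → Mid M → B ∈ 𝓕 → B′ ∈ 𝓕 → Above M B → Above M B′ → B ≡ B′
  upper-unique {M} {B} {B′} (M∈ , low , _) B∈ B′∈ (⊆B , b<) (⊆B′ , b′<) with B ≟ˢ B′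
  ... | yes e = e
  ... | no B≢ with A , A∈ , A⊆M , a< ← find low =
    ⊥-elim (free A M B B′ A∈ M∈ B∈ B′∈ (size≢ a<) (size≢ (<-trans a< b<)) (size≢ (<-trans a< b′<)) (size≢ b<) (size≢ b′<) B≢
      (⊆B ∘ A⊆M) ⊆B (⊆B′ ∘ A⊆M) ⊆B′)

  -- Both `M′` and the member above `M′` would lie above `M`, against `upper-unique`.
  mid-mid : ∀ {M M′} → Mid M → Mid M′ → M ⊆ M′ → ∣ M ∣ < ∣ M′ ∣ → ⊥
  mid-mid mid (M′∈ , _ , up) M⊆M′ m< with B , B∈ , M′⊆B , m′< ← find up =
    size≢ m′< (upper-unique mid M′∈ B∈ (M⊆M′ , m<) (M′⊆B ∘ M⊆M′ , <-trans m< m′<))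

  ∈𝓕⇒nonempty : ∀ {A} → A ∈ 𝓕 → 1 ≤ ∣ A ∣
  ∈𝓕⇒nonempty {A} A∈ with e , e∈ ← intersecting A A A∈ A∈ = pos A (proj₁ (x∈p∩q⁻ A A e∈))
    where
    pos : ∀ {n} (A : Subset n) {e} → e ∈ˢ A → 1 ≤ ∣ A ∣
    pos (true ∷ A)  Vec.here       = s≤s z≤n
    pos (true ∷ A)  (Vec.there e∈) = s≤s z≤n
    pos (false ∷ A) (Vec.there e∈) = pos A e∈

  disjoint-∉ : ∀ {A B} → A ∈ 𝓕 → (∀ {e} → e ∈ˢ A → e ∈ˢ B → ⊥) → B ∈ 𝓕 → ⊥
  disjoint-∉ {A} {B} A∈ dis B∈ with e , e∈ ← intersecting A B A∈ B∈ with p , q ← x∈p∩q⁻ A B e∈ = dis p q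

  ∑-Ω-x : ∀ J → ∑[ σ ∈ Ω n ] x (Vec.map J σ) ≡ ∑[ A ∈ 𝓕 ] (𝟙 (size n J ≟ ∣ A ∣) * (∣ A ∣ ! * (n ∸ ∣ A ∣) !))
  ∑-Ω-x J = trans (∑-cong (Ω n) (λ {σ} _ → x-count (Vec.map J σ)))
    (trans (∑-swap (Ω n) 𝓕 _) (∑-cong 𝓕 (λ {A} _ → per A)))
    where
    per : ∀ A → ∑[ σ ∈ Ω n ] 𝟙 (A ≟ˢ Vec.map J σ) ≡ 𝟙 (size n J ≟ ∣ A ∣) * (∣ A ∣ ! * (n ∸ ∣ A ∣) !)
    per A with size n J ≟ ∣ A ∣
    ... | yes e = trans (∑-Ω-set J A (sym e)) (sym (+-identityʳ _))
    ... | no ne = ∑-zero (Ω n) (λ {σ} σ∈ → 𝟙-no (A ≟ˢ Vec.map J σ) (λ { refl → ne (sym (∣map∣ J σ∈)) }))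

  -- Both sides of a mid in one frame. `J` carries the mid, the `Q s` are the arcs on one side, and
  -- the only member that can occur on them is the partner `D`. Given that `M` occupies `J`, this
  -- happens with probability at most 1/c, so the mean number of members on that side is at most 1/c
  -- per mid.
  module _ (J : ℕ → Bool) (Q : ℕ → ℕ → Bool) (a l c : ℕ)
           (size-Q : ∀ s → a ≤ s → s < a + l → size n (Q s) ≡ s)
           (partner : ∀ M → Mid M → ∣ M ∣ ≡ size n J → ∃ λ D → D ∈ 𝓕 × a ≤ ∣ D ∣ × ∣ D ∣ < a + l ×
             (∀ {σ s} → σ ∈ Ω n → a ≤ s → s < a + l → Vec.map J σ ≡ M → Vec.map (Q s) σ ∈ 𝓕 → Vec.map (Q s) σ ≡ D) ×
             c * ∑[ σ ∈ Ω n ] (𝟙 (D ≟ˢ Vec.map (Q ∣ D ∣) σ) * 𝟙 (M ≟ˢ Vec.map J σ)) ≤ ∑[ σ ∈ Ω n ] 𝟙 (M ≟ˢ Vec.map J σ)) where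

    private
      h : Vec ℕ n → ℕ
      h σ = ∑[ s ∈ range a l ] x (Vec.map (Q s) σ)

      -- Splits the orderings by the mid that occupies the arc, so that each mid can be treated with
      -- its own partner.
      μ-expand : ∀ B → μ B ≡ ∑[ M ∈ 𝓕 ] (μ M * 𝟙 (M ≟ˢ B))
      μ-expand B with Mid? B
      ... | yes mid = trans (Mid⇒μ mid) (sym (trans (∑-cong 𝓕 (λ {M} _ → at M)) (trans (sym (x-count B)) (∈⇒x (proj₁ mid)))))
        where
        at : ∀ M → μ M * 𝟙 (M ≟ˢ B) ≡ 𝟙 (M ≟ˢ B)
        at M with M ≟ˢ B
        ... | yes refl = cong (_* 1) (Mid⇒μ mid)
        ... | no _ = *-zeroʳ (μ M)
      ... | no ¬mid = trans (¬Mid⇒μ ¬mid) (sym (∑-zero 𝓕 (λ {M} _ → at M)))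
        where
        at : ∀ M → μ M * 𝟙 (M ≟ˢ B) ≡ 0
        at M with M ≟ˢ B
        ... | yes refl = cong (_* 1) (¬Mid⇒μ ¬mid)
        ... | no _ = *-zeroʳ (μ M)

      at-M : ∀ M → c * ∑[ σ ∈ Ω n ] (μ M * 𝟙 (M ≟ˢ Vec.map J σ) * h σ) ≤ ∑[ σ ∈ Ω n ] (μ M * 𝟙 (M ≟ˢ Vec.map J σ))
      at-M M with Mid? M | ∣ M ∣ ≟ size n J
      ... | no ¬mid | _ = ≤-trans (≤-reflexive (trans (cong (c *_) (∑-zero (Ω n)
          (λ {σ} _ → cong (λ z → z * 𝟙 (M ≟ˢ Vec.map J σ) * h σ) (¬Mid⇒μ ¬mid)))) (*-zeroʳ c))) z≤n
      ... | yes _ | no ne = ≤-trans (≤-reflexive (trans (cong (c *_) (∑-zero (Ω n) (λ {σ} σ∈ →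
              trans (cong (λ z → μ M * z * h σ) (𝟙-no (M ≟ˢ Vec.map J σ) (λ { refl → ne (∣map∣ J σ∈) })))
                  (cong (_* h σ) (*-zeroʳ (μ M)))))) (*-zeroʳ c))) z≤n
      ... | yes mid | yes e with D , D∈ , a≤ , <l , only , bound ← partner M mid e = begin
        c * ∑[ σ ∈ Ω n ] (μ M * 𝟙 (M ≟ˢ Vec.map J σ) * h σ)
          ≡⟨ cong (c *_) (∑-cong (Ω n) (λ {σ} _ → cong (λ z → z * 𝟙 (M ≟ˢ Vec.map J σ) * h σ) (Mid⇒μ mid))) ⟩
        c * ∑[ σ ∈ Ω n ] ((𝟙 (M ≟ˢ Vec.map J σ) + 0) * h σ)
          ≤⟨ *-monoʳ-≤ c (∑-mono (Ω n) (λ {σ} σ∈ → step σ σ∈)) ⟩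
        c * ∑[ σ ∈ Ω n ] (𝟙 (D ≟ˢ Vec.map (Q ∣ D ∣) σ) * 𝟙 (M ≟ˢ Vec.map J σ))
          ≤⟨ bound ⟩
        ∑[ σ ∈ Ω n ] 𝟙 (M ≟ˢ Vec.map J σ)
          ≡⟨ ∑-cong (Ω n) (λ {σ} _ → trans (sym (+-identityʳ _)) (cong (_* 𝟙 (M ≟ˢ Vec.map J σ)) (sym (Mid⇒μ mid)))) ⟩
        ∑[ σ ∈ Ω n ] (μ M * 𝟙 (M ≟ˢ Vec.map J σ)) ∎
        where
        open ≤-Reasoning
        step : ∀ σ → σ ∈ Ω n → (𝟙 (M ≟ˢ Vec.map J σ) + 0) * h σ ≤ 𝟙 (D ≟ˢ Vec.map (Q ∣ D ∣) σ) * 𝟙 (M ≟ˢ Vec.map J σ)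
        step σ σ∈ with M ≟ˢ Vec.map J σ
        ... | no _ = z≤n
        ... | yes M≡ = begin
          h σ + 0 ≡⟨ +-identityʳ _ ⟩
          h σ     ≤⟨ ∑-mono (range a l) (λ {s} s∈ → term s (∈-range⁻ a l s∈)) ⟩
          ∑[ s ∈ range a l ] (𝟙 (∣ D ∣ ≟ s) * 𝟙 (D ≟ˢ Vec.map (Q s) σ)) ≡⟨ ∑-𝟙≟ a l ∣ D ∣ _ a≤ <l ⟩
          𝟙 (D ≟ˢ Vec.map (Q ∣ D ∣) σ)      ≡⟨ *-identityʳ _ ⟨
          𝟙 (D ≟ˢ Vec.map (Q ∣ D ∣) σ) * 1  ∎
          where
          term : ∀ s → a ≤ s × s < a + l → x (Vec.map (Q s) σ) ≤ 𝟙 (∣ D ∣ ≟ s) * 𝟙 (D ≟ˢ Vec.map (Q s) σ)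
          term s (p , q) with Vec.map (Q s) σ ∈𝓕?
          ... | no ∉ = ≤-trans (≤-reflexive (∉⇒x ∉)) z≤n
          ... | yes y with e′ ← only σ∈ p q (sym M≡) y =
            ≤-reflexive (trans (∈⇒x y) (sym (cong₂ _*_ (𝟙-yes (∣ D ∣ ≟ s)
                (trans (cong ∣_∣ (sym e′)) (trans (∣map∣ (Q s) σ∈) (size-Q s p q))))
              (𝟙-yes (D ≟ˢ _) (sym e′)))))

    ∑-mid-others : c * ∑[ σ ∈ Ω n ] (μ (Vec.map J σ) * h σ) ≤ ∑[ σ ∈ Ω n ] μ (Vec.map J σ)
    ∑-mid-others = begin
      c * ∑[ σ ∈ Ω n ] (μ (Vec.map J σ) * h σ)
        ≡⟨ cong (c *_) (trans (∑-cong (Ω n) (λ {σ} _ → trans (cong (_* h σ) (μ-expand (Vec.map J σ)))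
            (sym (∑-*ʳ (h σ) 𝓕 _)))) (∑-swap (Ω n) 𝓕 _)) ⟩
      c * ∑[ M ∈ 𝓕 ] ∑[ σ ∈ Ω n ] (μ M * 𝟙 (M ≟ˢ Vec.map J σ) * h σ)
        ≡⟨ ∑-*ˡ c 𝓕 _ ⟨
      ∑[ M ∈ 𝓕 ] (c * ∑[ σ ∈ Ω n ] (μ M * 𝟙 (M ≟ˢ Vec.map J σ) * h σ))
        ≤⟨ ∑-mono 𝓕 (λ {M} _ → at-M M) ⟩
      ∑[ M ∈ 𝓕 ] ∑[ σ ∈ Ω n ] (μ M * 𝟙 (M ≟ˢ Vec.map J σ))
        ≡⟨ trans (∑-cong (Ω n) (λ {σ} _ → μ-expand (Vec.map J σ))) (∑-swap (Ω n) 𝓕 _) ⟨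
      ∑[ σ ∈ Ω n ] μ (Vec.map J σ) ∎
      where open ≤-Reasoning

-- Binomial coefficients and averages over all orderings

C-! : ∀ n k → k ≤ n → (n choose k) * (k ! * (n ∸ k) !) ≡ n !
C-! n k k≤n = trans (cong (_* (k ! * (n ∸ k) !)) (nCk≡n!/k![n-k]! k≤n)) (m/n*n≡m (k![n∸k]!∣n! k≤n))
  where instance _ = (k !* (n ∸ k) !≢0)

!-pos : ∀ n → 1 ≤ n !
!-pos n = n≢0⇒n>0 (λ e → ≢-nonZero⁻¹ (n !) {{n !≢0}} e)

C-pos : ∀ n k → k ≤ n → 1 ≤ n choose k
C-pos n k k≤n with n choose k in eq
... | suc _ = s≤s z≤n
... | zero = ⊥-elim (<⇒≱ (!-pos n) (≤-reflexive (trans (sym (C-! n k k≤n)) (cong (_* (k ! * (n ∸ k) !)) eq))))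

*-cancel-pos : ∀ {a b} c → 1 ≤ c → c * a ≡ c * b → a ≡ b
*-cancel-pos (suc c) _ e = *-cancelˡ-≡ _ _ (suc c) e

*-cancel-≤-pos : ∀ {a b} c → 1 ≤ c → c * a ≤ c * b → a ≤ b
*-cancel-≤-pos (suc c) _ e = *-cancelˡ-≤ (suc c) e

suc-∸ : ∀ {n k} → k < n → n ∸ k ≡ suc (n ∸ suc k)
suc-∸ {n} {k} k<n = +-∸-assoc 1 k<n

[k+1]C[k+1]≡[n-k]Ck : ∀ n k → k < n → suc k * (n choose suc k) ≡ (n ∸ k) * (n choose k)
[k+1]C[k+1]≡[n-k]Ck n k k<n = *-cancel-pos (k ! * j !) (*-mono-≤ (!-pos k) (!-pos j)) (begin
  k ! * j ! * (suc k * (n choose suc k))        ≡⟨ r₁ (k !) (j !) (suc k) (n choose suc k) ⟩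
  (n choose suc k) * (suc k ! * j !)            ≡⟨ C-! n (suc k) k<n ⟩
  n !                                       ≡⟨ C-! n k (<⇒≤ k<n) ⟨
  (n choose k) * (k ! * (n ∸ k) !)              ≡⟨ cong (λ z → (n choose k) * (k ! * z !)) (suc-∸ k<n) ⟩
  (n choose k) * (k ! * (suc j * j !))          ≡⟨ r₂ (n choose k) (k !) (suc j) (j !) ⟩
  k ! * j ! * (suc j * (n choose k))            ≡⟨ cong (λ z → k ! * j ! * (z * (n choose k))) (suc-∸ k<n) ⟨
  k ! * j ! * ((n ∸ k) * (n choose k))          ∎)
  where
  open ≡-Reasoning
  j = n ∸ suc k
  r₁ : ∀ a b c d → a * b * (c * d) ≡ d * (c * a * b)
  r₁ = solve-∀
  r₂ : ∀ a b c d → a * (b * (c * d)) ≡ b * d * (c * a)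
  r₂ = solve-∀

[n+1]Ck≡[n+1-k]C : ∀ n k → k ≤ n → suc n * (n choose k) ≡ (suc n ∸ k) * (suc n choose k)
[n+1]Ck≡[n+1-k]C n k k≤n = *-cancel-pos (k ! * j !) (*-mono-≤ (!-pos k) (!-pos j)) (begin
  k ! * j ! * (suc n * (n choose k))            ≡⟨ r₁ (k !) (j !) (suc n) (n choose k) ⟩
  suc n * ((n choose k) * (k ! * j !))          ≡⟨ cong (suc n *_) (C-! n k k≤n) ⟩
  suc n !                                   ≡⟨ C-! (suc n) k (m≤n⇒m≤1+n k≤n) ⟨
  (suc n choose k) * (k ! * (suc n ∸ k) !)      ≡⟨ cong (λ z → (suc n choose k) * (k ! * z !)) (suc-∸ (s≤s k≤n)) ⟩
  (suc n choose k) * (k ! * (suc j * j !))      ≡⟨ r₂ (suc n choose k) (k !) (suc j) (j !) ⟩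
  k ! * j ! * (suc j * (suc n choose k))        ≡⟨ cong (λ z → k ! * j ! * (z * (suc n choose k))) (suc-∸ (s≤s k≤n)) ⟨
  k ! * j ! * ((suc n ∸ k) * (suc n choose k))  ∎)
  where
  open ≡-Reasoning
  j = n ∸ k
  r₁ : ∀ a b c d → a * b * (c * d) ≡ c * (d * (a * b))
  r₁ = solve-∀
  r₂ : ∀ a b c d → a * (b * (c * d)) ≡ b * d * (c * a)
  r₂ = solve-∀

C-step : ∀ n k → suc k ≤ n ∸ k → n choose k ≤ n choose suc k
C-step n k h = *-cancel-≤-pos (suc k) (s≤s z≤n) (begin
  suc k * (n choose k)      ≤⟨ *-monoˡ-≤ (n choose k) h ⟩
  (n ∸ k) * (n choose k)    ≡⟨ [k+1]C[k+1]≡[n-k]Ck n k k<n ⟨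
  suc k * (n choose suc k)  ∎)
  where
  open ≤-Reasoning
  k<n : k < n
  k<n with k <? n
  ... | yes p = p
  ... | no ¬p = ⊥-elim (<⇒≱ (s≤s (z≤n {k})) (subst (suc k ≤_) (m≤n⇒m∸n≡0 (≮⇒≥ ¬p)) h))

C-mono : ∀ n s d → (s + d) + (s + d) ≤ suc n → n choose s ≤ n choose (s + d)
C-mono n s zero    h = ≤-reflexive (cong (n choose_) (sym (+-identityʳ s)))
C-mono n s (suc d) h rewrite +-suc s d = ≤-trans (C-mono n s d (≤-trans (m≤n⇒m≤1+n (+-monoʳ-≤ (s + d) (n≤1+n _))) h))
  (C-step n (s + d) (m+n≤o⇒m≤o∸n (suc (s + d)) (≤-pred (subst (_≤ suc n) (cong suc (+-suc (s + d) (s + d))) h))))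

C-mono-≤ : ∀ n {s t} → s ≤ t → t + t ≤ suc n → n choose s ≤ n choose t
C-mono-≤ n {s} {t} s≤t h with d , refl ← m≤n⇒∃[o]m+o≡n s≤t = C-mono n s d h

C-anti-≤ : ∀ n {s t} → s ≤ n → t ≤ s → (n ∸ t) + (n ∸ t) ≤ suc n → n choose s ≤ n choose t
C-anti-≤ n {s} {t} s≤n t≤s h = subst₂ _≤_ (sym (nCk≡nC[n∸k] s≤n)) (sym (nCk≡nC[n∸k] (≤-trans t≤s s≤n)))
  (C-mono-≤ n (∸-monoʳ-≤ n t≤s) h)

<-pred⇒< : ∀ s {t} → 1 ≤ t → t < 1 + (s ∸ 1) → t < s
<-pred⇒< zero    1≤t t< = ⊥-elim (<⇒≱ t< 1≤t)
<-pred⇒< (suc _) 1≤t t< = t<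

<⇒<-pred : ∀ s {t} → t < s → t < 1 + (s ∸ 1)
<⇒<-pred (suc _) t< = t<

module Arcs {n : ℕ} .{{nz : NonZero n}} (𝓕 : List (Subset n)) (unique : Unique 𝓕)
            (intersecting : Intersecting 𝓕) (free : ButterflyFree 𝓕) where

  open Family 𝓕 unique intersecting free

  -- The weight `n choose s` cancels against the s! (n - s)! orderings that put a given set on its
  -- arc, so every member of size below `n` contributes exactly `n !`. An intersecting family has no
  -- empty member, hence the start at size 1.
  ∑-Ω-weights : (J : ℕ → ℕ → Bool) → (∀ s → 1 ≤ s → s < n → size n (J s) ≡ s) →
    ∑[ σ ∈ Ω n ] ∑[ s ∈ range 1 (n ∸ 1) ] ((n choose s) * x (Vec.map (J s) σ)) ≡ n ! * ∑[ A ∈ 𝓕 ] 𝟙 (∣ A ∣ <? n)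
  ∑-Ω-weights J size-J = begin
    ∑[ σ ∈ Ω n ] ∑[ s ∈ range 1 (n ∸ 1) ] ((n choose s) * x (Vec.map (J s) σ))
      ≡⟨ ∑-swap (Ω n) (range 1 (n ∸ 1)) _ ⟩
    ∑[ s ∈ range 1 (n ∸ 1) ] ∑[ σ ∈ Ω n ] ((n choose s) * x (Vec.map (J s) σ))
      ≡⟨ ∑-cong (range 1 (n ∸ 1)) (λ {s} s∈ → let (1≤s , s<n) = inRange s∈ in
           trans (∑-*ˡ (n choose s) (Ω n) _) (trans (cong ((n choose s) *_) (∑-Ω-x (J s))) (trans (sym (∑-*ˡ (n choose s) 𝓕 _))
             (∑-cong 𝓕 (λ {A} _ → term s A 1≤s s<n))))) ⟩
    ∑[ s ∈ range 1 (n ∸ 1) ] ∑[ A ∈ 𝓕 ] (𝟙 (∣ A ∣ ≟ s) * n !)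
      ≡⟨ ∑-swap (range 1 (n ∸ 1)) 𝓕 _ ⟩
    ∑[ A ∈ 𝓕 ] ∑[ s ∈ range 1 (n ∸ 1) ] (𝟙 (∣ A ∣ ≟ s) * n !)
      ≡⟨ ∑-cong 𝓕 (λ {A} A∈ → whole A A∈) ⟩
    ∑[ A ∈ 𝓕 ] (n ! * 𝟙 (∣ A ∣ <? n))
      ≡⟨ ∑-*ˡ (n !) 𝓕 _ ⟩
    n ! * ∑[ A ∈ 𝓕 ] 𝟙 (∣ A ∣ <? n) ∎
    where
    open ≡-Reasoning
    1+[n-1] : 1 + (n ∸ 1) ≡ n
    1+[n-1] = m+[n∸m]≡n (n≢0⇒n>0 (λ e → ≢-nonZero⁻¹ n e))
    inRange : ∀ {s} → s ∈ range 1 (n ∸ 1) → 1 ≤ s × s < n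
    inRange s∈ with p , q ← ∈-range⁻ 1 (n ∸ 1) s∈ = p , subst (_ <_) 1+[n-1] q
    term : ∀ s A → 1 ≤ s → s < n → (n choose s) * (𝟙 (size n (J s) ≟ ∣ A ∣) * (∣ A ∣ ! * (n ∸ ∣ A ∣) !)) ≡ 𝟙 (∣ A ∣ ≟ s) * n !
    term s A 1≤s s<n with ∣ A ∣ ≟ s
    ... | yes e = trans (cong₂ (λ z k → (n choose s) * (z * (k ! * (n ∸ k) !)))
        (𝟙-yes (size n (J s) ≟ ∣ A ∣) (trans (size-J s 1≤s s<n) (sym e))) e)
      (trans (cong ((n choose s) *_) (+-identityʳ _)) (trans (C-! n s (<⇒≤ s<n)) (sym (+-identityʳ _))))
    ... | no ne = trans (cong (λ z → (n choose s) * (z * (∣ A ∣ ! * (n ∸ ∣ A ∣) !)))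
          (𝟙-no (size n (J s) ≟ ∣ A ∣) (λ e → ne (trans (sym e) (size-J s 1≤s s<n))))) (*-zeroʳ (n choose s))
    whole : ∀ A → A ∈ 𝓕 → ∑[ s ∈ range 1 (n ∸ 1) ] (𝟙 (∣ A ∣ ≟ s) * n !) ≡ n ! * 𝟙 (∣ A ∣ <? n)
    whole A A∈ with ∣ A ∣ <? n
    ... | yes lt = trans (∑-𝟙≟ 1 (n ∸ 1) (∣ A ∣) (λ _ → n !) (∈𝓕⇒nonempty A∈) (subst (∣ A ∣ <_) (sym 1+[n-1]) lt))
        (sym (*-identityʳ (n !)))
    ... | no ¬lt = trans (∑-zero (range 1 (n ∸ 1)) (λ {s} s∈ → cong (_* n !)
        (𝟙-no (∣ A ∣ ≟ s) (λ e → ¬lt (subst (_< n) (sym e) (proj₂ (inRange s∈))))))) (sym (*-zeroʳ (n !)))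

  -- The offsets `o` are free: the arcs `Q t` have only to be comparable with `J`, so the bounds
  -- apply to the chain of `J` and to the neighbouring chain alike.
  module _ (J : ℕ → Bool) (s : ℕ) (size-J : size n J ≡ s) (o : ℕ → ℕ) where

    private
      Q : ℕ → ℕ → Bool
      Q t = arc n (o t) t

    -- Of the orderings with `M` on `J`, those with the unique lower partner `A` on its arc have a
    -- share of at most a! (s - a)! / s!, hence at most 1/s.
    ∑-mid-below : s ≤ n → (∀ t → t < s → Q t ⊑ J) →
      s * ∑[ σ ∈ Ω n ] (μ (Vec.map J σ) * ∑[ t ∈ range 1 (s ∸ 1) ] x (Vec.map (Q t) σ)) ≤ ∑[ σ ∈ Ω n ] μ (Vec.map J σ)
    ∑-mid-below s≤n Q⊑J = ∑-mid-others J Q 1 (s ∸ 1) s (λ t 1≤t t< → size-arc (o t) t (≤-trans (<⇒≤ (below t< 1≤t)) s≤n)) partner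
      where
      below : ∀ {t} → t < 1 + (s ∸ 1) → 1 ≤ t → t < s
      below t< 1≤t = <-pred⇒< s 1≤t t<
      partner : ∀ M → Mid M → ∣ M ∣ ≡ size n J → _
      partner M mid e with A , A∈ , A⊆M , a< ← find (proj₁ (proj₂ mid)) =
        A , A∈ , ∈𝓕⇒nonempty A∈ , a<′ ,
        (λ {σ} {t} σ∈ 1≤t t< M≡ Q∈ → lower-unique mid Q∈ A∈
          (subst (Vec.map (Q t) σ ⊆_) M≡ (map-⊆ σ (Q⊑J t (below t< 1≤t))) ,
           subst₂ _<_ (sym (trans (∣map∣ (Q t) σ∈) (size-arc (o t) t (≤-trans (<⇒≤ (below t< 1≤t)) s≤n)))) (sym |M|)
               (below t< 1≤t))
          (A⊆M , a<)) ,
        bound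
        where
        open ≤-Reasoning
        |M| : ∣ M ∣ ≡ s
        |M| = trans e size-J
        a<s : ∣ A ∣ < s
        a<s = subst (∣ A ∣ <_) |M| a<
        a<′ : ∣ A ∣ < 1 + (s ∸ 1)
        a<′ = <⇒<-pred s a<s
        bound : s * ∑[ σ ∈ Ω n ] (𝟙 (A ≟ˢ Vec.map (Q ∣ A ∣) σ) * 𝟙 (M ≟ˢ Vec.map J σ)) ≤ ∑[ σ ∈ Ω n ] 𝟙 (M ≟ˢ Vec.map J σ)
        bound = begin
          s * ∑[ σ ∈ Ω n ] (𝟙 (A ≟ˢ Vec.map (Q ∣ A ∣) σ) * 𝟙 (M ≟ˢ Vec.map J σ))
            ≤⟨ *-monoʳ-≤ s (∑-Ω-nested (Q ∣ A ∣) J A M (Q⊑J ∣ A ∣ a<s) A⊆M (sym (size-arc (o ∣ A ∣) ∣ A ∣ (∣p∣≤n A))) e) ⟩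
          s * (∣ A ∣ ! * (∣ M ∣ ∸ ∣ A ∣) ! * (n ∸ ∣ M ∣) !)
            ≡⟨ trans (sym (*-assoc s (∣ A ∣ ! * (∣ M ∣ ∸ ∣ A ∣) !) _))
                (cong (λ z → z * (∣ A ∣ ! * (∣ M ∣ ∸ ∣ A ∣) !) * (n ∸ ∣ M ∣) !) (sym |M|)) ⟩
          ∣ M ∣ * (∣ A ∣ ! * (∣ M ∣ ∸ ∣ A ∣) !) * (n ∸ ∣ M ∣) !
            ≤⟨ *-monoˡ-≤ _ (s*!*! ∣ A ∣ ∣ M ∣ (∈𝓕⇒nonempty A∈) a<) ⟩
          ∣ M ∣ ! * (n ∸ ∣ M ∣) ! ≡⟨ ∑-Ω-set J M e ⟨
          ∑[ σ ∈ Ω n ] 𝟙 (M ≟ˢ Vec.map J σ) ∎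

    -- The dual count outside `M`: the share is at most (b - s)! (n - b)! / (n - s)!, hence at most
    -- 1/(n - s). Properness gives b < n, as `s*!*!` requires.
    ∑-mid-above : (∀ {B} → B ∈ 𝓕 → ∣ B ∣ < n) → s < n → (∀ t → s < t → t < n → J ⊑ Q t) →
      (n ∸ s) * ∑[ σ ∈ Ω n ] (μ (Vec.map J σ) * ∑[ t ∈ range (suc s) (n ∸ suc s) ] x (Vec.map (Q t) σ)) ≤ ∑[ σ ∈ Ω n ] μ
          (Vec.map J σ)
    ∑-mid-above proper s<n J⊑Q = ∑-mid-others J Q (suc s) (n ∸ suc s) (n ∸ s)
        (λ t s<t t< → size-arc (o t) t (<⇒≤ (above t<))) partner
      where
      above : ∀ {t} → t < suc s + (n ∸ suc s) → t < n
      above {t} = subst (t <_) (m+[n∸m]≡n s<n)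
      partner : ∀ M → Mid M → ∣ M ∣ ≡ size n J → _
      partner M mid e with B , B∈ , M⊆B , m< ← find (proj₂ (proj₂ mid)) =
        B , B∈ , subst (_< ∣ B ∣) |M| m< , subst (∣ B ∣ <_) (sym (m+[n∸m]≡n s<n)) (proper B∈) ,
        (λ {σ} {t} σ∈ s<t t< M≡ Q∈ → upper-unique mid Q∈ B∈
          (subst (_⊆ Vec.map (Q t) σ) M≡ (map-⊆ σ (J⊑Q t s<t (above t<))) ,
           subst₂ _<_ (sym |M|) (sym (trans (∣map∣ (Q t) σ∈) (size-arc (o t) t (<⇒≤ (above t<))))) s<t)
          (M⊆B , m<)) ,
        bound
        where
        open ≤-Reasoning
        |M| : ∣ M ∣ ≡ s
        |M| = trans e size-J
        b = ∣ B ∣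
        m = ∣ M ∣
        r : ∀ a b c d → a * (b * c * d) ≡ b * (a * (c * d))
        r = solve-∀
        bound : (n ∸ s) * ∑[ σ ∈ Ω n ] (𝟙 (B ≟ˢ Vec.map (Q b) σ) * 𝟙 (M ≟ˢ Vec.map J σ)) ≤ ∑[ σ ∈ Ω n ] 𝟙 (M ≟ˢ Vec.map J σ)
        bound = begin
          (n ∸ s) * ∑[ σ ∈ Ω n ] (𝟙 (B ≟ˢ Vec.map (Q b) σ) * 𝟙 (M ≟ˢ Vec.map J σ))
            ≡⟨ cong ((n ∸ s) *_) (∑-cong (Ω n) (λ {σ} _ → *-comm (𝟙 (B ≟ˢ Vec.map (Q b) σ)) _)) ⟩
          (n ∸ s) * ∑[ σ ∈ Ω n ] (𝟙 (M ≟ˢ Vec.map J σ) * 𝟙 (B ≟ˢ Vec.map (Q b) σ))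
            ≤⟨ *-monoʳ-≤ (n ∸ s) (∑-Ω-nested J (Q b) M B (J⊑Q b (subst (_< b) |M| m<) (proper B∈)) M⊆B e
                (sym (size-arc (o b) b (∣p∣≤n B)))) ⟩
          (n ∸ s) * (m ! * (b ∸ m) ! * (n ∸ b) !)
            ≡⟨ trans (cong (λ z → (n ∸ z) * (m ! * (b ∸ m) ! * (n ∸ b) !)) (sym |M|)) (r (n ∸ m) (m !) ((b ∸ m) !) ((n ∸ b) !)) ⟩
          m ! * ((n ∸ m) * ((b ∸ m) ! * (n ∸ b) !))
            ≡⟨ cong (λ z → m ! * ((n ∸ m) * ((b ∸ m) ! * z !))) n-b ⟩
          m ! * ((n ∸ m) * ((b ∸ m) ! * ((n ∸ m) ∸ (b ∸ m)) !))
            ≤⟨ *-monoʳ-≤ (m !) (s*!*! (b ∸ m) (n ∸ m) (m<n⇒0<n∸m m<) (∸-monoˡ-< (proper B∈) (<⇒≤ m<))) ⟩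
          m ! * (n ∸ m) ! ≡⟨ ∑-Ω-set J M e ⟨
          ∑[ σ ∈ Ω n ] 𝟙 (M ≟ˢ Vec.map J σ) ∎
          where
          n-b : n ∸ b ≡ (n ∸ m) ∸ (b ∸ m)
          n-b = sym (trans (∸-+-assoc n m (b ∸ m)) (cong (n ∸_) (m+[n∸m]≡n (<⇒≤ m<))))

    others : Vec ℕ n → ℕ
    others σ = ∑[ t ∈ range 1 (s ∸ 1) ] x (Vec.map (Q t) σ) + ∑[ t ∈ range (suc s) (n ∸ suc s) ] x (Vec.map (Q t) σ)

    -- The rates of the two sides add up: 1/s + 1/(n - s) = n / (s (n - s)).
    ∑-mid-others-arc : (∀ {B} → B ∈ 𝓕 → ∣ B ∣ < n) → s < n →
      (∀ t → t < s → Q t ⊑ J) → (∀ t → s < t → t < n → J ⊑ Q t) →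
      (s * (n ∸ s)) * ∑[ σ ∈ Ω n ] (μ (Vec.map J σ) * others σ) ≤ n * ∑[ σ ∈ Ω n ] μ (Vec.map J σ)
    ∑-mid-others-arc proper s<n Q⊑J J⊑Q = begin
      s * (n ∸ s) * ∑[ σ ∈ Ω n ] (μ (Vec.map J σ) * others σ)
        ≡⟨ cong (s * (n ∸ s) *_) (trans (∑-cong (Ω n) (λ {σ} _ → *-distribˡ-+ (μ (Vec.map J σ)) _ _)) (∑-+ (Ω n) _ _)) ⟩
      s * (n ∸ s) * (Z₁ + Z₂)                   ≡⟨ r s (n ∸ s) Z₁ Z₂ ⟩
      (n ∸ s) * (s * Z₁) + s * ((n ∸ s) * Z₂)   ≤⟨ +-mono-≤ (*-monoʳ-≤ (n ∸ s) (∑-mid-below (<⇒≤ s<n) Q⊑J))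
          (*-monoʳ-≤ s (∑-mid-above proper s<n J⊑Q)) ⟩
      (n ∸ s) * U + s * U                       ≡⟨ *-distribʳ-+ U (n ∸ s) s ⟨
      (n ∸ s + s) * U                           ≡⟨ cong (_* U) (m∸n+n≡m (<⇒≤ s<n)) ⟩
      n * U ∎
      where
      open ≤-Reasoning
      U = ∑[ σ ∈ Ω n ] μ (Vec.map J σ)
      Z₁ = ∑[ σ ∈ Ω n ] (μ (Vec.map J σ) * ∑[ t ∈ range 1 (s ∸ 1) ] x (Vec.map (Q t) σ))
      Z₂ = ∑[ σ ∈ Ω n ] (μ (Vec.map J σ) * ∑[ t ∈ range (suc s) (n ∸ suc s) ] x (Vec.map (Q t) σ))
      r : ∀ s t a b → s * t * (a + b) ≡ t * (s * a) + s * (t * b)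
      r = solve-∀

-- Members along the chains of arcs of one ordering

even : ℕ → Bool
even zero    = true
even (suc n) = not (even n)

even-+ : ∀ m → even (m + m) ≡ true
even-+ zero    = refl
even-+ (suc m) rewrite +-suc m m | even-+ m = refl

pos⊎0 : ∀ a → 1 ≤ a ⊎ a ≡ 0
pos⊎0 zero    = inj₂ refl
pos⊎0 (suc a) = inj₁ (s≤s z≤n)

≤1⇒≡1 : ∀ {a} → a ≤ 1 → 1 ≤ a → a ≡ 1
≤1⇒≡1 = ≤-antisym

module Chains {n : ℕ} (𝓕 : List (Subset n)) (unique : Unique 𝓕)
              (intersecting : Intersecting 𝓕) (free : ButterflyFree 𝓕) where

  open Family 𝓕 unique intersecting free

  -- Sizes 0 and `n` are left out: the empty set is never a member, and the full set is dealt with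
  -- separately.
  count : (ℕ → Subset n) → ℕ
  mids : (ℕ → Subset n) → ℕ
  count c = ∑[ s ∈ range 1 (n ∸ 1) ] x (c s)
  mids c  = ∑[ s ∈ range 1 (n ∸ 1) ] μ (c s)

  rest : (ℕ → Subset n) → ℕ → ℕ
  rest c s = ∑[ t ∈ range 1 (s ∸ 1) ] x (c t) + ∑[ t ∈ range (suc s) (n ∸ suc s) ] x (c t)

  ∈-inner⁻ : ∀ {s} → s ∈ range 1 (n ∸ 1) → 1 ≤ s × s < n
  ∈-inner⁻ s∈ with p , q ← ∈-range⁻ 1 (n ∸ 1) s∈ = p , <-pred⇒< n p q

  ∈-inner⁺ : ∀ {s} → 1 ≤ s → s < n → s ∈ range 1 (n ∸ 1)
  ∈-inner⁺ 1≤s s<n = ∈-range⁺ 1 (n ∸ 1) 1≤s (<⇒<-pred n s<n)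

  count-split : ∀ c {s} → 1 ≤ s → s < n → count c ≡ x (c s) + rest c s
  count-split c {suc s} 1≤s s<n = trans (cong (λ l → ∑ (range 1 l) (x ∘ c)) len)
    (trans (∑-range-++ 1 s (suc (n ∸ suc (suc s))) (x ∘ c)) (comm (∑ (range 1 s) (x ∘ c)) (x (c (suc s))) _))
    where
    len : n ∸ 1 ≡ s + suc (n ∸ suc (suc s))
    len = trans (cong (_∸ 1) (sym (m+[n∸m]≡n s<n))) (sym (+-suc s _))
    comm : ∀ a b d → a + (b + d) ≡ b + (a + d)
    comm = solve-∀

  -- A chain with a mid counts as lossy: on average it has few members besides the mid.
  Lossy : (ℕ → Subset n) → Set
  Lossy c = count c ≤ 1 ⊎ 1 ≤ mids c

  Lossy? : ∀ c → Dec (Lossy c)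
  Lossy? c = (count c ≤? 1) ⊎-dec (1 ≤? mids c)

  opaque

    ℓ : (ℕ → Subset n) → ℕ
    ℓ c = 𝟙 (Lossy? c)

    ℓ≤1 : ∀ c → ℓ c ≤ 1
    ℓ≤1 c = 𝟙≤1 (Lossy? c)

    ℓ-yes : ∀ {c} → Lossy c → ℓ c ≡ 1
    ℓ-yes {c} = 𝟙-yes (Lossy? c)

    ℓ-no : ∀ {c} → ¬ Lossy c → ℓ c ≡ 0
    ℓ-no {c} = 𝟙-no (Lossy? c)

    ℓ-cong : ∀ {c d} → (Lossy c → Lossy d) → (Lossy d → Lossy c) → ℓ c ≡ ℓ d
    ℓ-cong {c} {d} = 𝟙-cong (Lossy? c) (Lossy? d)

  -- A chain has at most one mid, so this is the number of its members besides the mid, or 0 if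
  -- there is no mid.
  extra : (ℕ → Subset n) → ℕ
  extra c = ∑[ s ∈ range 1 (n ∸ 1) ] (μ (c s) * rest c s)

  module Chain (c : ℕ → Subset n) (size-c : ∀ s → s ≤ n → ∣ c s ∣ ≡ s) (nest : ∀ {s t} → s ≤ t → c s ⊆ c t) where

    size-< : ∀ {s t} → s < t → t ≤ n → ∣ c s ∣ < ∣ c t ∣
    size-< {s} {t} s<t t≤n = subst₂ _<_ (sym (size-c s (≤-trans (<⇒≤ s<t) t≤n))) (sym (size-c t t≤n)) s<t

    mid-between : ∀ {s t u} → s < t → t < u → u ≤ n → c s ∈ 𝓕 → c t ∈ 𝓕 → c u ∈ 𝓕 → Mid (c t)
    mid-between {s} {t} {u} s<t t<u u≤n s∈ t∈ u∈ =
      t∈ , lose s∈ (nest (<⇒≤ s<t) , size-< s<t (≤-trans (<⇒≤ t<u) u≤n)) , lose u∈ (nest (<⇒≤ t<u) , size-< t<u u≤n)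

    two : 2 ≤ count c → ∃₂ λ s t → 1 ≤ s × s < t × t < n × c s ∈ 𝓕 × c t ∈ 𝓕
    two le with s , l , 1≤s , s< , xs , le′ , eq ← first 1 (n ∸ 1) (x ∘ c) 1 (x≤1 ∘ c) le
      with t , _ , s<t , t< , xt , _ ← first (suc s) l (x ∘ c) 0 (x≤1 ∘ c) le′
      = s , t , 1≤s , s<t , <-pred⇒< n (≤-trans 1≤s (<⇒≤ s<t)) (subst (t <_) eq t<) , x⇒∈ xs , x⇒∈ xt

    three : 3 ≤ count c → 1 ≤ mids c
    three le with s , l , 1≤s , s< , xs , le′ , eq ← first 1 (n ∸ 1) (x ∘ c) 2 (x≤1 ∘ c) le
      with t , k , s<t , t< , xt , le″ , eq′ ← first (suc s) l (x ∘ c) 1 (x≤1 ∘ c) le′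
      with u , _ , t<u , u< , xu , _ ← first (suc t) k (x ∘ c) 0 (x≤1 ∘ c) le″ =
      ≤-trans (≤-reflexive (sym (Mid⇒μ (mid-between s<t t<u (<⇒≤ u<n) (x⇒∈ xs) (x⇒∈ xt) (x⇒∈ xu)))))
        (∑-member _ (μ ∘ c) (∈-inner⁺ (≤-trans 1≤s (<⇒≤ s<t)) (<-trans t<u u<n)))
      where
      u<n : u < n
      u<n = <-pred⇒< n (≤-trans (≤-trans 1≤s (<⇒≤ s<t)) (<⇒≤ t<u)) (subst (u <_) (trans eq′ eq) u<)

    mids≤1 : mids c ≤ 1
    mids≤1 with 2 ≤? mids c
    ... | no ¬p = ≤-pred (≰⇒> ¬p)
    ... | yes p with s , l , 1≤s , s< , ms , le′ , eq ← first 1 (n ∸ 1) (μ ∘ c) 1 (μ≤1 ∘ c) p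
      with t , _ , s<t , t< , mt , _ ← first (suc s) l (μ ∘ c) 0 (μ≤1 ∘ c) le′
      = ⊥-elim (mid-mid (μ⇒Mid ms) (μ⇒Mid mt) (nest (<⇒≤ s<t))
          (size-< s<t (<⇒≤ (<-pred⇒< n (≤-trans 1≤s (<⇒≤ s<t)) (subst (t <_) eq t<)))))

    mid⇒hit : ∀ {s} → 1 ≤ s → s < n → Mid (c s) → 1 ≤ mids c
    mid⇒hit {s} 1≤s s<n mid = ≤-trans (≤-reflexive (sym (Mid⇒μ mid))) (∑-member _ (μ ∘ c) (∈-inner⁺ 1≤s s<n))

    hit : 1 ≤ mids c → count c ≤ 1 + extra c
    hit h with s , s∈ , ms ← ∑-find (range 1 (n ∸ 1)) (μ ∘ c) h with 1≤s , s<n ← ∈-inner⁻ s∈ = begin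
      count c                   ≡⟨ count-split c 1≤s s<n ⟩
      x (c s) + rest c s        ≤⟨ +-mono-≤ (x≤1 (c s)) (≤-reflexive (sym
          (trans (cong (_* rest c s) (≤1⇒≡1 (μ≤1 (c s)) ms)) (+-identityʳ _)))) ⟩
      1 + μ (c s) * rest c s    ≤⟨ +-monoʳ-≤ 1 (∑-member _ (λ s → μ (c s) * rest c s) s∈) ⟩
      1 + extra c               ∎
      where open ≤-Reasoning

    count+mids : count c + mids c ≤ 2 + extra c
    count+mids with pos⊎0 (mids c)
    ... | inj₁ h = ≤-trans (+-mono-≤ (hit h) mids≤1) (≤-reflexive (+-comm (1 + extra c) 1))
    ... | inj₂ e with 3 ≤? count c
    ...   | yes p = ⊥-elim (<⇒≱ (three p) (≤-reflexive e))
    ...   | no ¬p = ≤-trans (≤-reflexive (trans (cong (count c +_) e) (+-identityʳ _))) (≤-trans (≤-pred (≰⇒> ¬p)) (m≤m+n 2 _))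

    -- A chain that is not lossy has exactly two members, one with a mid has at most `1 + extra c`:
    -- being lossy costs one member, up to what `extra` gives back.
    count+ℓ : count c + ℓ c ≤ 2 + extra c
    count+ℓ with Lossy? c
    ... | yes (inj₁ p) = ≤-trans (+-mono-≤ p (ℓ≤1 c)) (m≤m+n 2 _)
    ... | yes (inj₂ h) = ≤-trans (+-mono-≤ (hit h) (ℓ≤1 c)) (≤-reflexive (+-comm (1 + extra c) 1))
    ... | no ¬l = ≤-trans (+-monoʳ-≤ (count c) (≤-trans (≤-reflexive (ℓ-no ¬l)) z≤n)) count+mids

    mids≤ℓ : mids c ≤ ℓ c
    mids≤ℓ with Lossy? c
    ... | yes l = ≤-trans mids≤1 (≤-reflexive (sym (ℓ-yes l)))
    ... | no ¬l = ≤-trans (≤-pred (≰⇒> (¬l ∘ inj₂))) z≤n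

  -- States of the chains around one circle

  module Cycle (p : ℕ) (n≡ : n ≡ suc p + suc p) (1≤p : 1 ≤ p) (C : ℕ → ℕ → Subset n)
    (size-C : ∀ k s → s ≤ n → ∣ C k s ∣ ≡ s)
    (nest : ∀ k {s t} → s ≤ t → C k s ⊆ C k t)
    -- In the application chain k + 1 is chain k turned by one position, so the arcs of the two
    -- chains interlace, with `up` and `down` alternating in the parity of the size.
    (up : ∀ k s → even (s + suc p) ≡ false → C k s ⊆ C (suc k) (suc s))
    (down : ∀ k s → even (s + suc p) ≡ true → C (suc k) s ⊆ C k (suc s))
    (opposite : ∀ k {s t} → s + t ≤ n → ∀ {e} → e ∈ˢ C k s → e ∈ˢ C (k + suc p) t → ⊥)
    (period : ∀ k s → C (k + n) s ≡ C k s) where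

    m : ℕ
    m = suc p

    module Ch k = Chain (C k) (size-C k) (nest k)

    lossy : ℕ → ℕ
    lossy k = ℓ (C k)

    count-ext : ∀ {c d} → (∀ s → c s ≡ d s) → count c ≡ count d
    count-ext e = ∑-cong (range 1 (n ∸ 1)) (λ {s} _ → cong x (e s))

    mids-ext : ∀ {c d} → (∀ s → c s ≡ d s) → mids c ≡ mids d
    mids-ext e = ∑-cong (range 1 (n ∸ 1)) (λ {s} _ → cong μ (e s))

    lossy-period : ∀ k → lossy (k + n) ≡ lossy k
    lossy-period k = ℓ-cong
      (λ { (inj₁ q) → inj₁ (subst (_≤ 1) ce q) ; (inj₂ q) → inj₂ (subst (1 ≤_) me q) })
      (λ { (inj₁ q) → inj₁ (subst (_≤ 1) (sym ce) q) ; (inj₂ q) → inj₂ (subst (1 ≤_) (sym me) q) })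
      where
      ce = count-ext (period k)
      me = mids-ext (period k)

    m<n : m < n
    m<n = subst (m <_) (sym n≡) (m<m+n m (s≤s z≤n))

    1+m<n : suc m < n
    1+m<n = subst (suc m <_) (sym n≡) (s≤s (+-monoˡ-≤ (suc p) 1≤p))

    -- Between chains that are not lossy a state is kept or becomes `Low`, which then persists.
    -- `Full` and `Upper` exclude each other through the arc of size `m`, so only a lossy chain can
    -- separate them.
    Low Full Upper : ℕ → Set
    Low k   = 1 ≤ ∑[ s ∈ range 1 p ] x (C k s)
    Full k  = 1 ≤ x (C k m) × 1 ≤ x (C k (suc m))
    Upper k = x (C k m) ≡ 0 × 1 ≤ x (C k (suc m))

    low⁻ : ∀ {k} → Low k → ∃ λ s → 1 ≤ s × s ≤ p × C k s ∈ 𝓕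
    low⁻ l with s , s∈ , xs ← ∑-find (range 1 p) _ l with 1≤s , s< ← ∈-range⁻ 1 p s∈ = s , 1≤s , ≤-pred s< , x⇒∈ xs

    low⁺ : ∀ {k s} → 1 ≤ s → s ≤ p → C k s ∈ 𝓕 → Low k
    low⁺ {k} 1≤s s≤p s∈ = ≤-trans (≤-reflexive (sym (∈⇒x s∈))) (∑-member (range 1 p) (x ∘ C k) (∈-range⁺ 1 p 1≤s (s≤s s≤p)))

    members : ∀ {k} → ¬ Lossy (C k) → ∃₂ λ s t → 1 ≤ s × s < t × t < n × C k s ∈ 𝓕 × C k t ∈ 𝓕
    members {k} ¬l = Ch.two k (≰⇒> (¬l ∘ inj₁))

    no-mid : ∀ {k s} → ¬ Lossy (C k) → 1 ≤ s → s < n → ¬ Mid (C k s)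
    no-mid {k} ¬l 1≤s s<n mid = ¬l (inj₂ (Ch.mid⇒hit k 1≤s s<n mid))

    private
      sz : ∀ {k s k′ s′} → s < s′ → s′ ≤ n → ∣ C k s ∣ < ∣ C k′ s′ ∣
      sz {k} {s} {k′} {s′} lt le = subst₂ _<_ (sym (size-C k s (≤-trans (<⇒≤ lt) le))) (sym (size-C k′ s′ le)) lt

      odd-p : even (p + suc p) ≡ false
      odd-p rewrite +-suc p p | even-+ p = refl

      odd-m+1 : even (suc m + m) ≡ false
      odd-m+1 rewrite even-+ m = refl

    up-p : ∀ k → C k p ⊆ C (suc k) m
    up-p k = up k p odd-p

    up-m+1 : ∀ k → C k (suc m) ⊆ C (suc k) (2 + m)
    up-m+1 k = up k (suc m) odd-m+1

    down-m : ∀ k → C (suc k) m ⊆ C k (suc m)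
    down-m k = down k m (even-+ m)

    -- If the next chain had no low member, its smaller member would have the low member of chain
    -- `k` below it and its own larger member above it: a mid.
    low-step : ∀ {k} → Low k → ¬ Lossy (C (suc k)) → Low (suc k)
    low-step {k} low ¬l with r , 1≤r , r≤p , D∈ ← low⁻ low with s , t , 1≤s , s<t , t<n , s∈ , t∈ ← members ¬l with s ≤? p
    ... | yes s≤p = low⁺ 1≤s s≤p s∈
    ... | no s≰p = ⊥-elim (no-mid ¬l 1≤s s<n
          (s∈ , lose D∈ (nest (suc k) (≰⇒> s≰p) ∘ up-p k ∘ nest k r≤p , sz (≤-<-trans r≤p (≰⇒> s≰p)) (<⇒≤ s<n)) ,
                lose t∈ (nest (suc k) (<⇒≤ s<t) , sz s<t (<⇒≤ t<n))))
      where s<n = <-trans s<t t<n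

    -- A member of size at least m + 2 on the next chain contains `C k (suc m)`, which itself
    -- contains `C k m`: a mid on chain `k`. Without low members only the sizes m and m + 1 are
    -- left.
    full-step : ∀ {k} → ¬ Lossy (C k) → Full k → ¬ Lossy (C (suc k)) → Low (suc k) ⊎ Full (suc k)
    full-step {k} ¬l (f , h) ¬l′ with s , t , 1≤s , s<t , t<n , s∈ , t∈ ← members ¬l′ with s ≤? p | t ≤? suc m
    ... | yes s≤p | _ = inj₁ (low⁺ 1≤s s≤p s∈)
    ... | no s≰p | yes t≤ = inj₂ (≤-reflexive (sym (∈⇒x (subst (λ z → C (suc k) z ∈ 𝓕) s≡m s∈))) ,
                                  ≤-reflexive (sym (∈⇒x (subst (λ z → C (suc k) z ∈ 𝓕) t≡ t∈))))
      where
      s≡m : s ≡ m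
      s≡m = ≤-antisym (≤-pred (≤-trans s<t t≤)) (≰⇒> s≰p)
      t≡ : t ≡ suc m
      t≡ = ≤-antisym t≤ (≤-trans (s≤s (≰⇒> s≰p)) s<t)
    ... | no s≰p | no t≰ = ⊥-elim (no-mid ¬l (s≤s z≤n) 1+m<n
          (x⇒∈ h , lose (x⇒∈ f) (nest k (n≤1+n m) , sz (n<1+n m) (<⇒≤ 1+m<n)) ,
                   lose t∈ (nest (suc k) (≰⇒> t≰) ∘ up-m+1 k , sz (≰⇒> t≰) (<⇒≤ t<n))))

    -- Both ways of leaving the state give a mid. If `C (suc k) m` is a member, then `C k (suc m)`
    -- lies between it and a larger member of chain `k`. If the smaller member of the next chain
    -- exceeds size m + 1, it lies between `C k (suc m)` and the larger one.
    upper-step : ∀ {k} → ¬ Lossy (C k) → ¬ Low k → Upper k → ¬ Lossy (C (suc k)) → Low (suc k) ⊎ Upper (suc k)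
    upper-step {k} ¬l ¬low (f , h) ¬l′
      with a , b , 1≤a , a<b , b<n , a∈ , b∈ ← members ¬l
      with s , t , 1≤s , s<t , t<n , s∈ , t∈ ← members ¬l′ with s ≤? p | pos⊎0 (x (C (suc k) m))
    ... | yes s≤p | _ = inj₁ (low⁺ 1≤s s≤p s∈)
    ... | no _ | inj₁ f′ = ⊥-elim (no-mid ¬l (s≤s z≤n) 1+m<n
          (x⇒∈ h , lose (x⇒∈ f′) (down-m k , sz (n<1+n m) (<⇒≤ 1+m<n)) ,
                   lose b∈ (nest k (<⇒≤ b>) , sz b> (<⇒≤ b<n))))
      where
      a>p : p < a
      a>p = ≰⇒> (λ a≤p → ¬low (low⁺ 1≤a a≤p a∈))
      a≢m : a ≢ m
      a≢m refl = <⇒≱ (≤-reflexive (sym (∈⇒x a∈))) (≤-reflexive f)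
      b> : suc m < b
      b> = ≤-trans (s≤s (≤∧≢⇒< a>p (a≢m ∘ sym))) a<b
    ... | no s≰p | inj₂ f′ with s ≟ suc m
    ...   | yes refl = inj₂ (f′ , ≤-reflexive (sym (∈⇒x s∈)))
    ...   | no s≢ = ⊥-elim (no-mid ¬l′ 1≤s s<n
            (s∈ , lose (x⇒∈ h) (nest (suc k) s> ∘ up-m+1 k , sz s> (<⇒≤ s<n)) ,
                  lose t∈ (nest (suc k) (<⇒≤ s<t) , sz s<t (<⇒≤ t<n))))
      where
      s<n = <-trans s<t t<n
      s≢m : s ≢ m
      s≢m refl = <⇒≱ (≤-reflexive (sym (∈⇒x s∈))) (≤-reflexive f′)
      s> : suc m < s
      s> = ≤∧≢⇒< (≤∧≢⇒< (≰⇒> s≰p) (s≢m ∘ sym)) (s≢ ∘ sym)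

    -- Marks the end of a run of consecutive lossy chains; `lossy-split` then counts lossy chains as
    -- runs plus adjacent lossy pairs.
    drop : ℕ → ℕ
    drop k = lossy k * (1 ∸ lossy (suc k))

    drop≡1 : ∀ {k} → Lossy (C k) → ¬ Lossy (C (suc k)) → drop k ≡ 1
    drop≡1 {k} l ¬l = cong₂ (λ a b → a * (1 ∸ b)) (ℓ-yes l) (ℓ-no ¬l)

    private
      -- Take the end `k` of the stretch on which the chain is lossy or in a state of `S`. If chain
      -- `k` were not lossy, the step rule would extend the stretch; so a run of lossy chains ends
      -- at `k`.
      drop-in : ∀ (S : ℕ → Set) → (∀ k → Dec (S k)) → (∀ k → ¬ Lossy (C k) → S k → ¬ Lossy (C (suc k)) → S (suc k)) →
                ∀ i → S i → ¬ Lossy (C (i + m)) → ¬ S (i + m) → 1 ≤ ∑[ k ∈ range i m ] drop k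
      drop-in S S? step i s ¬l ¬s
        with k , k∈ , pk , ¬psk ← last-true (λ k → Lossy (C k) ⊎ S k) (λ k → Lossy? (C k) ⊎-dec S? k) i m
               (inj₂ s) (λ { (inj₁ q) → ¬l q ; (inj₂ q) → ¬s q })
        with pk
      ... | inj₁ l = ≤-trans (≤-reflexive (sym (drop≡1 l (¬psk ∘ inj₁)))) (∑-member (range i m) drop k∈)
      ... | inj₂ sk with Lossy? (C k)
      ...   | yes l = ≤-trans (≤-reflexive (sym (drop≡1 l (¬psk ∘ inj₁)))) (∑-member (range i m) drop k∈)
      ...   | no ¬lk = ⊥-elim (¬psk (inj₂ (step k ¬lk sk (¬psk ∘ inj₁))))

    Low? : ∀ k → Dec (Low k)
    Low? k = 1 ≤? _
    Full? : ∀ k → Dec (Full k)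
    Full? k = (1 ≤? _) ×-dec (1 ≤? _)
    Upper? : ∀ k → Dec (Upper k)
    Upper? k = (_ ≟ 0) ×-dec (1 ≤? _)

    total-lossy adjacent : ℕ
    total-lossy = ∑[ k ∈ range 0 n ] lossy k
    adjacent    = ∑[ k ∈ range 0 n ] (lossy k * lossy (suc k))

    lossy-split : total-lossy ≡ ∑[ k ∈ range 0 n ] drop k + adjacent
    lossy-split = trans (∑-cong (range 0 n) (λ {k} _ → split (lossy k) (lossy (suc k)) (ℓ≤1 (C (suc k)))))
        (∑-+ (range 0 n) drop _)
      where
      split : ∀ a b → b ≤ 1 → a ≡ a * (1 ∸ b) + a * b
      split a zero    _ = sym (trans (cong₂ _+_ (*-identityʳ a) (*-zeroʳ a)) (+-identityʳ a))
      split a (suc zero) _ = sym (cong₂ _+_ (*-zeroʳ a) (*-identityʳ a))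
      split a (suc (suc b)) (s≤s ())

    drop-period : ∀ k → drop (k + n) ≡ drop k
    drop-period k = cong₂ (λ a b → a * (1 ∸ b)) (lossy-period k) (lossy-period (suc k))

    -- Walking once around the circle, the state changes from full to upper and back, and each change needs a lossy chain.
    lossy-full-upper : ∀ i → ¬ Lossy (C i) → ¬ Low i → Full i → ¬ Lossy (C (i + m)) → ¬ Low (i + m) → Upper (i + m) →
                       2 + adjacent ≤ total-lossy
    lossy-full-upper i ¬l ¬low full ¬l′ ¬low′ upper = begin
      2 + adjacent                                     ≤⟨ +-monoˡ-≤ adjacent (+-mono-≤ d₁ d₂) ⟩
      ∑ (range i m) drop + ∑ (range (i + m) m) drop + adjacent ≡⟨ cong (_+ adjacent) (sym (∑-range-++ i m m drop)) ⟩
      ∑ (range i (m + m)) drop + adjacent              ≡⟨ cong (λ z → ∑ (range i z) drop + adjacent) (sym n≡) ⟩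
      ∑ (range i n) drop + adjacent                    ≡⟨ cong (_+ adjacent) (∑-rotate n drop drop-period i) ⟩
      ∑ (range 0 n) drop + adjacent                    ≡⟨ sym lossy-split ⟩
      total-lossy                                      ∎
      where
      open ≤-Reasoning
      d₁ : 1 ≤ ∑ (range i m) drop
      d₁ = drop-in (λ k → Low k ⊎ Full k) (λ k → Low? k ⊎-dec Full? k)
        (λ k ¬l → λ { (inj₁ q) ¬l′ → inj₁ (low-step q ¬l′) ; (inj₂ q) ¬l′ → full-step ¬l q ¬l′ })
        i (inj₂ full) ¬l′ (λ { (inj₁ q) → ¬low′ q ; (inj₂ (f , _)) → <⇒≱ f (≤-reflexive (proj₁ upper)) })
      -- The second half turn ends at chain `i + n`, which is chain `i` again and is `Full`, hence
      -- not `Upper`.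
      wrap : i + m + m ≡ i + n
      wrap = trans (+-assoc i m m) (cong (i +_) (sym n≡))
      wrapped : (i′ : ℕ) → i′ ≡ i + n → Lossy (C i′) ⊎ Low i′ ⊎ Upper i′ → ⊥
      wrapped _ refl (inj₁ q) = <⇒≱ (≤-reflexive (sym (ℓ-yes q))) (≤-reflexive (trans (lossy-period i) (ℓ-no ¬l)))
      wrapped _ refl (inj₂ (inj₁ q)) = ¬low (subst (1 ≤_) (∑-cong (range 1 p) (λ {s} _ → cong x (period i s))) q)
      wrapped _ refl (inj₂ (inj₂ (f , _))) = <⇒≱ (proj₁ full) (≤-reflexive (trans (cong x (sym (period i m))) f))
      stepᵘ : ∀ k → ¬ Lossy (C k) → Low k ⊎ Upper k → ¬ Lossy (C (suc k)) → Low (suc k) ⊎ Upper (suc k)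
      stepᵘ k ¬l (inj₁ q) ¬l′ = inj₁ (low-step q ¬l′)
      stepᵘ k ¬l (inj₂ q) ¬l′ with Low? k
      ... | yes w = inj₁ (low-step w ¬l′)
      ... | no ¬w = upper-step ¬l ¬w q ¬l′
      d₂ : 1 ≤ ∑ (range (i + m) m) drop
      d₂ = drop-in (λ k → Low k ⊎ Upper k) (λ k → Low? k ⊎-dec Upper? k) stepᵘ (i + m) (inj₂ upper)
        (wrapped (i + m + m) wrap ∘ inj₁) (wrapped (i + m + m) wrap ∘ inj₂)

    -- The chain whose arcs of sizes s − 1 and s + 1 enclose the arc of size s on chain k. If that arc is a mid
    -- and its two partners miss the neighbouring chain, then the latter is lossy as well.
    neighbour : ℕ → ℕ → ℕ
    neighbour k s = if even (s + m) then k + (n ∸ 1) else suc k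

    echoes total-mids : ℕ
    echoes     = ∑[ k ∈ range 0 n ] ∑[ s ∈ range 1 (n ∸ 1) ] (μ (C k s) * lossy (neighbour k s))
    total-mids = ∑[ k ∈ range 0 n ] mids (C k)

    private
      1+[n-1] : suc (n ∸ 1) ≡ n
      1+[n-1] = m+[n∸m]≡n (≤-trans (s≤s z≤n) m<n)

      -- A chain has at most one mid, and a chain with a mid is lossy; an echo therefore pairs it
      -- with a lossy chain on one of its two sides.
      echo-k : ∀ k → ∑[ s ∈ range 1 (n ∸ 1) ] (μ (C k s) * lossy (neighbour k s)) ≤ lossy k * lossy (suc k) + lossy
          (k + (n ∸ 1)) * lossy (suc (k + (n ∸ 1)))
      echo-k k = begin
        ∑[ s ∈ range 1 (n ∸ 1) ] (μ (C k s) * lossy (neighbour k s))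
          ≤⟨ ∑-mono (range 1 (n ∸ 1)) (λ {s} _ → *-monoʳ-≤ (μ (C k s)) (nb s)) ⟩
        ∑[ s ∈ range 1 (n ∸ 1) ] (μ (C k s) * (lossy (suc k) + lossy (k + (n ∸ 1))))
          ≡⟨ ∑-*ʳ (lossy (suc k) + lossy (k + (n ∸ 1))) (range 1 (n ∸ 1)) _ ⟩
        mids (C k) * (lossy (suc k) + lossy (k + (n ∸ 1)))
          ≤⟨ *-monoˡ-≤ (lossy (suc k) + lossy (k + (n ∸ 1))) (Ch.mids≤ℓ k) ⟩
        lossy k * (lossy (suc k) + lossy (k + (n ∸ 1)))
          ≡⟨ r (lossy k) (lossy (suc k)) (lossy (k + (n ∸ 1))) ⟩
        lossy k * lossy (suc k) + lossy (k + (n ∸ 1)) * lossy k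
          ≡⟨ cong (λ z → lossy k * lossy (suc k) + lossy (k + (n ∸ 1)) * z)
              (sym (trans (cong lossy (trans (sym (+-suc k (n ∸ 1))) (cong (k +_) 1+[n-1]))) (lossy-period k))) ⟩
        lossy k * lossy (suc k) + lossy (k + (n ∸ 1)) * lossy (suc (k + (n ∸ 1))) ∎
        where
        open ≤-Reasoning
        r : ∀ a b c → a * (b + c) ≡ a * b + c * a
        r = solve-∀
        nb : ∀ s → lossy (neighbour k s) ≤ lossy (suc k) + lossy (k + (n ∸ 1))
        nb s with even (s + m)
        ... | true  = m≤n+m _ (lossy (suc k))
        ... | false = m≤m+n _ _

    -- An adjacent lossy pair can be reached from both of its chains; this factor two is why weights
    -- on the circle are doubled.
    echoes≤adjacent : echoes ≤ adjacent + adjacent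
    echoes≤adjacent = begin
      echoes ≤⟨ ∑-mono (range 0 n) (λ {k} _ → echo-k k) ⟩
      ∑[ k ∈ range 0 n ] (adj k + adj (k + (n ∸ 1)))                 ≡⟨ ∑-+ (range 0 n) adj _ ⟩
      adjacent + ∑[ k ∈ range 0 n ] adj (k + (n ∸ 1))                ≡⟨ cong (adjacent +_)
          (trans (∑-range-+ (n ∸ 1) 0 n adj) (∑-rotate n adj (λ k → cong₂ _*_ (lossy-period k) (lossy-period (suc k))) (n ∸ 1))) ⟩
      adjacent + adjacent ∎
      where
      open ≤-Reasoning
      adj : ℕ → ℕ
      adj k = lossy k * lossy (suc k)

    echoes≤mids : echoes ≤ total-mids
    echoes≤mids = ∑-mono (range 0 n) (λ {k} _ → ∑-mono (range 1 (n ∸ 1)) (λ {s} _ →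
      ≤-trans (*-monoʳ-≤ (μ (C k s)) (ℓ≤1 (C (neighbour k s)))) (≤-reflexive (*-identityʳ _))))

    mids≤lossy : total-mids ≤ total-lossy
    mids≤lossy = ∑-mono (range 0 n) (λ {k} _ → Ch.mids≤ℓ k)

    -- Mids are subtracted because what they save in weight is reserved for `ψ`; the other large
    -- members pay for bad pairs.
    high : ℕ → ℕ
    high k = ∑[ s ∈ range (3 + m) (n ∸ (3 + m)) ] (x (C k s) ∸ μ (C k s))

    -- Two opposite chains that do not attain the maximal weight: in each of the three pairs of complementary arcs
    -- around the middle level at most one is a member, and the sizes above m + 2 have small weight.
    Bad : ℕ → Set
    Bad k = x (C k m) + x (C (k + m) m) ≡ 0 ⊎
            x (C k (suc m)) + x (C (k + m) p) ≡ 0 ⊎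
            x (C (k + m) (suc m)) + x (C k p) ≡ 0 ⊎
            1 ≤ high k + high (k + m)

    opaque

      Bad? : ∀ k → Dec (Bad k)
      Bad? k = (_ ≟ 0) ⊎-dec (_ ≟ 0) ⊎-dec (_ ≟ 0) ⊎-dec (1 ≤? _)

    opposite′ : ∀ k {s t} → s + t ≤ n → ∀ {e} → e ∈ˢ C (k + m) s → e ∈ˢ C k t → ⊥
    opposite′ k {s} {t} le p q = opposite k {t} {s} (subst (_≤ n) (+-comm s t) le) q p

    private
      Opposite : ℕ → ℕ → Set
      Opposite i j = ∀ {s t} → s + t ≤ n → ∀ {e} → e ∈ˢ C i s → e ∈ˢ C j t → ⊥

      -- A low member of size r meets the smaller opposite member, of size s, only if r + s exceeds
      -- n. So s is at least m + 2, the larger opposite member has size at least m + 3, and not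
      -- being a mid it is counted by `high`.
      not-low : ∀ {i j} → Opposite i j → ¬ Lossy (C j) → high j ≡ 0 → ¬ Low i
      not-low {i} {j} opp ¬l h low with r , 1≤r , r≤p , r∈ ← low⁻ low
        with s , t , 1≤s , s<t , t<n , s∈ , t∈ ← members ¬l =
        <⇒≱ (≤-trans (≤-reflexive (sym (cong₂ _∸_ (∈⇒x t∈) (¬Mid⇒μ (no-mid ¬l (≤-trans 1≤s (<⇒≤ s<t)) t<n)))))
                     (∑-member (range (3 + m) (n ∸ (3 + m))) (λ s → x (C j s) ∸ μ (C j s))
                       (∈-range⁺ (3 + m) _ t≥ (subst (t <_) (sym (m+[n∸m]≡n (≤-trans t≥ (<⇒≤ t<n)))) t<n))))
             (≤-reflexive h)
        where
        r+s>n : n < r + s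
        r+s>n = ≰⇒> (λ le → disjoint-∉ r∈ (λ {e} → opp {r} {s} le {e}) s∈)
        s≥ : 2 + m ≤ s
        s≥ = +-cancelʳ-≤ p (2 + m) s (≤-trans (≤-reflexive eq) (≤-trans r+s>n
            (≤-trans (+-monoˡ-≤ s r≤p) (≤-reflexive (+-comm p s)))))
          where eq : 2 + m + p ≡ suc n
                eq = cong suc (trans (sym (+-suc m p)) (sym n≡))
        t≥ : 3 + m ≤ t
        t≥ = ≤-trans (s≤s s≥) s<t

      1≤+ : ∀ {a b} → a + b ≢ 0 → b ≡ 0 → 1 ≤ a
      1≤+ {zero}  ne refl = ⊥-elim (ne refl)
      1≤+ {suc a} ne e    = s≤s z≤n

      p+2 : m + m ≤ n
      p+2 = ≤-reflexive (sym n≡)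

    -- Neither chain has low members, so the arcs of size m + 1 on both are members, and exactly one
    -- of the two complementary m-arcs is: one chain is `Full`, the opposite one `Upper`.
    nonlossy-good : ∀ k → ¬ Lossy (C k) → ¬ Lossy (C (k + m)) → ¬ Bad k → 2 + adjacent ≤ total-lossy
    nonlossy-good k ¬l ¬l′ ¬b = go (pos⊎0 (x (C k m)))
      where
      highs = n<1⇒n≡0 (≰⇒> (¬b ∘ inj₂ ∘ inj₂ ∘ inj₂))
      hi : high k ≡ 0
      hi = m+n≡0⇒m≡0 (high k) highs
      hi′ : high (k + m) ≡ 0
      hi′ = m+n≡0⇒n≡0 (high k) highs
      ¬low : ¬ Low k
      ¬low = not-low {k} {k + m} (λ {s} {t} → opposite k {s} {t}) ¬l′ hi′
      ¬low′ : ¬ Low (k + m)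
      ¬low′ = not-low {k + m} {k} (λ {s} {t} → opposite′ k {s} {t}) ¬l hi
      no-p : ∀ {i} → ¬ Low i → x (C i p) ≡ 0
      no-p ¬w = ∉⇒x (λ q → ¬w (low⁺ 1≤p ≤-refl q))
      h : 1 ≤ x (C k (suc m))
      h = 1≤+ (¬b ∘ inj₂ ∘ inj₁) (no-p ¬low′)
      h′ : 1 ≤ x (C (k + m) (suc m))
      h′ = 1≤+ (¬b ∘ inj₂ ∘ inj₂ ∘ inj₁) (no-p ¬low)
      go : 1 ≤ x (C k m) ⊎ x (C k m) ≡ 0 → 2 + adjacent ≤ total-lossy
      go (inj₁ f) = lossy-full-upper k ¬l ¬low (f , h) ¬l′ ¬low′
        (∉⇒x (λ q → disjoint-∉ (x⇒∈ f) (λ {e} → opposite k {m} {m} p+2 {e}) q) , h′)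
      go (inj₂ f) = lossy-full-upper (k + m) ¬l′ ¬low′ (f′ , h′) (¬lᵖ ∘ cast)
          (¬low ∘ subst (1 ≤_) (∑-cong (range 1 p) (λ {s} _ → cong x (per s))))
        (trans (cong x (per m)) f , subst (1 ≤_) (cong x (sym (per (suc m)))) h)
        where
        per : ∀ s → C (k + m + m) s ≡ C k s
        per s = trans (cong (λ z → C z s) (trans (+-assoc k m m) (cong (k +_) (sym n≡)))) (period k s)
        f′ : 1 ≤ x (C (k + m) m)
        f′ = 1≤+ (λ e → ¬b (inj₁ (trans (+-comm (x (C k m)) _) e))) f
        ¬lᵖ = ¬l
        cast : Lossy (C (k + m + m)) → Lossy (C k)
        cast (inj₁ q) = inj₁ (subst (_≤ 1) (count-ext per) q)
        cast (inj₂ q) = inj₂ (subst (1 ≤_) (mids-ext per) q)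

    bads : ℕ
    bads = ∑[ k ∈ range 0 m ] 𝟙 (Bad? k)

    ∑-pairs : ∀ f → ∑ (range 0 n) f ≡ ∑[ k ∈ range 0 m ] (f k + f (k + m))
    ∑-pairs f = trans (cong (λ z → ∑ (range 0 z) f) n≡) (trans (∑-range-++ 0 m m f)
      (trans (cong (∑ (range 0 m) f +_) (sym (∑-range-+ m 0 m f))) (sym (∑-+ (range 0 m) f _))))

    dichotomy : 2 + adjacent ≤ total-lossy ⊎ m ≤ total-lossy + bads
    -- `1 ≤ 1 ∸ a` expresses a = 0: the search is for an opposite pair that is not bad and contains
    -- no lossy chain.
    dichotomy with any? (λ k → 1 ≤? (1 ∸ (lossy k + lossy (k + m) + 𝟙 (Bad? k)))) (range 0 m)
    ... | yes found with k , _ , q ← find found = inj₁ (nonlossy-good k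
            (λ l → big (m≤n⇒m≤n+o (𝟙 (Bad? k)) (m≤n⇒m≤n+o (lossy (k + m)) (≤-reflexive (sym (ℓ-yes l))))) q)
            (λ l → big (m≤n⇒m≤n+o (𝟙 (Bad? k)) (m≤n⇒m≤o+n (lossy k) (≤-reflexive (sym (ℓ-yes l))))) q)
            (λ b → big (m≤n⇒m≤o+n (lossy k + lossy (k + m)) (≤-reflexive (sym (𝟙-yes (Bad? k) b)))) q))
      where
      big : ∀ {a} → 1 ≤ a → 1 ≤ 1 ∸ a → ⊥
      big 1≤a q = <⇒≱ q (≤-reflexive (m≤n⇒m∸n≡0 1≤a))
    ... | no ¬found = inj₂ (begin
      m                                    ≡⟨ ones 0 m ⟨
      ∑[ k ∈ range 0 m ] 1                 ≤⟨ ∑-mono (range 0 m) (λ {k} k∈ → each k k∈) ⟩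
      ∑[ k ∈ range 0 m ] (lossy k + lossy (k + m) + 𝟙 (Bad? k)) ≡⟨ ∑-+ (range 0 m) (λ k → lossy k + lossy (k + m))
          (λ k → 𝟙 (Bad? k)) ⟩
      ∑[ k ∈ range 0 m ] (lossy k + lossy (k + m)) + bads ≡⟨ cong (_+ bads) (∑-pairs lossy) ⟨
      total-lossy + bads ∎)
      where
      open ≤-Reasoning
      ones : ∀ a l → ∑[ k ∈ range a l ] 1 ≡ l
      ones a zero    = refl
      ones a (suc l) = cong suc (ones (suc a) l)
      each : ∀ k → k ∈ range 0 m → 1 ≤ lossy k + lossy (k + m) + 𝟙 (Bad? k)
      each k k∈ with pos⊎0 (lossy k + lossy (k + m) + 𝟙 (Bad? k))
      ... | inj₁ q = q
      ... | inj₂ e = ⊥-elim (¬found (lose k∈ (≤-reflexive (cong (1 ∸_) (sym e)))))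

    neighbour-extra total-extra : ℕ
    neighbour-extra = ∑[ k ∈ range 0 n ] ∑[ s ∈ range 1 (n ∸ 1) ] (μ (C k s) * rest (C (neighbour k s)) s)
    total-extra     = ∑[ k ∈ range 0 n ] extra (C k)

    -- If `rest` finds no member of a size other than `s` on the neighbouring chain, that chain has
    -- at most one member and is lossy.
    mids≤echoes : total-mids ≤ echoes + neighbour-extra
    mids≤echoes = begin
      total-mids ≤⟨ ∑-mono (range 0 n) (λ {k} _ → ∑-mono (range 1 (n ∸ 1)) (λ s∈ → each k s∈)) ⟩
      ∑[ k ∈ range 0 n ] ∑[ s ∈ range 1 (n ∸ 1) ] (μ (C k s) * lossy (neighbour k s) + μ (C k s) * rest (C (neighbour k s)) s)
        ≡⟨ trans (∑-cong (range 0 n) (λ _ → ∑-+ (range 1 (n ∸ 1)) _ _)) (∑-+ (range 0 n) _ _) ⟩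
      echoes + neighbour-extra ∎
      where
      open ≤-Reasoning
      each : ∀ k {s} → s ∈ range 1 (n ∸ 1) → μ (C k s) ≤ μ (C k s) * lossy (neighbour k s) + μ (C k s) * rest
          (C (neighbour k s)) s
      each k {s} s∈ with 1≤s , s<n ← ∈-inner⁻ s∈ = begin
        μ (C k s)     ≡⟨ *-identityʳ _ ⟨
        μ (C k s) * 1 ≤⟨ *-monoʳ-≤ (μ (C k s)) (one (pos⊎0 (rest (C j) s))) ⟩
        μ (C k s) * (lossy j + rest (C j) s)  ≡⟨ *-distribˡ-+ (μ (C k s)) _ _ ⟩
        μ (C k s) * lossy j + μ (C k s) * rest (C j) s ∎
        where
        j = neighbour k s
        one : 1 ≤ rest (C j) s ⊎ rest (C j) s ≡ 0 → 1 ≤ lossy j + rest (C j) s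
        one (inj₁ q) = ≤-trans q (m≤n+m (rest (C j) s) (lossy j))
        one (inj₂ e) = ≤-trans (≤-reflexive (sym (ℓ-yes (inj₁ (≤-trans (≤-reflexive (trans (count-split (C j) 1≤s s<n)
          (trans (cong (x (C j s) +_) e) (+-identityʳ _)))) (x≤1 _)))))) (m≤m+n _ _)

    -- All weights are compared with `w (2 + m)`, above which the central levels have surpluses `d₀`
    -- and `d₁`. The levels further out stay below it; in doubled weights `ψ` is the reserve this
    -- leaves for mids, and `d₁` is the reserve left by sets larger than 2 + m.
    module Weights (w ψ : ℕ → ℕ) (d₀ d₁ : ℕ) (6≤m : 6 ≤ m) (d₁≤d₀ : d₁ ≤ d₀)
      (w-m : w m ≡ w (2 + m) + d₀) (w-m+1 : w (suc m) ≡ w (2 + m) + d₁) (w-p : w p ≡ w (2 + m) + d₁)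
      (ψ-low : ∀ s → s < p → 2 * w s + ψ s ≤ 2 * w (2 + m))
      (ψ-centre : ∀ s → p ≤ s → s ≤ 2 + m → ψ s ≡ 0)
      (ψ-high : ∀ s → 3 + m ≤ s → s < n → 2 * w s + ψ s ≤ 2 * w (2 + m))
      (w-high : ∀ s → 3 + m ≤ s → s < n → w s + d₁ ≤ w (2 + m))
      (3w₂≤md₁ : 3 * w (2 + m) ≤ m * d₁) where

      w₂ = w (2 + m)

      weight far : (ℕ → Subset n) → ℕ
      weight c = ∑[ s ∈ range 1 (n ∸ 1) ] (w s * x (c s))
      far c    = ∑[ s ∈ range 1 (n ∸ 1) ] (ψ s * μ (c s))

      private
        D : ℕ → ℕ
        D s = d₀ * 𝟙 (m ≟ s) + d₁ * 𝟙 (suc m ≟ s) + d₁ * 𝟙 (p ≟ s)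

        hi : ℕ → ℕ
        hi s = 𝟙 (3 + m ≤? s)

        claim : ∀ s → s < n → 2 * w s + ψ s ≤ 2 * (w₂ + D s) × 2 * w s + 2 * (d₁ * hi s) ≤ 2 * (w₂ + D s)
        claim s s<n with s <? p
        ... | yes s<p = ≤-trans (ψ-low s s<p) up′ , ≤-trans (≤-reflexive (no-hi (≤-trans s<p (m≤n+m p 4))))
                                                     (≤-trans (≤-trans (m≤m+n _ (ψ s)) (ψ-low s s<p)) up′)
          where
          up′ : 2 * w₂ ≤ 2 * (w₂ + D s)
          up′ = *-monoʳ-≤ 2 (m≤m+n w₂ (D s))
          no-hi : ∀ {s} → s < 3 + m → 2 * w s + 2 * (d₁ * hi s) ≡ 2 * w s
          no-hi {s} s< = trans (cong (λ z → 2 * w s + 2 * (d₁ * z)) (𝟙-no (3 + m ≤? s) (<⇒≱ s<)))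
            (trans (cong (λ z → 2 * w s + 2 * z) (*-zeroʳ d₁)) (+-identityʳ _))
        ... | no s≮p with 3 + m ≤? s
        ...   | yes h = ≤-trans (ψ-high s h s<n) (*-monoʳ-≤ 2 (m≤m+n w₂ (D s))) ,
                        (begin
                          2 * w s + 2 * (d₁ * 1) ≡⟨ r (w s) d₁ ⟩
                          2 * (w s + d₁)         ≤⟨ *-monoʳ-≤ 2 (≤-trans (w-high s h s<n) (m≤m+n w₂ (D s))) ⟩
                          2 * (w₂ + D s)         ∎)
          where
          open ≤-Reasoning
          r : ∀ a b → 2 * a + 2 * (b * 1) ≡ 2 * (a + b)
          r = solve-∀
        ...   | no ¬h = ≤-trans (≤-reflexive (trans (cong (2 * w s +_) (ψ-centre s (≮⇒≥ s≮p) (≤-pred (≰⇒> ¬h))))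
            (+-identityʳ _))) w≤ ,
                        ≤-trans (≤-reflexive (trans (cong (λ z → 2 * w s + 2 * z) (*-zeroʳ d₁)) (+-identityʳ _))) w≤
          where
          centre : w s ≤ w₂ + D s
          centre with m ≟ s | suc m ≟ s | p ≟ s
          ... | yes refl | _ | _ = ≤-trans (≤-reflexive w-m) (+-monoʳ-≤ w₂
              (≤-trans (≤-reflexive (sym (*-identityʳ d₀))) (≤-trans (m≤m+n _ _) (m≤m+n _ _))))
          ... | no _ | yes refl | _ = ≤-trans (≤-reflexive w-m+1) (+-monoʳ-≤ w₂
              (≤-trans (≤-reflexive (sym (*-identityʳ d₁))) (≤-trans (m≤n+m _ (d₀ * 0)) (m≤m+n _ _))))
          ... | no _ | no _ | yes refl = ≤-trans (≤-reflexive w-p) (+-monoʳ-≤ w₂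
              (≤-trans (≤-reflexive (sym (*-identityʳ d₁))) (m≤n+m _ _)))
          ... | no a | no b | no c with s ≟ 2 + m
          ...   | yes refl = m≤m+n w₂ _
          ...   | no d = ⊥-elim (d (≤-antisym (≤-pred (≰⇒> ¬h)) (≤∧≢⇒< (≤∧≢⇒< (≤∧≢⇒< (≮⇒≥ s≮p) c) a) b)))
          w≤ : 2 * w s ≤ 2 * (w₂ + D s)
          w≤ = *-monoʳ-≤ 2 centre

        pointwise : ∀ s a b → s < n → a ≤ 1 → b ≤ a →
          2 * (w s * a) + ψ s * b + 2 * (d₁ * (hi s * (a ∸ b))) ≤ 2 * ((w₂ + D s) * a)
        pointwise s zero zero s<n _ _ = ≤-reflexive (trans (r (w s) (ψ s) d₁ (hi s)) (cong (2 *_) (sym (*-zeroʳ (w₂ + D s)))))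
          where r : ∀ a b c d → 2 * (a * 0) + b * 0 + 2 * (c * (d * 0)) ≡ 2 * 0
                r = solve-∀
        pointwise s (suc zero) zero s<n _ _ = ≤-trans (≤-reflexive (r (w s) (ψ s) d₁ (hi s)))
            (≤-trans (proj₂ (claim s s<n)) (≤-reflexive (cong (2 *_) (sym (*-identityʳ (w₂ + D s))))))
          where r : ∀ a b c d → 2 * (a * 1) + b * 0 + 2 * (c * (d * 1)) ≡ 2 * a + 2 * (c * d)
                r = solve-∀
        pointwise s (suc zero) (suc zero) s<n _ _ = ≤-trans (≤-reflexive (r (w s) (ψ s) d₁ (hi s)))
            (≤-trans (proj₁ (claim s s<n)) (≤-reflexive (cong (2 *_) (sym (*-identityʳ (w₂ + D s))))))
          where r : ∀ a b c d → 2 * (a * 1) + b * 1 + 2 * (c * (d * 0)) ≡ 2 * a + b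
                r = solve-∀
        pointwise s (suc zero) (suc (suc b)) s<n _ (s≤s ())
        pointwise s (suc (suc a)) b s<n (s≤s ()) _

        3+m≤n : 3 + m ≤ n
        3+m≤n = subst (3 + m ≤_) (sym n≡) (+-monoˡ-≤ m (≤-trans (s≤s (s≤s (s≤s z≤n))) 6≤m))

        U : ℕ → ℕ
        U k = d₀ * x (C k m) + d₁ * x (C k (suc m)) + d₁ * x (C k p)

        at-D : ∀ c k → 1 ≤ c → c < n → ∑[ s ∈ range 1 (n ∸ 1) ] (𝟙 (c ≟ s) * x (C k s)) ≡ x (C k c)
        at-D c k 1≤c c<n = ∑-𝟙≟ 1 (n ∸ 1) c (x ∘ C k) 1≤c (<⇒<-pred n c<n)

        ∑-D : ∀ k → ∑[ s ∈ range 1 (n ∸ 1) ] ((w₂ + D s) * x (C k s)) ≡ w₂ * count (C k) + U k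
        ∑-D k = trans (∑-cong R (λ {s} _ → r w₂ d₀ d₁ (𝟙 (m ≟ s)) (𝟙 (suc m ≟ s)) (𝟙 (p ≟ s)) (x (C k s))))
          (trans (∑-+ R _ _) (cong₂ _+_ (∑-*ˡ w₂ R _) (trans (∑-+ R _ _) (cong₂ _+_ (trans (∑-+ R _ _)
            (cong₂ _+_ (trans (∑-*ˡ d₀ R _) (cong (d₀ *_) (at-D m k (s≤s z≤n) m<n)))
                       (trans (∑-*ˡ d₁ R _) (cong (d₁ *_) (at-D (suc m) k (s≤s z≤n) 1+m<n)))))
            (trans (∑-*ˡ d₁ R _) (cong (d₁ *_) (at-D p k 1≤p (<-trans (n<1+n p) m<n))))))))
          where
          R = range 1 (n ∸ 1)
          r : ∀ w a b i j l y → (w + (a * i + b * j + b * l)) * y ≡ w * y + (a * (i * y) + b * (j * y) + b * (l * y))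
          r = solve-∀

        high≤ : ∀ k → high k ≤ ∑[ s ∈ range 1 (n ∸ 1) ] (hi s * (x (C k s) ∸ μ (C k s)))
        high≤ k = begin
          high k ≡⟨ ∑-cong (range (3 + m) l) (λ {s} s∈ → sym (trans (cong (_* f s)
              (𝟙-yes (3 + m ≤? s) (proj₁ (∈-range⁻ (3 + m) l s∈)))) (+-identityʳ _))) ⟩
          ∑ (range (3 + m) l) g                          ≤⟨ m≤n+m _ _ ⟩
          ∑ (range 1 (2 + m)) g + ∑ (range (3 + m) l) g ≡⟨ ∑-range-++ 1 (2 + m) l g ⟨
          ∑ (range 1 (2 + m + l)) g                      ≡⟨ cong (λ z → ∑ (range 1 z) g) (cong (_∸ 1) (m+[n∸m]≡n 3+m≤n)) ⟩
          ∑ (range 1 (n ∸ 1)) g ∎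
          where
          open ≤-Reasoning
          l = n ∸ (3 + m)
          f = λ s → x (C k s) ∸ μ (C k s)
          g = λ s → hi s * f s

        chain-bound : ∀ k → 2 * weight (C k) + far (C k) + 2 * (d₁ * high k) ≤ 2 * (w₂ * count (C k) + U k)
        chain-bound k = begin
          2 * weight (C k) + far (C k) + 2 * (d₁ * high k)
            ≤⟨ +-monoʳ-≤ (2 * weight (C k) + far (C k)) (*-monoʳ-≤ 2 (*-monoʳ-≤ d₁ (high≤ k))) ⟩
          2 * weight (C k) + far (C k) + 2 * (d₁ * ∑[ s ∈ R ] (hi s * (x (C k s) ∸ μ (C k s))))
            ≡⟨ cong₂ (λ a b → a + far (C k) + b) (sym (∑-*ˡ 2 R _)) (trans (cong (2 *_) (sym (∑-*ˡ d₁ R _))) (sym (∑-*ˡ 2 R _))) ⟩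
          ∑[ s ∈ R ] (2 * (w s * x (C k s))) + far (C k) + ∑[ s ∈ R ] (2 * (d₁ * (hi s * (x (C k s) ∸ μ (C k s)))))
            ≡⟨ cong (_+ ∑[ s ∈ R ] (2 * (d₁ * (hi s * (x (C k s) ∸ μ (C k s)))))) (∑-+ R _ _) ⟨
          ∑[ s ∈ R ] (2 * (w s * x (C k s)) + ψ s * μ (C k s)) + ∑[ s ∈ R ] (2 * (d₁ * (hi s * (x (C k s) ∸ μ (C k s)))))
            ≡⟨ ∑-+ R _ _ ⟨
          ∑[ s ∈ R ] (2 * (w s * x (C k s)) + ψ s * μ (C k s) + 2 * (d₁ * (hi s * (x (C k s) ∸ μ (C k s)))))
            ≤⟨ ∑-mono R (λ {s} s∈ → pointwise s (x (C k s)) (μ (C k s)) (proj₂ (∈-inner⁻ s∈)) (x≤1 (C k s)) (μ≤x (C k s))) ⟩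
          ∑[ s ∈ R ] (2 * ((w₂ + D s) * x (C k s)))
            ≡⟨ trans (∑-*ˡ 2 R _) (cong (2 *_) (∑-D k)) ⟩
          2 * (w₂ * count (C k) + U k) ∎
          where
          open ≤-Reasoning
          R = range 1 (n ∸ 1)

        exclusive : ∀ k {s t} → s + t ≤ n → x (C k s) + x (C (k + m) t) ≤ 1
        exclusive k {s} {t} le with pos⊎0 (x (C k s))
        ... | inj₂ e = ≤-trans (≤-reflexive (cong (_+ x (C (k + m) t)) e)) (x≤1 _)
        ... | inj₁ q = ≤-trans (≤-reflexive (trans (cong (x (C k s) +_)
            (∉⇒x (disjoint-∉ (x⇒∈ q) (λ {e} → opposite k {s} {t} le {e})))) (+-identityʳ _))) (x≤1 _)

        -- `A`, `B`, `C` are the member counts of the three complementary pairs around the middle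
        -- level. A bad pair of chains leaves one of them empty, which saves at least `a` because a
        -- ≤ b, or has a high member, which is charged `a`.
        budget : ∀ a b {A B C h : ℕ} (β : Dec (A ≡ 0 ⊎ B ≡ 0 ⊎ C ≡ 0 ⊎ 1 ≤ h)) → A ≤ 1 → B ≤ 1 → C ≤ 1 → a ≤ b →
                 b * A + a * B + a * C + a * 𝟙 β ≤ b + a + a + a * h
        budget a b {A} {B} {C} {h} (no _) A≤ B≤ C≤ a≤b = ≤-trans (≤-reflexive
            (trans (cong (b * A + a * B + a * C +_) (*-zeroʳ a)) (+-identityʳ _)))
          (≤-trans (+-mono-≤ (+-mono-≤ (*≤ b A≤) (*≤ a B≤)) (*≤ a C≤)) (m≤m+n _ _))
          where *≤ : ∀ a {A} → A ≤ 1 → a * A ≤ a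
                *≤ a A≤ = ≤-trans (*-monoʳ-≤ a A≤) (≤-reflexive (*-identityʳ a))
        budget a b {A} {B} {C} {h} (yes β) A≤ B≤ C≤ a≤b = go β
          where
          open ≤-Reasoning
          *≤ : ∀ a {A} → A ≤ 1 → a * A ≤ a
          *≤ a A≤ = ≤-trans (*-monoʳ-≤ a A≤) (≤-reflexive (*-identityʳ a))
          go : A ≡ 0 ⊎ B ≡ 0 ⊎ C ≡ 0 ⊎ 1 ≤ h → b * A + a * B + a * C + a * 1 ≤ b + a + a + a * h
          go (inj₁ refl) = begin
            b * 0 + a * B + a * C + a * 1 ≡⟨ r b a B C ⟩
            a + a * B + a * C             ≤⟨ +-mono-≤ (+-mono-≤ a≤b (*≤ a B≤)) (*≤ a C≤) ⟩
            b + a + a                     ≤⟨ m≤m+n _ _ ⟩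
            b + a + a + a * h             ∎
            where r : ∀ b a B C → b * 0 + a * B + a * C + a * 1 ≡ a + a * B + a * C
                  r = solve-∀
          go (inj₂ (inj₁ refl)) = begin
            b * A + a * 0 + a * C + a * 1 ≡⟨ r (b * A) a C ⟩
            b * A + a + a * C             ≤⟨ +-mono-≤ (+-monoˡ-≤ a (*≤ b A≤)) (*≤ a C≤) ⟩
            b + a + a                     ≤⟨ m≤m+n _ _ ⟩
            b + a + a + a * h             ∎
            where r : ∀ b a C → b + a * 0 + a * C + a * 1 ≡ b + a + a * C
                  r = solve-∀
          go (inj₂ (inj₂ (inj₁ refl))) = begin
            b * A + a * B + a * 0 + a * 1 ≡⟨ r (b * A) a B ⟩
            b * A + a * B + a             ≤⟨ +-monoˡ-≤ a (+-mono-≤ (*≤ b A≤) (*≤ a B≤)) ⟩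
            b + a + a                     ≤⟨ m≤m+n _ _ ⟩
            b + a + a + a * h             ∎
            where r : ∀ b a B → b + a * B + a * 0 + a * 1 ≡ b + a * B + a
                  r = solve-∀
          go (inj₂ (inj₂ (inj₂ h≥1))) = +-mono-≤ (+-mono-≤ (+-mono-≤ (*≤ b A≤) (*≤ a B≤)) (*≤ a C≤)) (*-monoʳ-≤ a h≥1)

        -- The constant is twice the weight of four members of weight `w₂` with one surplus `d₀` and
        -- two surpluses `d₁`, as much as two opposite chains can share.
        pair-bound : ∀ k → 2 * (weight (C k) + weight (C (k + m))) + (far (C k) + far (C (k + m)))
                           + 2 * d₁ * 𝟙 (Bad? k) + 2 * w₂ * (lossy k + lossy (k + m))
                         ≤ 8 * w₂ + 2 * d₀ + 4 * d₁ + 2 * w₂ * (extra (C k) + extra (C (k + m)))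
        pair-bound k = farkas 0
          (+-mono-≤ (+-mono-≤ (chain-bound k) (chain-bound k′))
            (+-mono-≤ (*-monoʳ-≤ 2 (budget d₁ d₀ (Bad? k) (exclusive k {m} {m} le₁) (exclusive k {suc m} {p} le₂)
                 (subst (_≤ 1) (+-comm (x (C k p)) _) (exclusive k {p} {suc m} le₃)) d₁≤d₀))
              (*-monoʳ-≤ (2 * w₂) (+-mono-≤ (Ch.count+ℓ k) (Ch.count+ℓ k′)))))
          (r (weight (C k)) (weight (C k′)) (far (C k)) (far (C k′)) d₁ d₀ w₂ (𝟙 (Bad? k)) (lossy k) (lossy k′)
              (extra (C k)) (extra (C k′))
             (high k) (high k′) (count (C k)) (count (C k′)) (x (C k m)) (x (C k′ m)) (x (C k (suc m)))
                 (x (C k′ (suc m))) (x (C k p)) (x (C k′ p)))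
          where
          k′ = k + m
          le₁ : m + m ≤ n
          le₁ = ≤-reflexive (sym n≡)
          le₂ : suc m + p ≤ n
          le₂ = ≤-reflexive (trans (sym (+-suc m p)) (sym n≡))
          le₃ : p + suc m ≤ n
          le₃ = ≤-reflexive (trans (+-suc p m) (sym n≡))
          r : ∀ W W′ F F′ d₁ d₀ w β l l′ y y′ h h′ X X′ a a′ b b′ c c′ →
              2 * (W + W′) + (F + F′) + 2 * d₁ * β + 2 * w * (l + l′)
              + (2 * (w * X + (d₀ * a + d₁ * b + d₁ * c)) + 2 * (w * X′ + (d₀ * a′ + d₁ * b′ + d₁ * c′))
                 + (2 * (d₀ + d₁ + d₁ + d₁ * (h + h′)) + 2 * w * (2 + y + (2 + y′)))) + 0
              ≡ 8 * w + 2 * d₀ + 4 * d₁ + 2 * w * (y + y′)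
              + (2 * W + F + 2 * (d₁ * h) + (2 * W′ + F′ + 2 * (d₁ * h′))
                 + (2 * (d₀ * (a + a′) + d₁ * (b + c′) + d₁ * (b′ + c) + d₁ * β) + 2 * w * (X + l + (X′ + l′))))
          r = solve-∀

      total-weight total-far : ℕ
      total-weight = ∑[ k ∈ range 0 n ] weight (C k)
      total-far    = ∑[ k ∈ range 0 n ] far (C k)

      capacity : ℕ
      capacity = m * (8 * w₂ + 2 * d₀ + 4 * d₁)

      sum-bound : 2 * total-weight + total-far + 2 * d₁ * bads + 2 * w₂ * total-lossy ≤ capacity + 2 * w₂ * total-extra
      sum-bound = begin
        2 * total-weight + total-far + 2 * d₁ * bads + 2 * w₂ * total-lossy
          ≡⟨ cong₂ _+_ (cong₂ _+_ (cong₂ _+_ (trans (cong (2 *_) (∑-pairs (weight ∘ C))) (sym (∑-*ˡ 2 R fW))) (∑-pairs (far ∘ C)))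
               (sym (∑-*ˡ (2 * d₁) R fB))) (trans (cong (2 * w₂ *_) (∑-pairs lossy)) (sym (∑-*ˡ (2 * w₂) R fL))) ⟩
        ∑[ k ∈ R ] (2 * fW k) + ∑ R fF + ∑[ k ∈ R ] (2 * d₁ * fB k) + ∑[ k ∈ R ] (2 * w₂ * fL k)
          ≡⟨ trans (∑-+ R (λ k → 2 * fW k + fF k + 2 * d₁ * fB k) (λ k → 2 * w₂ * fL k)) (cong (_+ ∑[ k ∈ R ] (2 * w₂ * fL k))
               (trans (∑-+ R (λ k → 2 * fW k + fF k) (λ k → 2 * d₁ * fB k))
               (cong (_+ ∑[ k ∈ R ] (2 * d₁ * fB k)) (∑-+ R (λ k → 2 * fW k) fF)))) ⟨
        ∑[ k ∈ R ] (2 * fW k + fF k + 2 * d₁ * fB k + 2 * w₂ * fL k)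
          ≤⟨ ∑-mono R (λ {k} _ → pair-bound k) ⟩
        ∑[ k ∈ R ] (8 * w₂ + 2 * d₀ + 4 * d₁ + 2 * w₂ * fE k)
          ≡⟨ ∑-+ R (λ _ → 8 * w₂ + 2 * d₀ + 4 * d₁) (λ k → 2 * w₂ * fE k) ⟩
        ∑[ k ∈ R ] (8 * w₂ + 2 * d₀ + 4 * d₁) + ∑[ k ∈ R ] (2 * w₂ * fE k)
          ≡⟨ cong₂ _+_ (const 0 m) (trans (∑-*ˡ (2 * w₂) R fE) (cong (2 * w₂ *_) (sym (∑-pairs (extra ∘ C))))) ⟩
        capacity + 2 * w₂ * total-extra ∎
        where
        open ≤-Reasoning
        R = range 0 m
        fW fF fB fL fE : ℕ → ℕ
        fW k = weight (C k) + weight (C (k + m))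
        fF k = far (C k) + far (C (k + m))
        fB k = 𝟙 (Bad? k)
        fL k = lossy k + lossy (k + m)
        fE k = extra (C k) + extra (C (k + m))
        const : ∀ a l → ∑[ k ∈ range a l ] (8 * w₂ + 2 * d₀ + 4 * d₁) ≡ l * (8 * w₂ + 2 * d₀ + 4 * d₁)
        const a zero    = refl
        const a (suc l) = cong (8 * w₂ + 2 * d₀ + 4 * d₁ +_) (const (suc a) l)

      -- Few lossy chains force many bad pairs, which cost even more.
      few-lossy : m ≤ total-lossy + bads → (6 + echoes) * w₂ ≤ 2 * d₁ * bads + 2 * w₂ * total-lossy
      few-lossy m≤ = *-cancel-≤-pos m (s≤s z≤n) (begin
        m * ((6 + echoes) * w₂)                            ≡⟨ r₁ m echoes w₂ ⟩
        6 * (m * w₂) + m * (echoes * w₂)                   ≤⟨ +-monoˡ-≤ _ (*-monoʳ-≤ 6 (*-monoˡ-≤ w₂ m≤)) ⟩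
        6 * ((N + G) * w₂) + m * (echoes * w₂)             ≡⟨ r₂ N G w₂ _ ⟩
        6 * (N * w₂) + 2 * (3 * w₂ * G) + m * (echoes * w₂) ≤⟨ +-mono-≤
            (+-mono-≤ (*-monoˡ-≤ (N * w₂) 6≤m) (*-monoʳ-≤ 2 (*-monoˡ-≤ G 3w₂≤md₁)))
                                                                (*-monoʳ-≤ m (*-monoˡ-≤ w₂ (≤-trans echoes≤mids mids≤lossy))) ⟩
        m * (N * w₂) + 2 * (m * d₁ * G) + m * (N * w₂)     ≡⟨ r₃ m N w₂ d₁ G ⟩
        m * (2 * d₁ * G + 2 * w₂ * N) ∎)
        where
        open ≤-Reasoning
        N = total-lossy
        G = bads
        r₁ : ∀ m e w → m * ((6 + e) * w) ≡ 6 * (m * w) + m * (e * w)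
        r₁ = solve-∀
        r₂ : ∀ N G w z → 6 * ((N + G) * w) + z ≡ 6 * (N * w) + 2 * (3 * w * G) + z
        r₂ = solve-∀
        r₃ : ∀ m N w d G → m * (N * w) + 2 * (m * d * G) + m * (N * w) ≡ m * (2 * d * G + 2 * w * N)
        r₃ = solve-∀

      loss : (4 + echoes) * w₂ ≤ 2 * d₁ * bads + 2 * w₂ * total-lossy
      loss with dichotomy
      ... | inj₁ q = begin
        (4 + echoes) * w₂              ≤⟨ *-monoˡ-≤ w₂ (+-monoʳ-≤ 4 echoes≤adjacent) ⟩
        (4 + (adjacent + adjacent)) * w₂ ≡⟨ r adjacent w₂ ⟩
        2 * w₂ * (2 + adjacent)        ≤⟨ *-monoʳ-≤ (2 * w₂) q ⟩
        2 * w₂ * total-lossy           ≤⟨ m≤n+m _ _ ⟩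
        2 * d₁ * bads + 2 * w₂ * total-lossy ∎
        where
        open ≤-Reasoning
        r : ∀ a w → (4 + (a + a)) * w ≡ 2 * w * (2 + a)
        r = solve-∀
      ... | inj₂ q = ≤-trans (*-monoˡ-≤ w₂ (+-monoˡ-≤ echoes (m≤m+n 4 2))) (few-lossy q)

      -- The left side keeps `w₂` for every mid, and more for mids of extreme size, in order to pay,
      -- on average over the orderings, for the members around mids on the right.
      cycle-bound : 2 * total-weight + 4 * w₂ + (w₂ * total-mids + total-far)
                    ≤ capacity + (2 * w₂ * total-extra + w₂ * neighbour-extra)
      cycle-bound = farkas 0 (+-mono-≤ (+-mono-≤ sum-bound loss) (*-monoʳ-≤ w₂ mids≤echoes))
        (r total-weight w₂ total-mids total-far capacity total-extra neighbour-extra d₁ bads total-lossy echoes)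
        where
        r : ∀ W w H F K Y Y′ d G N R → 2 * W + 4 * w + (w * H + F) + (K + 2 * w * Y + (2 * d * G + 2 * w * N) + w * (R + Y′)) + 0
            ≡ K + (2 * w * Y + w * Y′) + (2 * W + F + 2 * d * G + 2 * w * N + (4 + R) * w + w * H)
        r = solve-∀

      tight : 1 ≤ w₂ → 1 ≤ d₁ → total-extra ≡ 0 → capacity ≤ 2 * total-weight + 4 * w₂ → total-lossy ≡ 2 × bads ≡ 0
      tight w₂>0 d₁>0 Y≡0 le = go dichotomy
        where
        open ≤-Reasoning
        bound : 2 * d₁ * bads + 2 * w₂ * total-lossy ≤ 4 * w₂
        bound = farkas total-far (+-mono-≤ le sum-bound)
          (trans (cong (λ z → 2 * d₁ * bads + 2 * w₂ * total-lossy + (2 * total-weight + 4 * w₂ +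
              (capacity + 2 * w₂ * z)) + total-far) Y≡0)
            (r (2 * d₁ * bads) (2 * w₂ * total-lossy) total-weight w₂ capacity total-far))
          where
          r : ∀ a b W w K F → a + b + (2 * W + 4 * w + (K + 2 * w * 0)) + F ≡ 4 * w + (K + (2 * W + F + a + b))
          r = solve-∀
        go : 2 + adjacent ≤ total-lossy ⊎ m ≤ total-lossy + bads → total-lossy ≡ 2 × bads ≡ 0
        -- `few-lossy` would demand a loss of 6 `w₂`, while equality leaves only 4 `w₂`.
        go (inj₂ q) = ⊥-elim (<⇒≱ (*-monoˡ-< w₂ {{>-nonZero w₂>0}} {4} {6} (s≤s (s≤s (s≤s (s≤s (s≤s z≤n))))))
          (≤-trans (*-monoˡ-≤ w₂ (m≤m+n 6 echoes)) (≤-trans (few-lossy q) bound)))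
        go (inj₁ q) = ≤-antisym N≤2 2≤N , G≡0 (pos⊎0 bads)
          where
          2≤N : 2 ≤ total-lossy
          2≤N = ≤-trans (m≤m+n 2 adjacent) q
          N≤2 : total-lossy ≤ 2
          N≤2 = *-cancel-≤-pos (2 * w₂) (≤-trans w₂>0 (m≤m+n w₂ _)) (≤-trans (m≤n+m _ _) (≤-trans bound (≤-reflexive (r w₂))))
            where r : ∀ w → 4 * w ≡ 2 * w * 2
                  r = solve-∀
          G≡0 : 1 ≤ bads ⊎ bads ≡ 0 → bads ≡ 0
          G≡0 (inj₂ e) = e
          G≡0 (inj₁ G>0) = ⊥-elim (<⇒≱ (m<n+m (4 * w₂) (*-mono-≤ (≤-trans d₁>0 (m≤m+n d₁ _)) G>0))
            (≤-trans (+-monoʳ-≤ (2 * d₁ * bads) (≤-trans (≤-reflexive (r w₂)) (*-monoʳ-≤ (2 * w₂) 2≤N))) bound))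
            where r : ∀ w → 4 * w ≡ 2 * w * 2
                  r = solve-∀

-- Even n: the upper bound

⌈/2⌉-even : ∀ x → even x ≡ true → ⌈ x /2⌉ ≡ ⌊ x /2⌋
⌈/2⌉-odd  : ∀ x → even x ≡ false → ⌈ x /2⌉ ≡ suc ⌊ x /2⌋
⌈/2⌉-even zero          _ = refl
⌈/2⌉-even (suc (suc x)) e = cong suc (⌈/2⌉-even x (trans (sym (not² (even x))) e))
  where not² : ∀ b → not (not b) ≡ b
        not² true  = refl
        not² false = refl
⌈/2⌉-odd (suc zero)     _ = refl
⌈/2⌉-odd (suc (suc x)) e = cong suc (⌈/2⌉-odd x (trans (sym (not² (even x))) e))
  where not² : ∀ b → not (not b) ≡ b
        not² true  = refl
        not² false = refl

⊑-trans : ∀ {I J K : ℕ → Bool} → I ⊑ J → J ⊑ K → I ⊑ K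
⊑-trans f g p = g p ∘ f p

-- Chains of arcs on a circle of even length

module ArcGrid (n : ℕ) .{{nz : NonZero n}} (m : ℕ) (n≡ : n ≡ m + m) (1≤n : 1 ≤ n) where

  -- For fixed k the arcs J k s form a chain that grows alternately to the left and to the right.
  offset : ℕ → ℕ
  offset s = ⌈ s + m /2⌉

  J : ℕ → ℕ → ℕ → Bool
  J k s = arc n (k + offset s) s

  J-suc : ∀ k s → J k s ⊑ J k (suc s)
  J-suc k s with even (s + m) in e
  ... | true  = subst (λ a → J k s ⊑ arc n a (suc s))
                  (trans (sym (+-suc k _)) (cong (λ z → k + suc z) (⌈/2⌉-even (s + m) e))) (arc-⊑-suc (k + offset s) s)
  ... | false = subst (λ a → J k s ⊑ arc n (k + a) (suc s)) (⌈/2⌉-odd (s + m) e) (arc-⊑ (k + offset s) (n≤1+n s))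

  J-nest′ : ∀ k s d → J k s ⊑ J k (d + s)
  J-nest′ k s zero    p h = h
  J-nest′ k s (suc d) p h = J-suc k (d + s) p (J-nest′ k s d p h)

  J-nest : ∀ k {s t} → s ≤ t → J k s ⊑ J k t
  J-nest k {s} {t} s≤t = subst (λ z → J k s ⊑ J k z) (m∸n+n≡m s≤t) (J-nest′ k s (t ∸ s))

  J-up : ∀ k s → even (s + m) ≡ false → J k s ⊑ J (suc k) (suc s)
  J-up k s e = subst (λ a → J k s ⊑ arc n (suc (k + a)) (suc s)) (⌈/2⌉-odd (s + m) e) (arc-⊑-suc (k + offset s) s)

  J-down : ∀ k s → even (s + m) ≡ true → J (suc k) s ⊑ J k (suc s)
  J-down k s e = subst (λ a → J (suc k) s ⊑ arc n a (suc s))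
    (trans (cong (λ z → suc (k + z)) (⌈/2⌉-even (s + m) e)) (sym (+-suc k ⌊ s + m /2⌋))) (arc-⊑ (suc k + offset s) (n≤1+n s))

  J-period : ∀ k s p → J (k + n) s p ≡ J k s p
  J-period k s p = trans (cong (λ a → arc n a s p) (comm k n (offset s))) (arc-period (k + offset s) s p)
    where comm : ∀ a b c → a + b + c ≡ a + c + b
          comm = solve-∀

  J-opposite : ∀ k {s t} → s + t ≤ n → ∀ p → J k s p ≡ true → J (k + m) t p ≡ true → ⊥
  J-opposite k {s} {t} s+t≤n p h h′ = arc-disjoint (k + offset s) {s} {n ∸ s} {p} (≤-reflexive (m+[n∸m]≡n s≤n)) h
    (trans (cong (λ a → arc n a (n ∸ s) p) off) (J-nest (k + m) t≤ p h′))
    where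
    s≤n = ≤-trans (m≤m+n s t) s+t≤n
    t≤ : t ≤ n ∸ s
    t≤ = m+n≤o⇒m≤o∸n t (subst (_≤ n) (+-comm s t) s+t≤n)
    -- `J (k + m) (n ∸ s)` is the complement of `J k s`: with u = n - s, the identity s + u = m + m
    -- turns `offset s + u` into `m + offset u`.
    off : k + offset s + (n ∸ s) ≡ k + m + offset (n ∸ s)
    off = trans (+-assoc k _ _) (trans (cong (k +_) (begin
      ⌈ s + m /2⌉ + u           ≡⟨ +-comm _ u ⟩
      u + ⌈ s + m /2⌉           ≡⟨ ⌈/2⌉-+ u (s + m) ⟨
      ⌈ u + u + (s + m) /2⌉     ≡⟨ cong ⌈_/2⌉ (r u s m) ⟩
      ⌈ s + u + (u + m) /2⌉     ≡⟨ cong (λ z → ⌈ z + (u + m) /2⌉) (trans (m+[n∸m]≡n s≤n) n≡) ⟩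
      ⌈ m + m + (u + m) /2⌉     ≡⟨ ⌈/2⌉-+ m (u + m) ⟩
      m + ⌈ u + m /2⌉           ∎)) (sym (+-assoc k m _)))
      where
      open ≡-Reasoning
      u = n ∸ s
      r : ∀ u s m → u + u + (s + m) ≡ s + u + (u + m)
      r = solve-∀

  -- `k + (n ∸ 1)` stands for k - 1 modulo n. The body repeats that of `neighbour`, so that the two
  -- agree by definition.
  side : ℕ → ℕ → ℕ
  side k s = if even (s + m) then k + (n ∸ 1) else suc k

  private
    not-true : ∀ {b} → not b ≡ true → b ≡ false
    not-true {false} _ = refl
    not-false : ∀ {b} → not b ≡ false → b ≡ true
    not-false {true} _ = refl
    wrap : ∀ k → suc (k + (n ∸ 1)) ≡ k + n
    wrap k = trans (sym (+-suc k (n ∸ 1))) (cong (k +_) (m+[n∸m]≡n 1≤n))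
    unwind : ∀ k s → J (suc (k + (n ∸ 1))) s ⊑ J k s
    unwind k s p h = trans (sym (trans (cong (λ z → J z s p) (wrap k)) (J-period k s p))) h
    wind : ∀ k s → J k s ⊑ J (suc (k + (n ∸ 1))) s
    wind k s p h = trans (trans (cong (λ z → J z s p) (wrap k)) (J-period k s p)) h

  side-below : ∀ k s t → t < s → J (side k s) t ⊑ J k s
  side-below k (suc s) t (s≤s t≤s) with even (suc s + m) in e
  ... | true  = ⊑-trans (J-nest j t≤s) (⊑-trans (J-up j s (not-true e)) (unwind k (suc s)))
    where j = k + (n ∸ 1)
  ... | false = ⊑-trans (J-nest (suc k) t≤s) (J-down k s (not-false e))

  side-above : ∀ k s t → s < t → J k s ⊑ J (side k s) t
  side-above k s t s<t with even (s + m) in e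
  ... | true  = ⊑-trans (wind k s) (⊑-trans (J-down j s e) (J-nest j s<t))
    where j = k + (n ∸ 1)
  ... | false = ⊑-trans (J-up k s e) (J-nest (suc k) s<t)

-- `Z` and `Z′` count the members around the mids of one arc on its own and on the neighbouring
-- chain, with the factors 2 and 1 of `cycle-bound`. The 1 in `3 * n + 1` makes the inequality
-- strict unless there are no mids.
weighing : ∀ {P Z Z′ n U κ} → 1 ≤ P → P * Z ≤ n * U → P * Z′ ≤ n * U → 3 * n + 1 ≤ P * κ →
           2 * Z + Z′ ≤ κ * U × (κ * U ≤ 2 * Z + Z′ → U ≡ 0)
weighing {P} {Z} {Z′} {n} {U} {κ} 1≤P h h′ k = *-cancel-≤-pos P 1≤P (≤-trans (m≤m+n _ U) main) , tight
  where
  open ≤-Reasoning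
  main : P * (2 * Z + Z′) + U ≤ P * (κ * U)
  main = begin
    P * (2 * Z + Z′) + U       ≡⟨ cong (_+ U) (r₁ P Z Z′) ⟩
    2 * (P * Z) + P * Z′ + U   ≤⟨ +-monoˡ-≤ U (+-mono-≤ (*-monoʳ-≤ 2 h) h′) ⟩
    2 * (n * U) + n * U + U    ≡⟨ r₂ n U ⟩
    (3 * n + 1) * U            ≤⟨ *-monoˡ-≤ U k ⟩
    P * κ * U                  ≡⟨ *-assoc P κ U ⟩
    P * (κ * U)                ∎
    where
    r₁ : ∀ P Z Z′ → P * (2 * Z + Z′) ≡ 2 * (P * Z) + P * Z′
    r₁ = solve-∀
    r₂ : ∀ n U → 2 * (n * U) + n * U + U ≡ (3 * n + 1) * U
    r₂ = solve-∀
  tight : κ * U ≤ 2 * Z + Z′ → U ≡ 0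
  tight le = n≤0⇒n≡0 (+-cancelˡ-≤ (P * (2 * Z + Z′)) _ _ (≤-trans main
      (≤-trans (*-monoʳ-≤ P le) (≤-reflexive (sym (+-identityʳ _))))))

-- A mid whose size is close to 0 or n may have comparatively many other members around it, but then its own
-- weight is small; the factor 1 + 𝟙 (extreme? n s) accounts for this trade-off.
extreme? : ∀ n s → Dec (s ≤ 3 ⊎ n ≤ 3 + s)
extreme? n s = (s ≤? 3) ⊎-dec (n ≤? 3 + s)

-- From s = 4 on, s (n - s) is at least 4 (n - 4), which exceeds 3 n for n > 16. For s = 3 the
-- product 3 (n - 3) never reaches 3 n; this fixes the threshold for extreme sizes, where doubling
-- suffices.
3n<s[n-s] : ∀ n s → 18 ≤ n → 2 ≤ s → 2 + s ≤ n → 3 * n + 1 ≤ s * (n ∸ s) * (1 + 𝟙 (extreme? n s))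
3n<s[n-s] n s 18≤n 2≤s s+2≤n with extreme? n s
... | yes e = go e
  where
  open ≤-Reasoning
  t = n ∸ s
  n≡ : n ≡ s + t
  n≡ = sym (m+[n∸m]≡n (≤-trans (m≤n+m s 2) s+2≤n))
  2≤t : 2 ≤ t
  2≤t = m+n≤o⇒m≤o∸n 2 s+2≤n
  small : ∀ a b → 2 ≤ a → a ≤ 3 → 18 ≤ a + b → 3 * (a + b) + 1 ≤ a * b * 2
  small 2 b _ _ h = farkas 9 h (r b)
    where r : ∀ b → 3 * (2 + b) + 1 + (2 + b) + 9 ≡ 2 * b * 2 + 18
          r = solve-∀
  small 3 b _ _ h = farkas (2 * b + 5) h (r b)
    where r : ∀ b → 3 * (3 + b) + 1 + (3 + b) + (2 * b + 5) ≡ 3 * b * 2 + 18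
          r = solve-∀
  small (suc (suc (suc (suc a)))) b _ (s≤s (s≤s (s≤s ()))) h
  small 1 b (s≤s ()) _ h
  go : s ≤ 3 ⊎ n ≤ 3 + s → 3 * n + 1 ≤ s * t * 2
  go (inj₁ s≤3) = subst (λ z → 3 * z + 1 ≤ s * t * 2) (sym n≡) (small s t 2≤s s≤3 (subst (18 ≤_) n≡ 18≤n))
  go (inj₂ n≤) = subst₂ (λ y z → 3 * y + 1 ≤ z * 2) (trans (+-comm t s) (sym n≡)) (*-comm t s)
    (small t s 2≤t (≤-trans (∸-monoˡ-≤ s n≤) (≤-reflexive (m+n∸n≡m 3 s))) (subst (18 ≤_) (trans n≡ (+-comm s t)) 18≤n))
... | no ¬e with a , e₁ ← m≤n⇒∃[o]m+o≡n (≰⇒> (¬e ∘ inj₁)) | b , e₂ ← m≤n⇒∃[o]m+o≡n (m+n≤o⇒m≤o∸n 4 (≰⇒> (¬e ∘ inj₂))) =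
  farkas (a * b + 1) (subst (18 ≤_) n≡ 18≤n) (subst₂ (λ z t → 3 * z + 1 + (s + t) + (a * b + 1) ≡ s * t * 1 + 18) (sym n≡) refl
    (subst₂ (λ s t → 3 * (s + t) + 1 + (s + t) + (a * b + 1) ≡ s * t * 1 + 18) e₁ e₂ (r a b)))
  where
  n≡ : n ≡ s + (n ∸ s)
  n≡ = sym (m+[n∸m]≡n (≤-trans (m≤n+m s 2) s+2≤n))
  r : ∀ a b → 3 * (4 + a + (4 + b)) + 1 + (4 + a + (4 + b)) + (a * b + 1) ≡ (4 + a) * (4 + b) * 1 + 18
  r = solve-∀

∑-const : ∀ {A : Set} (xs : List A) c → ∑[ x ∈ xs ] c ≡ length xs * c
∑-const []       c = refl
∑-const (x ∷ xs) c = cong (c +_) (∑-const xs c)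

length-range : ∀ a n → length (range a n) ≡ n
length-range a zero    = refl
length-range a (suc n) = cong suc (length-range (suc a) n)

Star : ∀ {n} → ℕ → Fin n → Subset n → Set
Star m z F = (∣ F ∣ ≡ m × z ∈ˢ F) ⊎ (∣ F ∣ ≡ suc m ⊎ (∣ F ∣ ≡ 2 + m × z ∉ˢ F))

-- Writing the middle level as m = q + 2 avoids truncated subtraction below it.
module EvenLevels (n q : ℕ) (n≡ : n ≡ (2 + q) + (2 + q)) (7≤q : 7 ≤ q) where

  m = 2 + q
  w₀ = n choose m
  w₁ = n choose suc m
  w₂ = n choose (2 + m)
  w₃ = n choose (3 + m)
  d₀ = w₀ ∸ w₂
  d₁ = w₁ ∸ w₂

  capacity = m * (8 * w₂ + 2 * d₀ + 4 * d₁)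

  private
    open ≤-Reasoning

    n-[m+i] : ∀ i j → i + j ≡ m → n ∸ (i + m) ≡ j
    n-[m+i] i j e = trans (cong (_∸ (i + m)) (trans n≡ (trans (cong (_+ m) (trans (sym e) (+-comm i j)))
        (+-assoc j i m)))) (m+n∸n≡m j (i + m))

    m+i<n : ∀ i j → i + suc j ≡ m → i + m < n
    m+i<n i j e = subst (i + m <_) (trans (cong (_+ m) e) (sym n≡)) (+-monoˡ-< m (m<m+n i (s≤s z≤n)))

  ratio₁ : suc m * w₁ ≡ m * w₀
  ratio₁ = trans ([k+1]C[k+1]≡[n-k]Ck n m (m+i<n 0 (suc q) refl)) (cong (_* w₀) (n-[m+i] 0 m refl))

  ratio₂ : (2 + m) * w₂ ≡ (1 + q) * w₁
  ratio₂ = trans ([k+1]C[k+1]≡[n-k]Ck n (1 + m) (m+i<n 1 q refl)) (cong (_* w₁) (n-[m+i] 1 (1 + q) refl))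

  ratio₃ : (3 + m) * w₃ ≡ q * w₂
  ratio₃ = trans ([k+1]C[k+1]≡[n-k]Ck n (2 + m) 2+m<n) (cong (_* w₂) (n-[m+i] 2 q refl))
    where 2+m<n : 2 + m < n
          2+m<n = subst (2 + m <_) (sym n≡) (+-monoˡ-< m (s≤s (s≤s (≤-trans (s≤s z≤n) 7≤q))))

  18≤n : 18 ≤ n
  18≤n = subst (18 ≤_) (sym n≡) (+-mono-≤ (s≤s (s≤s 7≤q)) (s≤s (s≤s 7≤q)))

  3+m≤n : 3 + m ≤ n
  3+m≤n = subst (3 + m ≤_) (sym n≡) (+-monoˡ-≤ m (s≤s (s≤s (≤-trans (s≤s z≤n) 7≤q))))

  w₂≤w₁ : w₂ ≤ w₁
  w₂≤w₁ = *-cancel-≤-pos (2 + m) (s≤s z≤n) (≤-trans (≤-reflexive ratio₂) (*-monoˡ-≤ w₁ (m≤n+m (1 + q) 3)))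

  w₁≤w₀ : w₁ ≤ w₀
  w₁≤w₀ = *-cancel-≤-pos (suc m) (s≤s z≤n) (≤-trans (≤-reflexive ratio₁) (*-monoˡ-≤ w₀ (n≤1+n m)))

  w₁≡ : w₁ ≡ w₂ + d₁
  w₁≡ = sym (m+[n∸m]≡n w₂≤w₁)

  w₀≡ : w₀ ≡ w₂ + d₀
  w₀≡ = sym (m+[n∸m]≡n (≤-trans w₂≤w₁ w₁≤w₀))

  d₁≤d₀ : d₁ ≤ d₀
  d₁≤d₀ = ∸-monoˡ-≤ w₂ w₁≤w₀

  3w₂≡ : 3 * w₂ ≡ (1 + q) * d₁
  3w₂≡ = +-cancelˡ-≡ ((1 + q) * w₂) _ _ (trans (r q w₂) (trans ratio₂ (trans (cong ((1 + q) *_) w₁≡)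
      (*-distribˡ-+ (1 + q) w₂ d₁))))
    where r : ∀ q w → (1 + q) * w + 3 * w ≡ (4 + q) * w
          r = solve-∀

  3w₂≤md₁ : 3 * w₂ ≤ m * d₁
  3w₂≤md₁ = ≤-trans (≤-reflexive 3w₂≡) (*-monoˡ-≤ d₁ (n≤1+n (1 + q)))

  w₂>0 : 1 ≤ w₂
  w₂>0 = C-pos n (2 + m) (≤-trans (n≤1+n _) 3+m≤n)

  d₁>0 : 1 ≤ d₁
  d₁>0 with d₁ in e
  ... | suc _ = s≤s z≤n
  ... | zero = ⊥-elim (<⇒≱ (≤-trans w₂>0 (m≤m+n w₂ _)) (≤-reflexive (trans 3w₂≡ (trans (cong ((1 + q) *_) e) (*-zeroʳ (1 + q))))))

  -- Multiplied by (q + 5)(q + 1) both sides become multiples of w₂; this is where q ≥ 5 is needed.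
  w₃+d₁≤w₂ : w₃ + d₁ ≤ w₂
  w₃+d₁≤w₂ = *-cancel-≤-pos ((5 + q) * (1 + q)) (s≤s z≤n) (begin
    (5 + q) * (1 + q) * (w₃ + d₁)                        ≡⟨ r₁ q w₃ d₁ ⟩
    (1 + q) * ((5 + q) * w₃) + (5 + q) * ((1 + q) * d₁)  ≡⟨ cong₂ (λ a b → (1 + q) * a + (5 + q) * b) ratio₃ (sym 3w₂≡) ⟩
    (1 + q) * (q * w₂) + (5 + q) * (3 * w₂)              ≡⟨ r₂ q w₂ ⟩
    (q * q + 4 * q + 15) * w₂                            ≤⟨ *-monoˡ-≤ w₂
        (farkas {l = q * q + 4 * q + 15} {r = (5 + q) * (1 + q)} 4 (*-monoʳ-≤ 2 7≤q) (r₃ q)) ⟩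
    (5 + q) * (1 + q) * w₂                               ∎)
    where
    r₁ : ∀ q a b → (5 + q) * (1 + q) * (a + b) ≡ (1 + q) * ((5 + q) * a) + (5 + q) * ((1 + q) * b)
    r₁ = solve-∀
    r₂ : ∀ q w → (1 + q) * (q * w) + (5 + q) * (3 * w) ≡ (q * q + 4 * q + 15) * w
    r₂ = solve-∀
    r₃ : ∀ q → q * q + 4 * q + 15 + 2 * q + 4 ≡ (5 + q) * (1 + q) + 2 * 7
    r₃ = solve-∀

  mirror : ∀ i j → i + j ≡ m → n choose j ≡ n choose (i + m)
  mirror i j e = trans (nCk≡nC[n∸k] (≤-trans (≤-trans (m≤n+m j i) (≤-reflexive e)) (subst (m ≤_) (sym n≡) (m≤m+n m m))))
    (cong (n choose_) (trans (cong (_∸ j) (trans n≡ (trans (cong (_+ m) (trans (sym e) (+-comm i j))) (+-assoc j i m))))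
        (m+n∸m≡n j (i + m))))

  w-low : ∀ s → s ≤ q → n choose s ≤ w₂
  w-low s s≤q = ≤-trans (C-mono-≤ n s≤q (≤-trans (+-mono-≤ (m≤n+m q 2) (m≤n+m q 2))
      (≤-trans (≤-reflexive (sym n≡)) (n≤1+n n)))) (≤-reflexive (mirror 2 q refl))

  w-high : ∀ s → 3 + m ≤ s → s ≤ n → n choose s ≤ w₃
  w-high s h s≤n = C-anti-≤ n s≤n h (≤-trans (+-mono-≤ (∸-monoʳ-≤ n (m≤n+m m 3)) (∸-monoʳ-≤ n (m≤n+m m 3)))
    (≤-trans (≤-reflexive (trans (cong (λ z → z + z) (n-[m+i] 0 m refl)) (sym n≡))) (n≤1+n n)))

  -- The ratio of n choose 4 to n choose 3 is (n - 3) / 4, which is at least 2.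
  2w-small : ∀ s → s ≤ 3 → 2 * (n choose s) ≤ w₂
  2w-small s s≤3 = begin
    2 * (n choose s) ≤⟨ *-monoʳ-≤ 2 (C-mono-≤ n s≤3 (≤-trans (m≤m+n 6 12) (≤-trans 18≤n (n≤1+n n)))) ⟩
    2 * (n choose 3) ≤⟨ *-cancel-≤-pos 4 (s≤s z≤n) step ⟩
    n choose 4       ≤⟨ w-low 4 (≤-trans (m≤m+n 4 3) 7≤q) ⟩
    w₂          ∎
    where
    step : 4 * (2 * (n choose 3)) ≤ 4 * (n choose 4)
    step = begin
      4 * (2 * (n choose 3))  ≡⟨ sym (*-assoc 4 2 (n choose 3)) ⟩
      8 * (n choose 3)        ≤⟨ *-monoˡ-≤ (n choose 3) (m+n≤o⇒m≤o∸n 8 (≤-trans (m≤m+n 11 7) 18≤n)) ⟩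
      (n ∸ 3) * (n choose 3)  ≡⟨ [k+1]C[k+1]≡[n-k]Ck n 3 (≤-trans (m≤m+n 4 14) 18≤n) ⟨
      4 * (n choose 4)        ∎

  2w-extreme : ∀ s → s ≤ n → s ≤ 3 ⊎ n ≤ 3 + s → 2 * (n choose s) ≤ w₂
  2w-extreme s _   (inj₁ h) = 2w-small s h
  2w-extreme s s≤n (inj₂ h) = subst (λ z → 2 * z ≤ w₂) (sym (nCk≡nC[n∸k] s≤n))
    (2w-small (n ∸ s) (≤-trans (∸-monoˡ-≤ s h) (≤-reflexive (m+n∸n≡m 3 s))))

  -- The second unit of `w₂` granted to mids of extreme size, affordable because twice their weight
  -- is at most `w₂`.
  ψ : ℕ → ℕ
  ψ s = w₂ * 𝟙 (extreme? n s)

  ψ-bound : ∀ s → s ≤ n → n choose s ≤ w₂ → 2 * (n choose s) + ψ s ≤ 2 * w₂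
  ψ-bound s s≤n h with extreme? n s
  ... | yes e = ≤-trans (+-mono-≤ (2w-extreme s s≤n e) (≤-reflexive (*-identityʳ w₂)))
      (≤-reflexive (cong (w₂ +_) (sym (+-identityʳ w₂))))
  ... | no _  = ≤-trans (≤-reflexive (trans (cong (2 * (n choose s) +_) (*-zeroʳ w₂)) (+-identityʳ _))) (*-monoʳ-≤ 2 h)

  ψ-centre : ∀ s → suc q ≤ s → s ≤ 2 + m → ψ s ≡ 0
  ψ-centre s q<s s≤ = trans (cong (w₂ *_) (𝟙-no (extreme? n s) λ { (inj₁ h) → <⇒≱ (≤-trans (s≤s (≤-trans (m≤m+n 3 4) 7≤q)) q<s) h
                                                                    ; (inj₂ h) → <⇒≱ far h })) (*-zeroʳ w₂)
    where
    far : 3 + s < n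
    far = subst (3 + s <_) (sym n≡) (≤-trans (s≤s (+-monoʳ-≤ 3 s≤)) (+-monoˡ-≤ m (s≤s (s≤s (≤-trans (m≤m+n 4 3) 7≤q)))))

-- Averaging the circles over all orderings

module Even {n : ℕ} .{{nz : NonZero n}} (q : ℕ) (n≡ : n ≡ (2 + q) + (2 + q)) (7≤q : 7 ≤ q)
            (𝓕 : List (Subset n)) (unique : Unique 𝓕)
            (intersecting : Intersecting 𝓕) (free : ButterflyFree 𝓕) (proper : ∀ {B} → B ∈ 𝓕 → ∣ B ∣ < n) where

  open EvenLevels n q n≡ 7≤q public
  open Family 𝓕 unique intersecting free public
  open Arcs 𝓕 unique intersecting free public
  open Chains 𝓕 unique intersecting free public

  1≤n : 1 ≤ n
  1≤n = ≤-trans (s≤s z≤n) 18≤n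

  open ArcGrid n m n≡ 1≤n public

  grid : Vec ℕ n → ℕ → ℕ → Subset n
  grid σ k s = Vec.map (J k s) σ

  size-J : ∀ k s → s ≤ n → size n (J k s) ≡ s
  size-J k s = size-arc (k + offset s) s

  size-grid : ∀ {σ} → σ ∈ Ω n → ∀ k s → s ≤ n → ∣ grid σ k s ∣ ≡ s
  size-grid σ∈ k s s≤n = trans (∣map∣ (J k s) σ∈) (size-J k s s≤n)

  module Cyc {σ : Vec ℕ n} (σ∈ : σ ∈ Ω n) where
    open Cycle (suc q) n≡ (s≤s z≤n) (grid σ) (size-grid σ∈)
      (λ k s≤t → map-⊆ σ (J-nest k s≤t))
      (λ k s e → map-⊆ σ (J-up k s e))
      (λ k s e → map-⊆ σ (J-down k s e))
      (λ k {s} {t} le {e} e∈ e∈′ → J-opposite k {s} {t} le (lookup σ e) (∈-map⁻ σ e∈) (∈-map⁻ σ e∈′))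
      (λ k s → Vecₚ.map-cong (J-period k s) σ) public hiding (m)
    open Weights (n choose_) ψ d₀ d₁ (≤-trans (m≤m+n 6 3) (s≤s (s≤s 7≤q))) d₁≤d₀ w₀≡ w₁≡ (trans (mirror 1 (suc q) refl) w₁≡)
      (λ s s<p → ψ-bound s (≤-trans (≤-pred s<p) (≤-trans (m≤n+m q 5) 3+m≤n)) (w-low s (≤-pred s<p)))
      ψ-centre
      (λ s h s<n → ψ-bound s (<⇒≤ s<n) (≤-trans (w-high s h (<⇒≤ s<n)) (≤-trans (m≤m+n w₃ d₁) w₃+d₁≤w₂)))
      (λ s h s<n → ≤-trans (+-monoˡ-≤ d₁ (w-high s h (<⇒≤ s<n))) w₃+d₁≤w₂)
      3w₂≤md₁ public hiding (w₂; capacity)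

  private
    K = range 0 n
    S = range 1 (n ∸ 1)

  gridμ gridR gridR′ : ℕ → ℕ → Vec ℕ n → ℕ
  gridμ k s σ  = μ (grid σ k s)
  gridR k s σ  = μ (grid σ k s) * rest (grid σ k) s
  gridR′ k s σ = μ (grid σ k s) * rest (grid σ (side k s)) s

  weightsum : Vec ℕ n → ℕ
  weightsum σ = ∑[ k ∈ K ] ∑[ s ∈ S ] ((n choose s) * x (grid σ k s))

  ∑-weightsum : ∑ (Ω n) weightsum ≡ n * (n ! * length 𝓕)
  ∑-weightsum = trans (∑-swap (Ω n) K _) (trans (∑-cong K (λ {k} _ → ∑-Ω-weights (λ s → J k s)
      (λ s _ s<n → size-J k s (<⇒≤ s<n))))
    (trans (∑-const K _) (cong₂ _*_ (length-range 0 n) (cong (n ! *_)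
      (trans (∑-cong 𝓕 (λ {A} A∈ → 𝟙-yes (∣ A ∣ <? n) (proper A∈))) (trans (∑-const 𝓕 1) (*-identityʳ _)))))))

  bonus : ℕ → ℕ
  bonus s = 𝟙 (extreme? n s)

  private
    sum-R : ∀ k s → s < n → (s * (n ∸ s)) * ∑ (Ω n) (gridR k s) ≤ n * ∑ (Ω n) (gridμ k s)
    sum-R k s s<n = ∑-mid-others-arc (J k s) s (size-J k s (<⇒≤ s<n)) (λ t → k + offset t) proper s<n
      (λ t t<s → J-nest k (<⇒≤ t<s)) (λ t s<t _ → J-nest k (<⇒≤ s<t))

    sum-R′ : ∀ k s → s < n → (s * (n ∸ s)) * ∑ (Ω n) (gridR′ k s) ≤ n * ∑ (Ω n) (gridμ k s)
    sum-R′ k s s<n = ∑-mid-others-arc (J k s) s (size-J k s (<⇒≤ s<n)) (λ t → side k s + offset t) proper s<n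
      (λ t t<s → side-below k s t t<s) (λ t s<t _ → side-above k s t s<t)

    mid-size : ∀ {M} → Mid M → 2 ≤ ∣ M ∣ × 2 + ∣ M ∣ ≤ n
    mid-size (_ , low , up) with A , A∈ , _ , a< ← find low | B , B∈ , _ , b< ← find up =
      ≤-trans (s≤s (∈𝓕⇒nonempty A∈)) a< , ≤-trans (s≤s b<) (proper B∈)

    -- A mid has a nonempty set below it and a proper one above it, so sizes outside 2, ..., n - 2
    -- carry no mids; for the others `weighing` applies.
    comparison : ∀ k s → s ∈ S → 2 * ∑ (Ω n) (gridR k s) + ∑ (Ω n) (gridR′ k s) ≤ (1 + bonus s) * ∑ (Ω n) (gridμ k s) ×
                 ((1 + bonus s) * ∑ (Ω n) (gridμ k s) ≤ 2 * ∑ (Ω n) (gridR k s) + ∑ (Ω n) (gridR′ k s) → ∑ (Ω n) (gridμ k s) ≡ 0)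
    comparison k s s∈ with 1≤s , s<n ← ∈-inner⁻ s∈ with (2 ≤? s) ×-dec (2 + s ≤? n)
    ... | yes (p₁ , p₂) = weighing {P = s * (n ∸ s)} {n = n} (*-mono-≤ 1≤s (m<n⇒0<n∸m s<n)) (sum-R k s s<n)
        (sum-R′ k s s<n) (3n<s[n-s] n s 18≤n p₁ p₂)
    ... | no ¬p = ≤-trans (≤-reflexive (cong₂ (λ a b → 2 * a + b) (zero-sum (λ σ → rest (grid σ k) s))
        (zero-sum (λ σ → rest (grid σ (side k s)) s)))) z≤n , (λ _ → zero-μ)
      where
      none : ∀ {σ} → σ ∈ Ω n → gridμ k s σ ≡ 0
      none σ∈ = ¬Mid⇒μ (λ mid → ¬p (subst (λ z → 2 ≤ z × 2 + z ≤ n) (size-grid σ∈ k s (<⇒≤ s<n)) (mid-size mid)))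
      zero-sum : ∀ (f : Vec ℕ n → ℕ) → ∑[ σ ∈ Ω n ] (gridμ k s σ * f σ) ≡ 0
      zero-sum f = ∑-zero (Ω n) (λ {σ} σ∈ → cong (_* f σ) (none σ∈))
      zero-μ = ∑-zero (Ω n) none

    -- The mid terms on the two sides of `cycle-bound`, arranged by arc because the comparison holds
    -- for each arc separately once it is summed over the orderings.
    gain cost : Vec ℕ n → ℕ
    gain σ = ∑[ k ∈ K ] ∑[ s ∈ S ] (w₂ * ((1 + bonus s) * gridμ k s σ))
    cost σ = ∑[ k ∈ K ] ∑[ s ∈ S ] (w₂ * (2 * gridR k s σ + gridR′ k s σ))

    ∑-grid : ∀ (f : ℕ → ℕ → Vec ℕ n → ℕ) → ∑[ σ ∈ Ω n ] ∑[ k ∈ K ] ∑[ s ∈ S ] (w₂ * f k s σ) ≡ ∑[ k ∈ K ] ∑[ s ∈ S ]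
        (w₂ * ∑ (Ω n) (f k s))
    ∑-grid f = trans (∑-swap (Ω n) K _) (∑-cong K (λ {k} _ → trans (∑-swap (Ω n) S _)
        (∑-cong S (λ {s} _ → ∑-*ˡ w₂ (Ω n) (f k s)))))

    ∑-cost : ∑ (Ω n) cost ≡ ∑[ k ∈ K ] ∑[ s ∈ S ] (w₂ * (2 * ∑ (Ω n) (gridR k s) + ∑ (Ω n) (gridR′ k s)))
    ∑-cost = trans (∑-grid (λ k s σ → 2 * gridR k s σ + gridR′ k s σ)) (∑-cong K (λ {k} _ → ∑-cong S (λ {s} _ → cong (w₂ *_)
      (trans (∑-+ (Ω n) _ _) (cong (_+ ∑ (Ω n) (gridR′ k s)) (∑-*ˡ 2 (Ω n) (gridR k s)))))))

    ∑-gain : ∑ (Ω n) gain ≡ ∑[ k ∈ K ] ∑[ s ∈ S ] (w₂ * ((1 + bonus s) * ∑ (Ω n) (gridμ k s)))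
    ∑-gain = trans (∑-grid (λ k s σ → (1 + bonus s) * gridμ k s σ)) (∑-cong K
        (λ {k} _ → ∑-cong S (λ {s} _ → cong (w₂ *_) (∑-*ˡ (1 + bonus s) (Ω n) (gridμ k s)))))

    cost≤gain : ∑ (Ω n) cost ≤ ∑ (Ω n) gain
    cost≤gain = subst₂ _≤_ (sym ∑-cost) (sym ∑-gain) (∑-mono K (λ {k} _ → ∑-mono S
        (λ {s} s∈ → *-monoʳ-≤ w₂ (proj₁ (comparison k s s∈)))))

    -- Equality of the totals forces equality for every arc, and there the comparison is strict
    -- unless the arc carries no mid in any ordering.
    no-mids : ∑ (Ω n) gain ≤ ∑ (Ω n) cost → ∀ {σ} → σ ∈ Ω n → ∀ {k s} → k ∈ K → s ∈ S → gridμ k s σ ≡ 0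
    no-mids le {σ} σ∈ {k} {s} k∈ s∈ = n≤0⇒n≡0 (≤-trans (∑-member (Ω n) (gridμ k s) σ∈) (≤-reflexive
      (proj₂ (comparison k s s∈) (*-cancel-≤-pos w₂ w₂>0 (≤-reflexive (sym at-s))))))
      where
      inner≤ : ∀ {k} → k ∈ K → _
      inner≤ {k} k∈ = ∑-mono S (λ {s} s∈ → *-monoʳ-≤ w₂ (proj₁ (comparison k s s∈)))
      at-k = ∑-tight K inner≤ (subst₂ _≤_ ∑-gain ∑-cost le) k∈
      at-s = ∑-tight S (λ {s} s∈ → *-monoʳ-≤ w₂ (proj₁ (comparison k s s∈))) (≤-reflexive (sym at-k)) s∈

    gain≡ : ∀ {σ} (σ∈ : σ ∈ Ω n) → gain σ ≡ w₂ * Cyc.total-mids σ∈ + Cyc.total-far σ∈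
    gain≡ {σ} σ∈ = trans (∑-cong K (λ {k} _ → trans (∑-cong S (λ {s} _ → r w₂ (bonus s) (gridμ k s σ))) (trans (∑-+ S _ _)
        (cong₂ _+_ (∑-*ˡ w₂ S (λ s → gridμ k s σ)) refl)))) (trans (∑-+ K _ _)
            (cong₂ _+_ (∑-*ˡ w₂ K (λ k → ∑[ s ∈ S ] gridμ k s σ)) refl))
      where r : ∀ w a b → w * ((1 + a) * b) ≡ w * b + w * a * b
            r = solve-∀

    cost≡ : ∀ {σ} (σ∈ : σ ∈ Ω n) → cost σ ≡ 2 * w₂ * Cyc.total-extra σ∈ + w₂ * Cyc.neighbour-extra σ∈
    cost≡ {σ} σ∈ = trans (∑-cong K (λ {k} _ → trans (∑-cong S (λ {s} _ → r w₂ (gridR k s σ) (gridR′ k s σ))) (trans (∑-+ S _ _)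
        (cong₂ _+_ (∑-*ˡ (2 * w₂) S _) (∑-*ˡ w₂ S _))))) (trans (∑-+ K _ _) (cong₂ _+_ (∑-*ˡ (2 * w₂) K _) (∑-*ˡ w₂ K _)))
      where r : ∀ w a b → w * (2 * a + b) ≡ 2 * w * a + w * b
            r = solve-∀

    cycle : ∀ {σ} → σ ∈ Ω n → 2 * weightsum σ + 4 * w₂ + gain σ ≤ capacity + cost σ
    cycle {σ} σ∈ = subst₂ (λ a b → 2 * weightsum σ + 4 * w₂ + a ≤ capacity + b) (sym (gain≡ σ∈)) (sym (cost≡ σ∈))
        (Cyc.cycle-bound σ∈)

    ∑-left : ∑[ σ ∈ Ω n ] (2 * weightsum σ + 4 * w₂ + gain σ) ≡ 2 * (n * (n ! * length 𝓕)) + n ! * (4 * w₂) + ∑ (Ω n) gain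
    ∑-left = trans (∑-+ (Ω n) _ gain) (cong (_+ ∑ (Ω n) gain) (trans (∑-+ (Ω n) _ _)
      (cong₂ _+_ (trans (∑-*ˡ 2 (Ω n) weightsum) (cong (2 *_) ∑-weightsum)) (∑-perms-const (rangeⱽ 0 n) (4 * w₂)))))

    ∑-right : ∑[ σ ∈ Ω n ] (capacity + cost σ) ≡ n ! * capacity + ∑ (Ω n) cost
    ∑-right = trans (∑-+ (Ω n) _ cost) (cong (_+ ∑ (Ω n) cost) (∑-perms-const (rangeⱽ 0 n) capacity))

    total : 2 * (n * (n ! * length 𝓕)) + n ! * (4 * w₂) + ∑ (Ω n) gain ≤ n ! * capacity + ∑ (Ω n) cost
    total = subst₂ _≤_ ∑-left ∑-right (∑-mono (Ω n) cycle)

  upper : 2 * (n * length 𝓕) + 4 * w₂ ≤ capacity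
  upper = *-cancel-≤-pos (n !) (!-pos n) (farkas 0 (+-mono-≤ total cost≤gain)
    (r n (n !) (length 𝓕) w₂ capacity (∑ (Ω n) gain) (∑ (Ω n) cost)))
    where r : ∀ n f l w K g c → f * (2 * (n * l) + 4 * w) + (f * K + c + g) + 0 ≡ f * K + (2 * (n * (f * l)) + f * (4 * w) + g + c)
          r = solve-∀

  module Extremal (extremal : 2 * (n * length 𝓕) + 4 * w₂ ≡ capacity) where

    private
      gain≤cost : ∑ (Ω n) gain ≤ ∑ (Ω n) cost
      gain≤cost = +-cancelˡ-≤ (n ! * capacity) _ _ (subst (λ z → z + ∑ (Ω n) gain ≤ n ! * capacity + ∑ (Ω n) cost)
        (trans (r n (n !) (length 𝓕) w₂) (cong (n ! *_) extremal)) total)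
        where r : ∀ n f l w → 2 * (n * (f * l)) + f * (4 * w) ≡ f * (2 * (n * l) + 4 * w)
              r = solve-∀

    μ≡0 : ∀ {σ} → σ ∈ Ω n → ∀ {k s} → k ∈ K → s ∈ S → μ (grid σ k s) ≡ 0
    μ≡0 = no-mids gain≤cost

    private
      cost≡0 : ∀ {σ} → σ ∈ Ω n → cost σ ≡ 0
      cost≡0 {σ} σ∈ = ∑-zero K (λ {k} k∈ → ∑-zero S (λ {s} s∈ → trans (cong
          (λ z → w₂ * (2 * (z * rest (grid σ k) s) + z * rest (grid σ (side k s)) s)) (μ≡0 σ∈ k∈ s∈)) (*-zeroʳ w₂)))

      gain≡0 : ∀ {σ} → σ ∈ Ω n → gain σ ≡ 0
      gain≡0 {σ} σ∈ = ∑-zero K (λ {k} k∈ → ∑-zero S (λ {s} s∈ → trans (cong (λ z → w₂ * ((1 + bonus s) * z))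
          (μ≡0 σ∈ k∈ s∈)) (trans (cong (w₂ *_) (*-zeroʳ (1 + bonus s))) (*-zeroʳ w₂))))

    -- `cycle` holds for every ordering and its sum is an equality, so it is an equality for each of
    -- them; without mids only the loss terms remain, and `Cyc.tight` applies.
    cycle-tight : ∀ {σ} (σ∈ : σ ∈ Ω n) → Cyc.total-lossy σ∈ ≡ 2 × Cyc.bads σ∈ ≡ 0
    cycle-tight {σ} σ∈ = Cyc.tight σ∈ w₂>0 d₁>0
      (∑-zero K (λ {k} k∈ → ∑-zero S (λ {s} s∈ → cong (_* rest (grid σ k) s) (μ≡0 σ∈ k∈ s∈))))
      (≤-reflexive (sym (trans (trans (sym (+-identityʳ _)) (cong (2 * weightsum σ + 4 * w₂ +_) (sym (gain≡0 σ∈))))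
        (trans at-σ (trans (cong (capacity +_) (cost≡0 σ∈)) (+-identityʳ _))))))
      where
      at-σ = ∑-tight (Ω n) cycle (subst₂ _≤_ (sym ∑-right) (sym ∑-left)
        (≤-trans (+-monoʳ-≤ (n ! * capacity) cost≤gain) (≤-reflexive (cong (_+ ∑ (Ω n) gain)
          (trans (cong (n ! *_) (sym extremal)) (r n (n !) (length 𝓕) w₂)))))) σ∈
        where r : ∀ n f l w → f * (2 * (n * l) + 4 * w) ≡ 2 * (n * (f * l)) + f * (4 * w)
              r = solve-∀

-- Even n: the extremal families

∈⇒lookup : ∀ {n} {A : Subset n} {e} → e ∈ˢ A → lookup A e ≡ true
∈⇒lookup = Vecₚ.[]=⇒lookup

lookup⇒∈ : ∀ {n} {A : Subset n} {e} → lookup A e ≡ true → e ∈ˢ A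
lookup⇒∈ {A = A} {e} = Vecₚ.lookup⇒[]= e A

del ins : ∀ {n} → Subset n → Fin n → Subset n
del G y = G [ y ]≔ false
ins G y = G [ y ]≔ true

∈-del⁻ : ∀ {n} {G : Subset n} {y e} → e ∈ˢ del G y → e ∈ˢ G × e ≢ y
∈-del⁻ {G = G} {y} {e} e∈ = lookup⇒∈ (trans (sym (Vecₚ.lookup∘update′ e≢y G false)) (∈⇒lookup e∈)) , e≢y
  where
  e≢y : e ≢ y
  e≢y refl with () ← trans (sym (Vecₚ.lookup∘update e G false)) (∈⇒lookup e∈)

∈-del⁺ : ∀ {n} {G : Subset n} {y e} → e ∈ˢ G → e ≢ y → e ∈ˢ del G y
∈-del⁺ {G = G} e∈ e≢y = lookup⇒∈ (trans (Vecₚ.lookup∘update′ e≢y G false) (∈⇒lookup e∈))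

∈-ins-self : ∀ {n} (G : Subset n) y → y ∈ˢ ins G y
∈-ins-self G y = lookup⇒∈ (Vecₚ.lookup∘update y G true)

⊆-ins : ∀ {n} (G : Subset n) y → G ⊆ ins G y
⊆-ins G y {e} e∈ with e Finₚ.≟ y
... | yes refl = ∈-ins-self G y
... | no e≢y = lookup⇒∈ (trans (Vecₚ.lookup∘update′ e≢y G true) (∈⇒lookup e∈))

∈-ins⁻ : ∀ {n} {G : Subset n} {y e} → e ∈ˢ ins G y → e ∈ˢ G ⊎ e ≡ y
∈-ins⁻ {G = G} {y} {e} e∈ with e Finₚ.≟ y
... | yes e≡y = inj₂ e≡y
... | no e≢y = inj₁ (lookup⇒∈ (trans (sym (Vecₚ.lookup∘update′ e≢y G true)) (∈⇒lookup e∈)))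

∣del∣ : ∀ {n} (G : Subset n) {y} → y ∈ˢ G → suc ∣ del G y ∣ ≡ ∣ G ∣
∣del∣ (true ∷ G)  Vec.here       = refl
∣del∣ (true ∷ G)  (Vec.there y∈) = cong suc (∣del∣ G y∈)
∣del∣ (false ∷ G) (Vec.there y∈) = ∣del∣ G y∈

∣ins∣ : ∀ {n} (G : Subset n) {y} → y ∉ˢ G → ∣ ins G y ∣ ≡ suc ∣ G ∣
∣ins∣ (true ∷ G)  {zero}  y∉ = ⊥-elim (y∉ Vec.here)
∣ins∣ (false ∷ G) {zero}  y∉ = refl
∣ins∣ (true ∷ G)  {suc y} y∉ = cong suc (∣ins∣ G (y∉ ∘ Vec.there))
∣ins∣ (false ∷ G) {suc y} y∉ = ∣ins∣ G (y∉ ∘ Vec.there)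

∣ins∣≤ : ∀ {n} (G : Subset n) y → ∣ ins G y ∣ ≤ suc ∣ G ∣
∣ins∣≤ (true ∷ G)  zero    = n≤1+n _
∣ins∣≤ (false ∷ G) zero    = ≤-refl
∣ins∣≤ (true ∷ G)  (suc y) = s≤s (∣ins∣≤ G y)
∣ins∣≤ (false ∷ G) (suc y) = ∣ins∣≤ G y

same-size-⊆ : ∀ {n} (A B : Subset n) → A ⊆ B → ∣ B ∣ ≤ ∣ A ∣ → A ≡ B
same-size-⊆ []          []          _ _ = refl
same-size-⊆ (true ∷ A)  (true ∷ B)  s l = cong (true ∷_) (same-size-⊆ A B (drop-∷-⊆ s) (≤-pred l))
same-size-⊆ (false ∷ A) (false ∷ B) s l = cong (false ∷_) (same-size-⊆ A B (drop-∷-⊆ s) l)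
same-size-⊆ (false ∷ A) (true ∷ B)  s l = ⊥-elim (<⇒≱ l (p⊆q⇒∣p∣≤∣q∣ (drop-∷-⊆ s)))
same-size-⊆ (true ∷ A)  (false ∷ B) s l with () ← s Vec.here

codim-1 : ∀ {n} (A G : Subset n) → A ⊆ G → ∣ G ∣ ≡ suc ∣ A ∣ → ∃ λ y → y ∈ˢ G × A ≡ del G y
codim-1 (true ∷ A)  (true ∷ G)  s e with y , y∈ , eq ← codim-1 A G (drop-∷-⊆ s) (suc-injective e) = suc y ,
    Vec.there y∈ , cong (true ∷_) eq
codim-1 (false ∷ A) (false ∷ G) s e with y , y∈ , eq ← codim-1 A G (drop-∷-⊆ s) e = suc y , Vec.there y∈ , cong (false ∷_) eq
codim-1 (false ∷ A) (true ∷ G)  s e = zero , Vec.here , cong (false ∷_)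
    (same-size-⊆ A G (drop-∷-⊆ s) (≤-reflexive (suc-injective e)))
codim-1 (true ∷ A)  (false ∷ G) s e with () ← s Vec.here

interpolate : ∀ {n} (C E : Subset n) s → C ⊆ E → ∣ C ∣ ≤ s → s ≤ ∣ E ∣ → ∃ λ B → C ⊆ B × B ⊆ E × ∣ B ∣ ≡ s
interpolate C E s C⊆E c≤s s≤e = go (s ∸ ∣ C ∣) C C⊆E (m∸n+n≡m c≤s)
  where
  go : ∀ d C → C ⊆ E → d + ∣ C ∣ ≡ s → ∃ λ B → C ⊆ B × B ⊆ E × ∣ B ∣ ≡ s
  go zero    C C⊆E e = C , id , C⊆E , e
  go (suc d) C C⊆E e with Finₚ.¬∀⟶∃¬ _ (λ y → y ∈ˢ E → y ∈ˢ C) (λ y → imp (y ∈ˢ? E) (y ∈ˢ? C))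
                            (λ h → <⇒≱ (≤-trans (s≤s (m≤n+m ∣ C ∣ d)) (≤-trans (≤-reflexive e) s≤e)) (p⊆q⇒∣p∣≤∣q∣ (λ {y} → h y)))
    where
    imp : ∀ {P Q : Set} → Dec P → Dec Q → Dec (P → Q)
    imp (yes p) (yes q) = yes (λ _ → q)
    imp (yes p) (no ¬q) = no (λ f → ¬q (f p))
    imp (no ¬p) _       = yes (λ p → ⊥-elim (¬p p))
  ... | y , ¬h with y ∈ˢ? E | y ∈ˢ? C
  ...   | no y∉E | _ = ⊥-elim (¬h (λ y∈ → ⊥-elim (y∉E y∈)))
  ...   | yes _ | yes y∈C = ⊥-elim (¬h (λ _ → y∈C))
  ...   | yes y∈E | no y∉C with B , C⊆B , B⊆E , eq ← go d (ins C y) (λ z∈ → [ C⊆E , (λ { refl → y∈E }) ]′ (∈-ins⁻ z∈))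
                                  (trans (cong (d +_) (∣ins∣ C y∉C)) (trans (+-suc d _) e))
    = B , C⊆B ∘ ⊆-ins C y , B⊆E , eq

position<n : ∀ {n σ} → σ ∈ Ω n → ∀ e → lookup σ e < n
position<n {n} {σ} σ∈ e = <ᵇ⇒< (lookup σ e) n (subst T (sym (∈-map⁻ {J = J} σ all)) _)
  where
  J : ℕ → Bool
  J p = does (p <? n)
  full : ∣ Vec.map J σ ∣ ≡ n
  full = trans (∣map∣ J σ∈) (trans (∑-cong (range 0 n) (λ {p} _ → b2n-does (p <? n))) (∑-𝟙< 0 n n ≤-refl))
  all : e ∈ˢ Vec.map J σ
  all = subst (e ∈ˢ_) (sym (∣p∣≡n⇒p≡⊤ full)) ∈⊤

-- Orderings sorted by rank

below : ∀ {n} → ℕ → Vec ℕ n → Subset n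
below c t = Vec.map (λ κ → does (κ <? c)) t

∣below∣-suc : ∀ {n} c (t : Vec ℕ n) → ∣ below (suc c) t ∣ ≡ ∣ below c t ∣ + occ _≟_ c t
∣below∣-suc c []      = refl
∣below∣-suc c (κ ∷ t) with <-cmp κ c
... | tri< κ<c ne _ rewrite dec-true (κ <? suc c) (m≤n⇒m≤1+n κ<c) | dec-true (κ <? c) κ<c | 𝟙-no (c ≟ κ) (ne ∘ sym) =
    cong suc (∣below∣-suc c t)
... | tri≈ ¬lt refl _ rewrite dec-true (κ <? suc κ) (n<1+n κ) | dec-false (κ <? κ) ¬lt | 𝟙-yes (κ ≟ κ) refl = trans
    (cong suc (∣below∣-suc κ t)) (sym (+-suc _ _))
... | tri> ¬lt ne c<κ rewrite dec-false (κ <? suc c) (<⇒≱ (s≤s c<κ)) | dec-false (κ <? c) ¬lt | 𝟙-no (c ≟ κ)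
    (ne ∘ sym) = ∣below∣-suc c t

∣below∣-zero : ∀ {n} (t : Vec ℕ n) → ∣ below 0 t ∣ ≡ 0
∣below∣-zero []      = refl
∣below∣-zero (κ ∷ t) = ∣below∣-zero t

∈-below⁺ : ∀ {n c} {t : Vec ℕ n} {e} → lookup t e < c → e ∈ˢ below c t
∈-below⁺ {c = c} {t} {e} h = ∈-map t (dec-true (lookup t e <? c) h)

∈-below⁻ : ∀ {n c} {t : Vec ℕ n} {e} → e ∈ˢ below c t → lookup t e < c
∈-below⁻ {c = c} {t} {e} h = <ᵇ⇒< (lookup t e) c (subst T (sym (∈-map⁻ {J = λ κ → does (κ <? c)} t h)) _)

∣below∣-mono : ∀ {n c d} (t : Vec ℕ n) → c ≤ d → ∣ below c t ∣ ≤ ∣ below d t ∣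
∣below∣-mono {c = c} {d} t c≤d = p⊆q⇒∣p∣≤∣q∣ {p = below c t} {q = below d t} (λ e∈ → ∈-below⁺ (≤-trans (∈-below⁻ {t = t} e∈) c≤d))

occ-map-rangeⱽ : ∀ a n (col : ℕ → ℕ) κ → occ _≟_ κ (Vec.map col (rangeⱽ a n)) ≡ ∑[ p ∈ range a n ] 𝟙 (κ ≟ col p)
occ-map-rangeⱽ a zero    col κ = refl
occ-map-rangeⱽ a (suc n) col κ = cong (𝟙 (κ ≟ col a) +_) (occ-map-rangeⱽ (suc a) n col κ)

-- Every ranking of the elements is realised by an ordering sorted by rank.
module Ranking {n : ℕ} (t : Vec ℕ n) (r : ℕ) (t≤r : ∀ e → lookup t e ≤ r) where

  private
    T′ : ℕ → ℕ
    T′ c = ∣ below c t ∣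

    T>r : ∀ {c} → r < c → T′ c ≡ n
    T>r {c} r<c = ≤-antisym (∣p∣≤n (below c t)) (≤-trans (≤-reflexive (sym (∣⊤∣≡n n)))
        (p⊆q⇒∣p∣≤∣q∣ {p = ⊤} {q = below c t} (λ {e} _ → ∈-below⁺ (≤-<-trans (t≤r e) r<c))))

    -- The rank found at position `p` after sorting: the elements of rank at least c start at
    -- position `T′ c`, so it is the number of thresholds c ≥ 1 already reached.
    col : ℕ → ℕ
    col p = ∑[ c ∈ range 1 r ] 𝟙 (T′ c ≤? p)

    ones : ∀ a l (f : ℕ → ℕ) → (∀ c → f c ≤ 1) → ∑ (range a l) f ≤ l
    ones a zero    f h = z≤n
    ones a (suc l) f h = +-mono-≤ (h a) (ones (suc a) l f h)

    ones≥ : ∀ a l (f : ℕ → ℕ) → (∀ c → c < a + l → f c ≡ 1) → l ≤ ∑ (range a l) f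
    ones≥ a zero    f h = z≤n
    ones≥ a (suc l) f h = +-mono-≤ (≤-reflexive (sym (h a (m<m+n a (s≤s z≤n)))))
        (ones≥ (suc a) l f (λ c c< → h c (subst (c <_) (sym (+-suc a l)) c<)))

    split : ∀ c f → c ≤ r → ∑ (range 1 r) f ≡ ∑ (range 1 c) f + ∑ (range (suc c) (r ∸ c)) f
    split c f c≤r = trans (cong (λ z → ∑ (range 1 z) f) (sym (m+[n∸m]≡n c≤r))) (∑-range-++ 1 c (r ∸ c) f)

    col⇐ : ∀ c p → p < n → p < T′ c → col p < c
    col⇐ zero    p _ p< = ⊥-elim (<⇒≱ p< (≤-trans (≤-reflexive (∣below∣-zero t)) z≤n))
    col⇐ (suc c) p _ p< with suc c ≤? r
    ... | no c≰r = s≤s (≤-trans (ones 1 r _ (λ c → 𝟙≤1 (T′ c ≤? p))) (≤-pred (≰⇒> c≰r)))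
    ... | yes c<r = s≤s (≤-trans (≤-reflexive (trans (split c _ (<⇒≤ c<r)) (trans (cong (∑ (range 1 c) _ +_)
            (∑-zero (range (suc c) (r ∸ c)) (λ {d} d∈ → 𝟙-no (T′ d ≤? p)
                (<⇒≱ (≤-trans p< (∣below∣-mono t (proj₁ (∈-range⁻ (suc c) _ d∈))))))))
            (+-identityʳ _)))) (ones 1 c _ (λ c → 𝟙≤1 (T′ c ≤? p))))

    col⇒ : ∀ c p → p < n → col p < c → p < T′ c
    col⇒ c p p<n col< with p <? T′ c | c ≤? r
    ... | yes q | _ = q
    ... | no _  | no c≰r = subst (p <_) (sym (T>r (≰⇒> c≰r))) p<n
    ... | no p≮ | yes c≤r = ⊥-elim (<⇒≱ col< (≤-trans (ones≥ 1 c _ (λ d d< → 𝟙-yes (T′ d ≤? p)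
        (≤-trans (∣below∣-mono t (≤-pred d<)) (≮⇒≥ p≮))))
            (≤-trans (m≤m+n _ _) (≤-reflexive (sym (split c _ c≤r))))))

    -- Cumulative counts are compared: a position lies before `T′ (suc κ)` exactly if it lies before
    -- `T′ κ` or carries rank `κ`.
    occ-eq : ∀ κ → occ _≟_ κ (Vec.map col (rangeⱽ 0 n)) ≡ occ _≟_ κ t
    occ-eq κ = +-cancelˡ-≡ (T′ κ) _ _ (begin
      T′ κ + occ _≟_ κ (Vec.map col (rangeⱽ 0 n))
        ≡⟨ cong₂ _+_ (sym (∑-𝟙< 0 n (T′ κ) (∣p∣≤n (below κ t)))) (occ-map-rangeⱽ 0 n col κ) ⟩
      ∑[ p ∈ range 0 n ] 𝟙 (p <? T′ κ) + ∑[ p ∈ range 0 n ] 𝟙 (κ ≟ col p)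
        ≡⟨ ∑-+ (range 0 n) _ _ ⟨
      ∑[ p ∈ range 0 n ] (𝟙 (p <? T′ κ) + 𝟙 (κ ≟ col p))
        ≡⟨ ∑-cong (range 0 n) (λ {p} p∈ → each p (proj₂ (∈-range⁻ 0 n p∈))) ⟩
      ∑[ p ∈ range 0 n ] 𝟙 (p <? T′ (suc κ))
        ≡⟨ ∑-𝟙< 0 n (T′ (suc κ)) (∣p∣≤n (below (suc κ) t)) ⟩
      T′ (suc κ)           ≡⟨ ∣below∣-suc κ t ⟩
      T′ κ + occ _≟_ κ t   ∎)
      where
      open ≡-Reasoning
      each : ∀ p → p < n → 𝟙 (p <? T′ κ) + 𝟙 (κ ≟ col p) ≡ 𝟙 (p <? T′ (suc κ))
      each p p<n with <-cmp (col p) κ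
      ... | tri< lt ne _ = trans (cong₂ _+_ (𝟙-yes (p <? T′ κ) (col⇒ κ p p<n lt)) (𝟙-no (κ ≟ col p) (ne ∘ sym)))
                                 (sym (𝟙-yes (p <? T′ (suc κ)) (col⇒ (suc κ) p p<n (m≤n⇒m≤1+n lt))))
      ... | tri≈ ¬lt e _ = trans (cong₂ _+_ (𝟙-no (p <? T′ κ) (¬lt ∘ col⇐ κ p p<n)) (𝟙-yes (κ ≟ col p) (sym e)))
                                 (sym (𝟙-yes (p <? T′ (suc κ)) (col⇒ (suc κ) p p<n (s≤s (≤-reflexive e)))))
      ... | tri> ¬lt ne gt = trans (cong₂ _+_ (𝟙-no (p <? T′ κ) (¬lt ∘ col⇐ κ p p<n)) (𝟙-no (κ ≟ col p) (ne ∘ sym)))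
                                 (sym (𝟙-no (p <? T′ (suc κ)) (λ q → <⇒≱ gt (≤-pred (col⇐ (suc κ) p p<n q)))))

    realised = ∃-colour _≟_ col (rangeⱽ 0 n) t occ-eq

  opaque

    sorted : Vec ℕ n
    sorted = proj₁ realised

    sorted∈ : sorted ∈ Ω n
    sorted∈ = proj₁ (proj₂ realised)

    private
      t≡ : ∀ e → lookup t e ≡ col (lookup sorted e)
      t≡ e = trans (cong (λ v → lookup v e) (proj₂ (proj₂ realised))) (Vecₚ.lookup-map e col sorted)

  private
    pos : ∀ e → lookup sorted e < n
    pos = position<n sorted∈

    <⇒ : ∀ {e c} → lookup t e < c → lookup sorted e < T′ c
    <⇒ {e} {c} h = col⇒ c _ (pos e) (subst (_< c) (t≡ e) h)

    ⇒< : ∀ {e c} → lookup sorted e < T′ c → lookup t e < c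
    ⇒< {e} {c} h = subst (_< c) (sym (t≡ e)) (col⇐ c _ (pos e) h)

  -- The elements of rank below `c` come first, so `S` starts at position `∣ below c t ∣`; an arc
  -- with offset a starts at -a, hence the subtraction from `n`.
  interval : .{{_ : NonZero n}} → ∀ c d (S : Subset n) → c ≤ d →
             (∀ {e} → e ∈ˢ S → c ≤ lookup t e × lookup t e < d) → (∀ {e} → c ≤ lookup t e → lookup t e < d → e ∈ˢ S) →
             Vec.map (arc n (n ∸ ∣ below c t ∣) ∣ S ∣) sorted ≡ S
  interval c d S c≤d S⇒ ⇒S = trans (cong (λ s → Vec.map (arc n a s) sorted) size-S) whole
    where
    i = T′ c
    l = T′ d ∸ T′ c
    a = n ∸ i
    i≤n : i ≤ n
    i≤n = ∣p∣≤n (below c t)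
    i+l : i + l ≡ T′ d
    i+l = m+[n∸m]≡n (∣below∣-mono t c≤d)
    l≤ : l ≤ n ∸ i
    l≤ = ∸-monoˡ-≤ i (∣p∣≤n (below d t))
    wrapped : ∀ p → p < n → i ≤ p → (p + a) % n ≡ p ∸ i
    wrapped p p<n i≤p = trans (cong (_% n) (trans (cong (_+ a) (sym (m∸n+n≡m i≤p)))
        (trans (+-assoc (p ∸ i) i a) (cong (p ∸ i +_) (m+[n∸m]≡n i≤n)))))
      (trans ([m+n]%n≡m%n (p ∸ i) n) (m<n⇒m%n≡m (≤-<-trans (m∸n≤m p i) p<n)))
    unwrapped : ∀ p → p < i → (p + a) % n ≡ p + a
    unwrapped p p<i = m<n⇒m%n≡m (subst (p + a <_) (m+[n∸m]≡n i≤n) (+-monoˡ-< a p<i))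
    to : Vec.map (arc n a l) sorted ⊆ S
    to {e} e∈ with p<l ← arc⁻ {n} {a = a} {p = lookup sorted e} (∈-map⁻ sorted e∈) with lookup sorted e <? i
    ... | yes p<i = ⊥-elim (<⇒≱ (subst (_< l) (unwrapped (lookup sorted e) p<i) p<l) (≤-trans l≤ (m≤n+m a (lookup sorted e))))
    ... | no p≮i = ⇒S (≮⇒≥ (λ q → p≮i (<⇒ q)))
          (⇒< (subst₂ _<_ (m+[n∸m]≡n (≮⇒≥ p≮i)) i+l (+-monoʳ-< i (subst (_< l) (wrapped _ (pos e) (≮⇒≥ p≮i)) p<l))))
    from : S ⊆ Vec.map (arc n a l) sorted
    from {e} e∈ with c≤ , <d ← S⇒ e∈ = ∈-map sorted (arc⁺ {a = a} {p = lookup sorted e}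
        (subst (_< l) (sym (wrapped _ (pos e) i≤p))
      (+-cancelˡ-< i _ _ (subst₂ _<_ (sym (m+[n∸m]≡n i≤p)) (sym i+l) (<⇒ <d)))))
      where i≤p = ≮⇒≥ (λ q → <⇒≱ (⇒< q) c≤)
    whole : Vec.map (arc n a l) sorted ≡ S
    whole = ⊆-antisym to from
    size-S : ∣ S ∣ ≡ l
    size-S = trans (cong ∣_∣ (sym whole)) (trans (∣map∣ (arc n a l) sorted∈) (size-arc a l (≤-trans l≤ (m∸n≤m n i))))

∣∣>0⇒member : ∀ {l} (B : Subset l) → 1 ≤ ∣ B ∣ → ∃ λ e → e ∈ˢ B
∣∣>0⇒member (true ∷ B)  _ = zero , Vec.here
∣∣>0⇒member (false ∷ B) h with e , e∈ ← ∣∣>0⇒member B h = suc e , Vec.there e∈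

-- Equality for even n: recovering the family

module EvenStructure {n : ℕ} .{{nz : NonZero n}} (q : ℕ) (n≡ : n ≡ (2 + q) + (2 + q)) (7≤q : 7 ≤ q)
            (𝓕 : List (Subset n)) (unique : Unique 𝓕)
            (intersecting : Intersecting 𝓕) (free : ButterflyFree 𝓕) (proper : ∀ {B} → B ∈ 𝓕 → ∣ B ∣ < n)
            (extremal : 2 * (n * length 𝓕) + 4 * EvenLevels.w₂ n q n≡ 7≤q ≡ EvenLevels.capacity n q n≡ 7≤q) where

  open Even q n≡ 7≤q 𝓕 unique intersecting free proper
  open Extremal extremal

  private
    m<n : m < n
    m<n = ≤-trans (m≤n+m (suc m) 2) 3+m≤n

    grid∈ : ∀ (A : Subset n) k → ∃ λ σ → σ ∈ Ω n × A ≡ grid σ k ∣ A ∣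
    grid∈ A k = ∃-Ω-set (J k ∣ A ∣) A (sym (size-J k ∣ A ∣ (∣p∣≤n A)))

  -- Every set is the arc of its size on chain 0 of some ordering, and in the case of equality no
  -- such arc is a mid.
  no-mid : ∀ {M} → ¬ Mid M
  no-mid {M} mid with σ , σ∈ , eq ← grid∈ M 0 =
    <⇒≱ (≤-reflexive (sym (Mid⇒μ mid))) (≤-reflexive (trans (cong μ eq) (μ≡0 σ∈ (∈-range⁺ 0 n z≤n 1≤n)
      (∈-inner⁺ (∈𝓕⇒nonempty (proj₁ mid)) (proper (proj₁ mid))))))

  between : ∀ {A M B} → A ∈ 𝓕 → M ∈ 𝓕 → B ∈ 𝓕 → A ⊆ M → M ⊆ B → ∣ A ∣ < ∣ M ∣ → ∣ M ∣ < ∣ B ∣ → ⊥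
  between A∈ M∈ B∈ A⊆M M⊆B a< b< = no-mid (M∈ , lose A∈ (A⊆M , a<) , lose B∈ (M⊆B , b<))

  module _ {σ : Vec ℕ n} (σ∈ : σ ∈ Ω n) where

    private module σ = Cyc σ∈

    good : ∀ {k} → k < m → ¬ σ.Bad k
    good {k} k<m bad = <⇒≱ (≤-trans (≤-reflexive (sym (𝟙-yes (σ.Bad? k) bad)))
        (∑-member (range 0 m) (λ k → 𝟙 (σ.Bad? k)) (∈-range⁺ 0 m z≤n k<m)))
      (≤-reflexive (proj₂ (cycle-tight σ∈)))

    either : ∀ k {s t} → x (grid σ k s) + x (grid σ (k + m) t) ≢ 0 → grid σ k s ∈ 𝓕 ⊎ grid σ (k + m) t ∈ 𝓕
    either k {s} {t} ne with grid σ k s ∈𝓕? | grid σ (k + m) t ∈𝓕?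
    ... | yes a | _ = inj₁ a
    ... | no _ | yes b = inj₂ b
    ... | no a | no b = ⊥-elim (ne (cong₂ _+_ (∉⇒x a) (∉⇒x b)))

    centre : ∀ {k} → k < m → grid σ k m ∈ 𝓕 ⊎ grid σ (k + m) m ∈ 𝓕
    centre {k} k<m = either k {m} {m} (good k<m ∘ inj₁)

    above-centre : ∀ {k} → k < m → grid σ k (suc m) ∈ 𝓕 ⊎ grid σ (k + m) (suc q) ∈ 𝓕
    above-centre {k} k<m = either k {suc m} {suc q} (good k<m ∘ inj₂ ∘ inj₁)

    opposite-∉ : ∀ k {s t} → s + t ≤ n → grid σ k s ∈ 𝓕 → grid σ (k + m) t ∈ 𝓕 → ⊥
    opposite-∉ k {s} {t} le s∈ t∈ = disjoint-∉ s∈ (λ {e} p r → J-opposite k {s} {t} le (lookup σ e) (∈-map⁻ σ p) (∈-map⁻ σ r)) t∈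

    not-high : ∀ {s} → 3 + m ≤ s → s < n → grid σ 0 s ∈ 𝓕 → ⊥
    not-high {s} h s<n s∈ = good {0} (s≤s z≤n) (inj₂ (inj₂ (inj₂ (≤-trans
      (≤-trans (≤-reflexive (sym (cong₂ _∸_ (∈⇒x s∈) (¬Mid⇒μ no-mid))))
        (∑-member (range (3 + m) (n ∸ (3 + m))) (λ s → x (grid σ 0 s) ∸ μ (grid σ 0 s))
            (∈-range⁺ (3 + m) _ h (subst (s <_) (sym (m+[n∸m]≡n 3+m≤n)) s<n))))
      (m≤m+n _ _)))))

  -- Placed on chain 0, a larger member would, not being a mid, make the pair of chains 0 and m bad.
  size≤ : ∀ {A} → A ∈ 𝓕 → ∣ A ∣ ≤ 2 + m
  size≤ {A} A∈ with 3 + m ≤? ∣ A ∣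
  ... | no h = ≤-pred (≰⇒> h)
  ... | yes h with σ , σ∈ , eq ← grid∈ A 0 = ⊥-elim (not-high σ∈ h (proper A∈) (subst (_∈ 𝓕) eq A∈))

  -- Place the small member on chain 0. The opposite arcs of sizes m and m - 1 are disjoint from it
  -- and cannot be members, so the arcs of sizes m and m + 1 on chain 0 are; the former is then a
  -- mid.
  size≥ : ∀ {A} → A ∈ 𝓕 → m ≤ ∣ A ∣
  size≥ {A} A∈ with m ≤? ∣ A ∣
  ... | yes h = h
  ... | no h with σ , σ∈ , eq ← grid∈ A 0 = ⊥-elim (go (centre σ∈ {0} (s≤s z≤n)) (above-centre σ∈ {0} (s≤s z≤n)))
    where
    s = ∣ A ∣
    s<m : s < m
    s<m = ≰⇒> h
    s+m≤n : s + m ≤ n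
    s+m≤n = subst (s + m ≤_) (sym n≡) (+-monoˡ-≤ m (<⇒≤ s<m))
    D∈ : grid σ 0 s ∈ 𝓕
    D∈ = subst (_∈ 𝓕) eq A∈
    go : grid σ 0 m ∈ 𝓕 ⊎ grid σ m m ∈ 𝓕 → grid σ 0 (suc m) ∈ 𝓕 ⊎ grid σ m (suc q) ∈ 𝓕 → ⊥
    go (inj₂ b) _ = opposite-∉ σ∈ 0 {s} {m} s+m≤n D∈ b
    go _ (inj₂ b) = opposite-∉ σ∈ 0 {s} {suc q} (≤-trans (+-monoʳ-≤ s (n≤1+n (suc q))) s+m≤n) D∈ b
    go (inj₁ a) (inj₁ b) = between D∈ a b (map-⊆ σ (J-nest 0 (<⇒≤ s<m))) (map-⊆ σ (J-nest 0 (n≤1+n m)))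
      (subst₂ _<_ (sym (size-grid σ∈ 0 s (<⇒≤ (<-trans s<m m<n)))) (sym (size-grid σ∈ 0 m (<⇒≤ m<n))) s<m)
      (subst₂ _<_ (sym (size-grid σ∈ 0 m (<⇒≤ m<n))) (sym (size-grid σ∈ 0 (suc m) m<n)) (n<1+n m))

  not-small : ∀ {σ} → σ ∈ Ω n → ∀ k {s} → s < m → ¬ (grid σ k s ∈ 𝓕)
  not-small σ∈ k {s} s<m s∈ = <⇒≱ s<m (subst (m ≤_) (size-grid σ∈ k s (<⇒≤ (<-trans s<m m<n))) (size≥ s∈))

  as-grid : ∀ {A s} → ∣ A ∣ ≡ s → ∃ λ σ → σ ∈ Ω n × A ≡ grid σ 0 s
  as-grid {A} refl = grid∈ A 0

  middle-full : ∀ {G} → ∣ G ∣ ≡ suc m → G ∈ 𝓕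
  middle-full {G} eq = go (as-grid eq)
    where
    go : (∃ λ σ → σ ∈ Ω n × G ≡ grid σ 0 (suc m)) → G ∈ 𝓕
    go (σ , σ∈ , refl) = [ id , (λ b → ⊥-elim (not-small σ∈ m {suc q} (n<1+n (suc q)) b)) ]′ (above-centre σ∈ {0} (s≤s z≤n))

  centre-or-disjoint : ∀ {A} → ∣ A ∣ ≡ m → A ∈ 𝓕 ⊎ ∃ λ A′ → A′ ∈ 𝓕 × ∣ A′ ∣ ≡ m × (∀ {e} → e ∈ˢ A → e ∈ˢ A′ → ⊥)
  centre-or-disjoint {A} eq = go (as-grid eq)
    where
    go : (∃ λ σ → σ ∈ Ω n × A ≡ grid σ 0 m) → A ∈ 𝓕 ⊎ ∃ λ A′ → A′ ∈ 𝓕 × ∣ A′ ∣ ≡ m × (∀ {e} → e ∈ˢ A → e ∈ˢ A′ → ⊥)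
    go (σ , σ∈ , refl) = [ inj₁ , (λ b → inj₂ (grid σ m m , b , size-grid σ∈ m m (<⇒≤ m<n) , λ {e} p r →
          J-opposite 0 {m} {m} (≤-reflexive (sym n≡)) (lookup σ e) (∈-map⁻ σ p) (∈-map⁻ σ r))) ]′ (centre σ∈ {0} (s≤s z≤n))

  offset-m : offset m ≡ m
  offset-m = trans (cong (λ z → ⌈ z /2⌉) (sym (+-identityʳ (m + m)))) (trans (⌈/2⌉-+ m 0) (+-identityʳ m))

  offset-2+m : offset (2 + m) ≡ suc m
  offset-2+m = cong suc offset-m

  -- Two consecutive arcs of length m, the first in 𝓕 and the second not: this forces exactly two lossy chains
  -- and hence determines the members of all the other chains.
  module Consecutive {σ : Vec ℕ n} (σ∈ : σ ∈ Ω n) (A₀ : grid σ 0 m ∈ 𝓕) (A₁ : ¬ (grid σ 1 m ∈ 𝓕)) where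

    private
      module R = Cyc {σ} σ∈

      1<m : 1 < m
      1<m = s≤s (s≤s z≤n)

      unhit : ∀ j → ¬ 1 ≤ mids (grid σ j)
      unhit j h with s , s∈ , ms ← ∑-find (range 1 (n ∸ 1)) (μ ∘ grid σ j) h = no-mid (μ⇒Mid ms)

      two-members : ∀ {j s t} → 1 ≤ s → s < t → t < n → grid σ j s ∈ 𝓕 → grid σ j t ∈ 𝓕 → 2 ≤ count (grid σ j)
      two-members {j} {s} {t} 1≤s s<t t<n s∈ t∈ = ≤-trans (≤-reflexive (sym two)) (∑-mono (range 1 (n ∸ 1)) (λ {u} _ → each u))
        where
        u₁ u₂ : ℕ → ℕ
        u₁ u = 𝟙 (s ≟ u) * 1
        u₂ u = 𝟙 (t ≟ u) * 1
        two : ∑[ u ∈ range 1 (n ∸ 1) ] (u₁ u + u₂ u) ≡ 2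
        two = trans (∑-+ (range 1 (n ∸ 1)) u₁ u₂) (cong₂ _+_ (∑-𝟙≟ 1 (n ∸ 1) s (λ _ → 1) 1≤s (<⇒<-pred n (<-trans s<t t<n)))
          (∑-𝟙≟ 1 (n ∸ 1) t (λ _ → 1) (≤-trans 1≤s (<⇒≤ s<t)) (<⇒<-pred n t<n)))
        each : ∀ u → u₁ u + u₂ u ≤ x (grid σ j u)
        each u with s ≟ u | t ≟ u
        ... | yes refl | yes refl = ⊥-elim (<-irrefl refl s<t)
        ... | yes refl | no _ = ≤-reflexive (sym (∈⇒x s∈))
        ... | no _ | yes refl = ≤-reflexive (sym (∈⇒x t∈))
        ... | no _ | no _ = z≤n

      full-m+1 : ∀ j → grid σ j (suc m) ∈ 𝓕
      full-m+1 j = middle-full (size-grid σ∈ j (suc m) m<n)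

      1+m<n : suc m < n
      1+m<n = ≤-trans (n≤1+n _) 3+m≤n

      lossless : ∀ {j} → grid σ j m ∈ 𝓕 → ¬ Lossy (grid σ j)
      lossless {j} m∈ (inj₁ q) = <⇒≱ (two-members {j} {m} {suc m} (s≤s z≤n) (n<1+n m) 1+m<n m∈ (full-m+1 j)) q
      lossless {j} m∈ (inj₂ h) = unhit j h

      full : ∀ {j} → grid σ j m ∈ 𝓕 → R.Full j
      full {j} m∈ = ≤-reflexive (sym (∈⇒x m∈)) , ≤-reflexive (sym (∈⇒x (full-m+1 j)))

      ¬low : ∀ {j} → ¬ R.Low j
      ¬low {j} low = let s , _ , s≤ , s∈ = R.low⁻ {j} low in not-small σ∈ j {s} (s≤s s≤) s∈

      Aₘ : ¬ (grid σ m m ∈ 𝓕)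
      Aₘ = opposite-∉ σ∈ 0 {m} {m} (≤-reflexive (sym n≡)) A₀

      Aₘ₊₁ : grid σ (suc m) m ∈ 𝓕
      Aₘ₊₁ = [ ⊥-elim ∘ A₁ , id ]′ (centre σ∈ {1} 1<m)

      -- Otherwise `full-step` would carry the state of chain 0 over to chain 1, whose m-arc is not
      -- a member.
      lossy₁ : Lossy (grid σ 1)
      lossy₁ = decidable-stable (Lossy? (grid σ 1)) λ ¬l →
        [ ¬low {1} , (λ (f , _) → A₁ (x⇒∈ f)) ]′ (R.full-step {0} (lossless {0} A₀) (full {0} A₀) ¬l)

      -- On the complements, the m-arc of chain m is not a member while that of chain m + 1 is, so
      -- `upper-step` from m to m + 1 is impossible.
      lossyₘ : Lossy (grid σ m)
      lossyₘ = decidable-stable (Lossy? (grid σ m)) λ ¬l →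
        [ ¬low {suc m} , (λ (f , _) → <⇒≱ (≤-reflexive (sym (∈⇒x Aₘ₊₁))) (≤-reflexive f)) ]′
        (R.upper-step {m} ¬l (¬low {m}) (∉⇒x Aₘ , ≤-reflexive (sym (∈⇒x (full-m+1 m)))) (lossless {suc m} Aₘ₊₁))

      only-two : ∀ {j} → j < n → j ≢ 1 → j ≢ m → ¬ Lossy (grid σ j)
      only-two {j} j<n ≢1 ≢m l = <⇒≱ (≤-reflexive (sym (ℓ-yes l))) (≤-reflexive
          (trans (sym (∑-tight (range 0 n) (λ {i} _ → each i)
          (≤-reflexive (trans (proj₁ (cycle-tight σ∈)) (sym two))) (∈-range⁺ 0 n z≤n j<n)))
          (cong₂ (λ a b → a * 1 + b * 1) (𝟙-no (1 ≟ j) (≢1 ∘ sym)) (𝟙-no (m ≟ j) (≢m ∘ sym)))))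
        where
        u₁ u₂ : ℕ → ℕ
        u₁ u = 𝟙 (1 ≟ u) * 1
        u₂ u = 𝟙 (m ≟ u) * 1
        two : ∑[ u ∈ range 0 n ] (u₁ u + u₂ u) ≡ 2
        two = trans (∑-+ (range 0 n) u₁ u₂) (cong₂ _+_ (∑-𝟙≟ 0 n 1 (λ _ → 1) z≤n (<-trans 1<m m<n))
            (∑-𝟙≟ 0 n m (λ _ → 1) z≤n m<n))
        each : ∀ u → u₁ u + u₂ u ≤ R.lossy u
        each u with 1 ≟ u | m ≟ u
        ... | yes refl | yes ()
        ... | yes refl | no _ = ≤-reflexive (sym (ℓ-yes lossy₁))
        ... | no _ | yes refl = ≤-reflexive (sym (ℓ-yes lossyₘ))
        ... | no _ | no _ = z≤n

      -- The lossy chains are 1 and m, so none of the chains m + 1, ..., 2 m - 1 is lossy and `Full`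
      -- is passed along them.
      run : ∀ i → suc i < m → grid σ (suc i + m) m ∈ 𝓕
      run zero    _ = Aₘ₊₁
      run (suc i) i< = [ ⊥-elim ∘ ¬low {suc (suc i) + m} , x⇒∈ ∘ proj₁ ]′
          (R.full-step {suc i + m} (lossless {suc i + m} prev) (full {suc i + m} prev)
          (only-two {suc (suc i) + m} (subst (suc (suc i) + m <_) (sym n≡) (+-monoˡ-< m i<)) (λ ())
              (λ e → <⇒≱ (s≤s (m≤n+m m (suc i))) (≤-reflexive e))))
        where
        prev : grid σ (suc i + m) m ∈ 𝓕
        prev = run i (<⇒≤ i<)

    -- Chain `k` has two members, of sizes between m and m + 2. Its m-arc is excluded by the
    -- opposite member supplied by `run`, which leaves m + 1 and m + 2.
    far-arc : ∀ {k} → 2 ≤ k → k < m → grid σ k (2 + m) ∈ 𝓕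
    far-arc {suc zero}    (s≤s ()) _
    far-arc {suc (suc j)} 2≤k k<m = go (R.members {k} (only-two (<-trans k<m m<n) (λ ()) (<⇒≢ k<m)))
      where
      k = suc (suc j)
      go : (∃₂ λ s t → 1 ≤ s × s < t × t < n × grid σ k s ∈ 𝓕 × grid σ k t ∈ 𝓕) → grid σ k (2 + m) ∈ 𝓕
      go (s , t , 1≤s , s<t , t<n , s∈ , t∈) = subst (λ z → grid σ k z ∈ 𝓕) (≤-antisym t≤ (≤-trans (s≤s s≥) s<t)) t∈
        where
        t≤ : t ≤ 2 + m
        t≤ = subst (_≤ 2 + m) (size-grid σ∈ k t (<⇒≤ t<n)) (size≤ t∈)
        s≢m : s ≢ m
        s≢m e = opposite-∉ σ∈ k {s} {m} (≤-reflexive (trans (cong (_+ m) e) (sym n≡))) s∈ (run (suc j) k<m)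
        s≥ : suc m ≤ s
        s≥ = ≤∧≢⇒< (subst (m ≤_) (size-grid σ∈ k s (<⇒≤ (<-trans s<t t<n))) (size≥ s∈)) (s≢m ∘ sym)

  -- One ordering of the elements in which the two sets of the pivot are consecutive arcs of length m and B is an arc.
  module Pivot {G : Subset n} {x′ y : Fin n} (∣G∣ : ∣ G ∣ ≡ suc m) (x∈G : x′ ∈ˢ G) (y∈G : y ∈ˢ G) (x≢y : x′ ≢ y)
               (A∈ : del G y ∈ 𝓕) (A′∉ : ¬ (del G x′ ∈ 𝓕)) {B : Subset n} (∣B∣ : ∣ B ∣ ≡ 2 + m) (y∈B : y ∈ˢ B)
                   (x∉B : x′ ∉ˢ B) where

    private
      -- Chosen so that all three sets are intervals of ranks: `del G y` has ranks 3 to 5,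
      -- `del G x′` ranks 2 to 4 and `B` ranks 1 to 3.
      data Rank (e : Fin n) : ℕ → Set where
        r₅ : e ≡ x′ → Rank e 5
        r₄ : e ≢ x′ → e ≢ y → e ∈ˢ G → e ∉ˢ B → Rank e 4
        r₃ : e ≢ x′ → e ≢ y → e ∈ˢ G → e ∈ˢ B → Rank e 3
        r₂ : e ≡ y → Rank e 2
        r₁ : e ∉ˢ G → e ∈ˢ B → Rank e 1
        r₀ : e ∉ˢ G → e ∉ˢ B → Rank e 0

      rank : ∀ e → ∃ (Rank e)
      rank e with e Finₚ.≟ x′ | e Finₚ.≟ y | e ∈ˢ? G | e ∈ˢ? B
      ... | yes p | _ | _ | _ = 5 , r₅ p
      ... | no _ | yes p | _ | _ = 2 , r₂ p
      ... | no a | no b | yes c | yes d = 3 , r₃ a b c d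
      ... | no a | no b | yes c | no d = 4 , r₄ a b c d
      ... | no a | no b | no c | yes d = 1 , r₁ c d
      ... | no a | no b | no c | no d = 0 , r₀ c d

      t : Vec ℕ n
      t = tabulate (proj₁ ∘ rank)

      ranked : ∀ e → Rank e (lookup t e)
      ranked e = subst (Rank e) (sym (Vecₚ.lookup∘tabulate (proj₁ ∘ rank) e)) (proj₂ (rank e))

      bounded : ∀ {e r} → Rank e r → r ≤ 5
      bounded (r₅ _)       = ≤-refl
      bounded (r₄ _ _ _ _) = m≤m+n 4 1
      bounded (r₃ _ _ _ _) = m≤m+n 3 2
      bounded (r₂ _)       = m≤m+n 2 3
      bounded (r₁ _ _)     = m≤m+n 1 4
      bounded (r₀ _ _)     = z≤n

      open Ranking t 5 (bounded ∘ ranked)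

      σ : Vec ℕ n
      σ = sorted

      Between : ℕ → ℕ → ℕ → Set
      Between c d r = c ≤ r × r < d

      A⇒ : ∀ {e r} → Rank e r → e ∈ˢ del G y → Between 3 6 r
      A⇒ {e} rk e∈ with ∈-del⁻ {G = G} {y} e∈
      ... | e∈G , e≢y = go rk
        where
        go : ∀ {r} → Rank e r → Between 3 6 r
        go (r₅ _)       = m≤m+n 3 2 , ≤-refl
        go (r₄ _ _ _ _) = m≤m+n 3 1 , m≤m+n 5 1
        go (r₃ _ _ _ _) = ≤-refl , m≤m+n 4 2
        go (r₂ e≡)      = ⊥-elim (e≢y e≡)
        go (r₁ o _)     = ⊥-elim (o e∈G)
        go (r₀ o _)     = ⊥-elim (o e∈G)

      ⇒A : ∀ {e r} → Rank e r → 3 ≤ r → e ∈ˢ del G y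
      ⇒A (r₅ refl)     _ = ∈-del⁺ x∈G x≢y
      ⇒A (r₄ _ ne i _)  _ = ∈-del⁺ i ne
      ⇒A (r₃ _ ne i _)  _ = ∈-del⁺ i ne
      ⇒A (r₂ _) (s≤s (s≤s ()))
      ⇒A (r₁ _ _) (s≤s ())

      A′⇒ : ∀ {e r} → Rank e r → e ∈ˢ del G x′ → Between 2 5 r
      A′⇒ {e} rk e∈ with ∈-del⁻ {G = G} {x′} e∈
      ... | e∈G , e≢x = go rk
        where
        go : ∀ {r} → Rank e r → Between 2 5 r
        go (r₅ e≡)      = ⊥-elim (e≢x e≡)
        go (r₄ _ _ _ _) = m≤m+n 2 2 , ≤-refl
        go (r₃ _ _ _ _) = m≤m+n 2 1 , m≤m+n 4 1
        go (r₂ _)       = ≤-refl , m≤m+n 3 2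
        go (r₁ o _)     = ⊥-elim (o e∈G)
        go (r₀ o _)     = ⊥-elim (o e∈G)

      ⇒A′ : ∀ {e r} → Rank e r → 2 ≤ r → r < 5 → e ∈ˢ del G x′
      ⇒A′ (r₅ _) _ lt = ⊥-elim (<-irrefl refl lt)
      ⇒A′ (r₄ ne _ i _) _ _ = ∈-del⁺ i ne
      ⇒A′ (r₃ ne _ i _) _ _ = ∈-del⁺ i ne
      ⇒A′ (r₂ refl)    _ _ = ∈-del⁺ y∈G (x≢y ∘ sym)
      ⇒A′ (r₁ _ _) (s≤s ()) _

      B⇒ : ∀ {e r} → Rank e r → e ∈ˢ B → Between 1 4 r
      B⇒ (r₅ refl) e∈     = ⊥-elim (x∉B e∈)
      B⇒ (r₄ _ _ _ o) e∈  = ⊥-elim (o e∈)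
      B⇒ (r₃ _ _ _ _) _   = m≤m+n 1 2 , ≤-refl
      B⇒ (r₂ _) _         = m≤m+n 1 1 , m≤m+n 3 1
      B⇒ (r₁ _ _) _       = ≤-refl , m≤m+n 2 2
      B⇒ (r₀ _ o) e∈      = ⊥-elim (o e∈)

      ⇒B : ∀ {e r} → Rank e r → 1 ≤ r → r < 4 → e ∈ˢ B
      ⇒B (r₅ _) _ lt        = ⊥-elim (<⇒≱ lt (m≤m+n 4 1))
      ⇒B (r₄ _ _ _ _) _ lt  = ⊥-elim (<-irrefl refl lt)
      ⇒B (r₃ _ _ _ i) _ _   = i
      ⇒B (r₂ refl) _ _      = y∈B
      ⇒B (r₁ _ i) _ _       = i

      ∣A∣ : ∣ del G y ∣ ≡ m
      ∣A∣ = suc-injective (trans (∣del∣ G y∈G) ∣G∣)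

      ∣A′∣ : ∣ del G x′ ∣ ≡ m
      ∣A′∣ = suc-injective (trans (∣del∣ G x∈G) ∣G∣)

      complement-size : ∀ c (S : Subset n) → (∀ {e} → e ∈ˢ S → c ≤ lookup t e) → (∀ {e} → c ≤ lookup t e → e ∈ˢ S) →
          n ∸ ∣ below c t ∣ ≡ ∣ S ∣
      complement-size c S S⇒ ⇒S = trans (sym (∣∁p∣≡n∸∣p∣ (below c t))) (≤-antisym
        (p⊆q⇒∣p∣≤∣q∣ {p = ∁ (below c t)} {q = S} (λ e∈ → ⇒S (≮⇒≥ (λ lt → x∈p⇒x∉∁p {p = below c t} (∈-below⁺ lt) e∈))))
        (p⊆q⇒∣p∣≤∣q∣ {p = S} {q = ∁ (below c t)} (λ e∈ → x∉p⇒x∈∁p {p = below c t} (λ b → <⇒≱ (∈-below⁻ {t = t} b) (S⇒ e∈)))))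

      grid-A : grid σ 0 m ≡ del G y
      grid-A = trans (cong₂ (λ a s → Vec.map (arc n a s) σ) (trans offset-m (sym (trans (complement-size 3 (del G y)
          (λ {e} e∈ → proj₁ (A⇒ (ranked e) e∈)) (λ {e} h → ⇒A (ranked e) h)) ∣A∣))) (sym ∣A∣))
        (interval 3 6 (del G y) (m≤m+n 3 3) (λ {e} → A⇒ (ranked e)) (λ {e} h _ → ⇒A (ranked e) h))

      G⇒ : ∀ {e r} → Rank e r → e ∈ˢ G → 2 ≤ r
      G⇒ (r₅ _) _       = m≤m+n 2 3
      G⇒ (r₄ _ _ _ _) _ = m≤m+n 2 2
      G⇒ (r₃ _ _ _ _) _ = m≤m+n 2 1
      G⇒ (r₂ _) _       = ≤-refl
      G⇒ (r₁ o _) i     = ⊥-elim (o i)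
      G⇒ (r₀ o _) i     = ⊥-elim (o i)

      ⇒G : ∀ {e r} → Rank e r → 2 ≤ r → e ∈ˢ G
      ⇒G (r₅ refl) _    = x∈G
      ⇒G (r₄ _ _ i _) _ = i
      ⇒G (r₃ _ _ i _) _ = i
      ⇒G (r₂ refl) _    = y∈G
      ⇒G (r₁ _ _) (s≤s ())

      grid-A′ : grid σ 1 m ≡ del G x′
      grid-A′ = trans (cong₂ (λ a s → Vec.map (arc n a s) σ) (trans (cong suc offset-m) (sym (trans (complement-size 2 G
          (λ {e} → G⇒ (ranked e)) (λ {e} → ⇒G (ranked e))) ∣G∣))) (sym ∣A′∣))
        (interval 2 5 (del G x′) (m≤m+n 2 3) (λ {e} → A′⇒ (ranked e)) (λ {e} → ⇒A′ (ranked e)))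

      -- `b` counts the elements of rank at least 1, so `B` is the arc with offset `b`; the arc of
      -- size 2 + m on chain `k` has offset k + (m + 1), which determines `k`. The bound 2 ≤ k holds
      -- because `B` and `x′` together have m + 3 elements, and k < m because b ≤ n.
      b = n ∸ ∣ below 1 t ∣
      k = b ∸ suc m

      b≥ : 3 + m ≤ b
      b≥ = subst₂ _≤_ (trans (∣ins∣ B x∉B) (cong suc ∣B∣)) (∣∁p∣≡n∸∣p∣ (below 1 t))
        (p⊆q⇒∣p∣≤∣q∣ {p = ins B x′} {q = ∁ (below 1 t)} (λ {e} e∈ → x∉p⇒x∈∁p {p = below 1 t}
            (λ h → <⇒≱ (∈-below⁻ {t = t} h) (pos e (∈-ins⁻ {G = B} e∈)))))
        where
        pos′ : ∀ {e r} → Rank e r → e ≡ x′ → 1 ≤ r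
        pos′ rk refl with rk
        ... | r₅ _       = s≤s z≤n
        ... | r₄ _ _ _ _ = s≤s z≤n
        ... | r₃ _ _ _ _ = s≤s z≤n
        ... | r₂ _       = s≤s z≤n
        ... | r₁ _ _     = s≤s z≤n
        ... | r₀ o _     = ⊥-elim (o x∈G)
        pos : ∀ e → e ∈ˢ B ⊎ e ≡ x′ → 1 ≤ lookup t e
        pos e (inj₁ e∈) = proj₁ (B⇒ (ranked e) e∈)
        pos e (inj₂ e≡) = pos′ (ranked e) e≡

      k+1+m : k + suc m ≡ b
      k+1+m = m∸n+n≡m (≤-trans (m≤n+m (suc m) 2) b≥)

      2≤k : 2 ≤ k
      2≤k = m+n≤o⇒m≤o∸n 2 b≥

      k<m : k < m
      k<m = +-cancelʳ-≤ m (suc k) m (subst₂ _≤_ (trans (sym k+1+m) (+-suc k m)) n≡ (m∸n≤m n (∣ below 1 t ∣)))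

      grid-B : grid σ k (2 + m) ≡ B
      grid-B = trans (cong₂ (λ a s → Vec.map (arc n a s) σ) (trans (cong (λ z → k + z) offset-2+m) k+1+m) (sym ∣B∣))
        (interval 1 4 B (m≤m+n 1 3) (λ {e} → B⇒ (ranked e)) (λ {e} → ⇒B (ranked e)))

    conclusion : B ∈ 𝓕
    conclusion = subst (_∈ 𝓕) grid-B (Consecutive.far-arc sorted∈ (subst (_∈ 𝓕) (sym grid-A) A∈)
        (A′∉ ∘ subst (_∈ 𝓕) grid-A′) 2≤k k<m)

  PivotData : Set
  PivotData = ∃ λ G → ∃₂ λ x′ y → ∣ G ∣ ≡ suc m × x′ ∈ˢ G × y ∈ˢ G × del G y ∈ 𝓕 × ¬ (del G x′ ∈ 𝓕)

  private
    exchange : ∀ {A A′ G} → A ∈ 𝓕 → ¬ (A′ ∈ 𝓕) → A ⊆ G → A′ ⊆ G → ∣ A ∣ ≡ m → ∣ A′ ∣ ≡ m → ∣ G ∣ ≡ suc m → PivotData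
    exchange {A} {A′} {G} A∈ A′∉ A⊆G A′⊆G ∣A∣ ∣A′∣ ∣G∣
      with y , y∈ , refl ← codim-1 A G A⊆G (trans ∣G∣ (cong suc (sym ∣A∣)))
      with x′ , x∈ , refl ← codim-1 A′ G A′⊆G (trans ∣G∣ (cong suc (sym ∣A′∣))) = G , x′ , y , ∣G∣ , x∈ , y∈ , A∈ , A′∉

    -- Between a member m-arc and its non-member complement there is a member followed by a
    -- non-member; both lie in the arc of size m + 1 on the chain of the member.
    turn : ∀ {σ} → σ ∈ Ω n → ∀ i → grid σ i m ∈ 𝓕 → ¬ (grid σ (i + m) m ∈ 𝓕) → PivotData
    turn {σ} σ∈ i a ¬a = go (last-true (λ k → grid σ k m ∈ 𝓕) (λ k → grid σ k m ∈𝓕?) i m a ¬a)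
      where
      go : (∃ λ k → k ∈ range i m × grid σ k m ∈ 𝓕 × ¬ (grid σ (suc k) m ∈ 𝓕)) → PivotData
      go (k , _ , f , ¬f) = exchange f ¬f (map-⊆ σ (J-nest k (n≤1+n m))) (map-⊆ σ (J-down k m (even-+ m)))
        (size-grid σ∈ k m (<⇒≤ m<n)) (size-grid σ∈ (suc k) m (<⇒≤ m<n)) (size-grid σ∈ k (suc m) m<n)

  pivot : PivotData
  -- The full set merely supplies an ordering; any other set would do.
  pivot = go (grid∈ ⊤ 0)
    where
    go : (∃ λ σ → σ ∈ Ω n × ⊤ ≡ grid σ 0 ∣ ⊤ {n} ∣) → PivotData
    go (σ , σ∈ , _) =
      [ (λ a → turn σ∈ 0 a (opposite-∉ σ∈ 0 {m} {m} (≤-reflexive (sym n≡)) a))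
      , (λ b → turn σ∈ m b (λ c → opposite-∉ σ∈ 0 {m} {m} (≤-reflexive (sym n≡)) (subst (_∈ 𝓕) again c) b)) ]′
          (centre σ∈ {0} (s≤s z≤n))
      where
      again : grid σ (m + m) m ≡ grid σ 0 m
      again = Vecₚ.map-cong (λ p → trans (cong (λ z → J z m p) (sym n≡)) (J-period 0 m p)) σ

  structure : ∃ λ x′ → ∀ A → (A ∈ 𝓕) ⇔ Star m x′ A
  structure = around pivot
   where
   around : PivotData → ∃ λ x′ → ∀ A → (A ∈ 𝓕) ⇔ Star m x′ A
   around (G , x′ , y , ∣G∣ , x∈G , y∈G , A∈ , A′∉) = x′ , λ A → mk⇔ (to A) (from A)
    where
    x≢y : x′ ≢ y
    x≢y refl = A′∉ A∈

    upper-y : ∀ {B} → ∣ B ∣ ≡ 2 + m → y ∈ˢ B → x′ ∉ˢ B → B ∈ 𝓕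
    upper-y = Pivot.conclusion ∣G∣ x∈G y∈G x≢y A∈ A′∉

    -- All (m + 1)-sets are members, so one between `A` and `B` would be a mid.
    squeeze : ∀ {A B} → A ∈ 𝓕 → B ∈ 𝓕 → A ⊆ B → ∣ A ∣ ≡ m → ∣ B ∣ ≡ 2 + m → ⊥
    squeeze {A} {B} A∈ B∈ A⊆B ∣A∣ ∣B∣ with M , A⊆M , M⊆B , ∣M∣ ← interpolate A B (suc m) A⊆B
        (≤-trans (≤-reflexive ∣A∣) (n≤1+n m)) (≤-trans (n≤1+n _) (≤-reflexive (sym ∣B∣))) =
      between A∈ (middle-full ∣M∣) B∈ A⊆M M⊆B (≤-reflexive (trans (cong suc ∣A∣) (sym ∣M∣)))
          (≤-reflexive (trans (cong suc ∣M∣) (sym ∣B∣)))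

    -- `C` together with `y` extends, avoiding `x′`, to a set of size m + 2, which is a member by
    -- `upper-y`; then `squeeze` excludes `C`.
    centre-∌ : ∀ {C} → ∣ C ∣ ≡ m → x′ ∉ˢ C → ¬ (C ∈ 𝓕)
    centre-∌ {C} ∣C∣ x∉C C∈ with B , C⊆B , B⊆E , ∣B∣ ← interpolate (ins C y) (del ⊤ x′) (2 + m)
        (λ e∈ → ∈-del⁺ ∈⊤ (λ { refl → [ x∉C , x≢y ]′ (∈-ins⁻ {G = C} e∈) }))
        (≤-trans (∣ins∣≤ C y) (≤-trans (≤-reflexive (cong suc ∣C∣)) (n≤1+n _)))
        (≤-pred (subst (3 + m ≤_) (sym (trans (∣del∣ ⊤ {x′} ∈⊤) (∣⊤∣≡n n))) 3+m≤n)) =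
      squeeze C∈ (upper-y ∣B∣ (C⊆B (∈-ins-self C y)) (λ x∈ → proj₂ (∈-del⁻ {G = ⊤} (B⊆E x∈)) refl)) (C⊆B ∘ ⊆-ins C y) ∣C∣ ∣B∣

    centre-∋ : ∀ {A} → ∣ A ∣ ≡ m → x′ ∈ˢ A → A ∈ 𝓕
    centre-∋ ∣A∣ x∈A with centre-or-disjoint ∣A∣
    ... | inj₁ a = a
    ... | inj₂ (A′ , A′∈ , ∣A′∣ , dis) = ⊥-elim (centre-∌ ∣A′∣ (dis x∈A) A′∈)

    upper-∋ : ∀ {B} → ∣ B ∣ ≡ 2 + m → x′ ∈ˢ B → ¬ (B ∈ 𝓕)
    upper-∋ {B} ∣B∣ x∈B B∈ with A , x⊆A , A⊆B , ∣A∣ ← interpolate ⁅ x′ ⁆ B m (λ e∈ → subst (_∈ˢ B) (sym (x∈⁅y⁆⇒x≡y x′ e∈)) x∈B)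
        (≤-trans (≤-reflexive (∣⁅x⁆∣≡1 x′)) (s≤s z≤n)) (≤-trans (m≤n+m m 2) (≤-reflexive (sym ∣B∣))) =
      squeeze (centre-∋ ∣A∣ (x⊆A (x∈⁅x⁆ x′))) B∈ A⊆B ∣A∣ ∣B∣

    -- Membership of m-sets is known by now, so any (m + 1)-set `H` through `x′` and an element `y′`
    -- of `B` serves as a new pivot.
    upper-∌ : ∀ {B} → ∣ B ∣ ≡ 2 + m → x′ ∉ˢ B → B ∈ 𝓕
    upper-∌ {B} ∣B∣ x∉B with y′ , y′∈ ← ∣∣>0⇒member B (≤-trans (s≤s z≤n) (≤-reflexive (sym ∣B∣)))
      with H , S⊆H , _ , ∣H∣ ← interpolate (ins ⁅ x′ ⁆ y′) ⊤ (suc m) (λ _ → ∈⊤)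
             (≤-trans (∣ins∣≤ ⁅ x′ ⁆ y′) (≤-trans (≤-reflexive (cong suc (∣⁅x⁆∣≡1 x′))) (s≤s (s≤s z≤n))))
             (≤-trans m<n (≤-reflexive (sym (∣⊤∣≡n n)))) =
      Pivot.conclusion ∣H∣ x∈H y∈H x≢y′
        (centre-∋ (suc-injective (trans (∣del∣ H y∈H) ∣H∣)) (∈-del⁺ x∈H x≢y′))
        (centre-∌ (suc-injective (trans (∣del∣ H x∈H) ∣H∣)) (λ h → proj₂ (∈-del⁻ {G = H} h) refl)) ∣B∣ y′∈ x∉B
      where
      x∈H : x′ ∈ˢ H
      x∈H = S⊆H (⊆-ins ⁅ x′ ⁆ y′ (x∈⁅x⁆ x′))
      y∈H : y′ ∈ˢ H
      y∈H = S⊆H (∈-ins-self ⁅ x′ ⁆ y′)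
      x≢y′ : x′ ≢ y′
      x≢y′ refl = x∉B y′∈

    to : ∀ A → A ∈ 𝓕 → Star m x′ A
    to A A∈ with ∣ A ∣ ≟ m | ∣ A ∣ ≟ suc m | x′ ∈ˢ? A
    ... | yes e | _ | yes x∈ = inj₁ (e , x∈)
    ... | yes e | _ | no x∉ = ⊥-elim (centre-∌ e x∉ A∈)
    ... | no _ | yes e | _ = inj₂ (inj₁ e)
    ... | no a | no b | x∈? = inj₂ (inj₂ (e , λ x∈ → upper-∋ e x∈ A∈))
      where e : ∣ A ∣ ≡ 2 + m
            e = ≤-antisym (size≤ A∈) (≤∧≢⇒< (≤∧≢⇒< (size≥ A∈) (a ∘ sym)) (b ∘ sym))

    from : ∀ A → Star m x′ A → A ∈ 𝓕
    from A (inj₁ (e , x∈))        = centre-∋ e x∈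
    from A (inj₂ (inj₁ e))        = middle-full e
    from A (inj₂ (inj₂ (e , x∉))) = upper-∌ e x∉

-- Initial and final segments; odd n

-- With t = n - s the claim is (s - 1) (t - 1) ≥ 2, which for s, t ≥ 2 fails only at s = t = 2.
n<s[n-s] : ∀ n s → 5 ≤ n → 2 ≤ s → 2 + s ≤ n → suc n ≤ s * (n ∸ s)
n<s[n-s] n s 5≤n 2≤s 2+s≤n with a , ea ← m≤n⇒∃[o]m+o≡n 2≤s | b , eb ← m≤n⇒∃[o]m+o≡n (m+n≤o⇒m≤o∸n 2 2+s≤n) =
  subst (λ z → suc z ≤ s * (n ∸ s)) n≡ (farkas (a * b) (subst (5 ≤_) (sym n≡) 5≤n)
    (subst₂ (λ s t → suc (s + t) + (s + t) + a * b ≡ s * t + 5) ea eb (r a b)))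
  where
  n≡ : s + (n ∸ s) ≡ n
  n≡ = m+[n∸m]≡n (≤-trans (m≤n+m s 2) 2+s≤n)
  r : ∀ a b → suc (2 + a + (2 + b)) + (2 + a + (2 + b)) + a * b ≡ (2 + a) * (2 + b) + 5
  r = solve-∀

-- Serves odd `n`, and also even `n` when the full set is a member: there the estimates leave enough
-- room to do without the circle.
module Line {n : ℕ} .{{nz : NonZero n}} (5≤n : 5 ≤ n) (𝓕 : List (Subset n)) (unique : Unique 𝓕)
            (intersecting : Intersecting 𝓕) (free : ButterflyFree 𝓕) where

  open Family 𝓕 unique intersecting free public
  open Arcs 𝓕 unique intersecting free public
  open Chains 𝓕 unique intersecting free public

  initial final : ℕ → ℕ → Bool
  initial s = arc n 0 s
  final s   = arc n s s

  initial-nest : ∀ {s t} → s ≤ t → initial s ⊑ initial t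
  initial-nest = arc-⊑ 0

  final-nest : ∀ {s t} → s ≤ t → final s ⊑ final t
  final-nest {s} {t} s≤t = subst (λ z → final s ⊑ final z) (m∸n+n≡m s≤t) (go (t ∸ s))
    where
    go : ∀ d → final s ⊑ final (d + s)
    go zero    p h = h
    go (suc d) p h = arc-⊑-suc (d + s) (d + s) p (go d p h)

  pre suf : Vec ℕ n → ℕ → Subset n
  pre σ s = Vec.map (initial s) σ
  suf σ s = Vec.map (final s) σ

  size-initial : ∀ s → s ≤ n → size n (initial s) ≡ s
  size-initial s = size-arc 0 s

  size-final : ∀ s → s ≤ n → size n (final s) ≡ s
  size-final s = size-arc s s

  size-pre : ∀ {σ} → σ ∈ Ω n → ∀ s → s ≤ n → ∣ pre σ s ∣ ≡ s
  size-pre σ∈ s s≤n = trans (∣map∣ (initial s) σ∈) (size-initial s s≤n)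

  size-suf : ∀ {σ} → σ ∈ Ω n → ∀ s → s ≤ n → ∣ suf σ s ∣ ≡ s
  size-suf σ∈ s s≤n = trans (∣map∣ (final s) σ∈) (size-final s s≤n)

  module Pre {σ} (σ∈ : σ ∈ Ω n) = Chain (pre σ) (size-pre σ∈) (λ s≤t → map-⊆ σ (initial-nest s≤t))
  module Suf {σ} (σ∈ : σ ∈ Ω n) = Chain (suf σ) (size-suf σ∈) (λ s≤t → map-⊆ σ (final-nest s≤t))

  pre-suf : ∀ σ {s t} → s + t ≤ n → pre σ s ∈ 𝓕 → suf σ t ∈ 𝓕 → ⊥
  pre-suf σ {s} {t} le = λ s∈ → disjoint-∉ s∈ (λ {e} p q →
    arc-disjoint 0 {s} {n ∸ s} {lookup σ e} (≤-reflexive (m+[n∸m]≡n (≤-trans (m≤m+n s t) le))) (∈-map⁻ σ p)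
      (final-nest (m+n≤o⇒m≤o∸n t (subst (_≤ n) (+-comm s t) le)) (lookup σ e) (∈-map⁻ σ q)))

  exclusive : ∀ σ {s t} → s + t ≤ n → x (pre σ s) + x (suf σ t) ≤ 1
  exclusive σ {s} {t} le with pos⊎0 (x (pre σ s))
  ... | inj₂ e = ≤-trans (≤-reflexive (cong (_+ x (suf σ t)) e)) (x≤1 _)
  ... | inj₁ q = ≤-trans (≤-reflexive (trans (cong (x (pre σ s) +_) (∉⇒x (pre-suf σ {s} {t} le (x⇒∈ q))))
      (+-identityʳ _))) (x≤1 _)

  pre∈ : ∀ (A : Subset n) → ∃ λ σ → σ ∈ Ω n × A ≡ pre σ ∣ A ∣
  pre∈ A = ∃-Ω-set (initial ∣ A ∣) A (sym (size-initial ∣ A ∣ (∣p∣≤n A)))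

  S : List ℕ
  S = range 1 (n ∸ 1)

  weight : (ℕ → Subset n) → ℕ
  weight c = ∑[ s ∈ S ] ((n choose s) * x (c s))

  properCount : ℕ
  properCount = ∑[ A ∈ 𝓕 ] 𝟙 (∣ A ∣ <? n)

  ∑-weight-pre : ∑[ σ ∈ Ω n ] weight (pre σ) ≡ n ! * properCount
  ∑-weight-pre = ∑-Ω-weights initial (λ s _ s<n → size-initial s (<⇒≤ s<n))

  ∑-weight-suf : ∑[ σ ∈ Ω n ] weight (suf σ) ≡ n ! * properCount
  ∑-weight-suf = ∑-Ω-weights final (λ s _ s<n → size-final s (<⇒≤ s<n))

  ∑-weights : ∑[ σ ∈ Ω n ] (weight (pre σ) + weight (suf σ)) ≡ 2 * (n ! * properCount)
  ∑-weights = trans (∑-+ (Ω n) _ _) (trans (cong₂ _+_ ∑-weight-pre ∑-weight-suf)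
      (cong (n ! * properCount +_) (sym (+-identityʳ _))))

  private
    mid-2≤ : ∀ {M} → Mid M → 2 ≤ ∣ M ∣
    mid-2≤ (_ , low , _) with A , A∈ , _ , a< ← find low = ≤-trans (s≤s (∈𝓕⇒nonempty A∈)) a<

    mid-2+ : (∀ {B} → B ∈ 𝓕 → ∣ B ∣ < n) → ∀ {M} → Mid M → 2 + ∣ M ∣ ≤ n
    mid-2+ proper (_ , _ , up) with B , B∈ , _ , b< ← find up = ≤-trans (s≤s b<) (proper B∈)

  -- Initial segments have offset 0 for all sizes, final segments of size `s` have offset `s`; both
  -- chains share these sums.
  module ChainSums (o : ℕ → ℕ) (nest : ∀ {s t} → s ≤ t → arc n (o s) s ⊑ arc n (o t) t) where

    I : ℕ → ℕ → Bool
    I s = arc n (o s) s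

    c : Vec ℕ n → ℕ → Subset n
    c σ s = Vec.map (I s) σ

    size-c : ∀ {σ} → σ ∈ Ω n → ∀ s → s ≤ n → ∣ c σ s ∣ ≡ s
    size-c σ∈ s s≤n = trans (∣map∣ (I s) σ∈) (size-arc (o s) s s≤n)

    module _ {σ} (σ∈ : σ ∈ Ω n) where
      module Cσ = Chain (c σ) (size-c σ∈) (λ s≤t → map-⊆ σ (nest s≤t))

    U : ℕ → ℕ
    U s = ∑[ σ ∈ Ω n ] μ (c σ s)

    U≡0 : ∀ s → s ≤ n → (∀ {M} → Mid M → ∣ M ∣ ≢ s) → ∀ {σ} → σ ∈ Ω n → μ (c σ s) ≡ 0
    U≡0 s s≤n h σ∈ = ¬Mid⇒μ (λ mid → h mid (size-c σ∈ s s≤n))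

    ∑-mids : ∑[ σ ∈ Ω n ] mids (c σ) ≡ ∑ S U
    ∑-mids = ∑-swap (Ω n) S _

    module _ (proper : ∀ {B} → B ∈ 𝓕 → ∣ B ∣ < n) where

      Z : ℕ → ℕ
      Z s = ∑[ σ ∈ Ω n ] (μ (c σ s) * rest (c σ) s)

      ∑-extra : ∑[ σ ∈ Ω n ] extra (c σ) ≡ ∑ S Z
      ∑-extra = ∑-swap (Ω n) S _

      -- In contrast to the circle only the mid's own chain is involved, so n / (s (n - s)) < 1 is
      -- enough.
      Z≤U : ∀ {s} → s ∈ S → Z s ≤ U s × (U s ≤ Z s → U s ≡ 0)
      Z≤U {s} s∈ with 1≤s , s<n ← ∈-inner⁻ s∈ with (2 ≤? s) ×-dec (2 + s ≤? n)
      ... | no ¬p = ≤-trans (≤-reflexive (∑-zero (Ω n) (λ {σ} σ∈ → cong (_* rest (c σ) s) (none σ∈)))) z≤n ,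
          (λ _ → ∑-zero (Ω n) none)
        where
        none : ∀ {σ} → σ ∈ Ω n → μ (c σ s) ≡ 0
        none = U≡0 s (<⇒≤ s<n) (λ { mid refl → ¬p (mid-2≤ mid , mid-2+ proper mid) })
      ... | yes (2≤s , 2+s≤n) = *-cancel-≤-pos P P>0 (≤-trans (m≤m+n _ (U s)) main) , tight
        where
        open ≤-Reasoning
        P = s * (n ∸ s)
        P>0 : 1 ≤ P
        P>0 = *-mono-≤ 1≤s (m<n⇒0<n∸m s<n)
        n<P : suc n ≤ P
        n<P = n<s[n-s] n s 5≤n 2≤s 2+s≤n
        main : P * Z s + U s ≤ P * U s
        main = begin
          P * Z s + U s ≤⟨ +-monoˡ-≤ (U s) (∑-mid-others-arc (I s) s (size-arc (o s) s (<⇒≤ s<n)) o proper s<n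
                             (λ t t<s → nest (<⇒≤ t<s)) (λ t s<t _ → nest (<⇒≤ s<t))) ⟩
          n * U s + U s ≡⟨ +-comm (n * U s) (U s) ⟩
          suc n * U s   ≤⟨ *-monoˡ-≤ (U s) n<P ⟩
          P * U s       ∎
        tight : U s ≤ Z s → U s ≡ 0
        tight le = n≤0⇒n≡0 (+-cancelˡ-≤ (P * Z s) _ _ (≤-trans main (≤-trans (*-monoʳ-≤ P le)
            (≤-reflexive (sym (+-identityʳ _))))))

    module _ (top : ⊤ ∈ 𝓕) where

      private
        lower : Vec ℕ n → ℕ
        lower σ = ∑[ s ∈ S ] (μ (c σ s) * ∑[ t ∈ range 1 (s ∸ 1) ] x (c σ t))

      -- With ⊤ in 𝓕, every proper member that has another member below it is a mid.
      count-top : ∀ {σ} → σ ∈ Ω n → count (c σ) ≤ 1 + lower σ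
      count-top {σ} σ∈ with 2 ≤? count (c σ)
      ... | no ¬p = ≤-trans (≤-pred (≰⇒> ¬p)) (m≤m+n 1 _)
      ... | yes p = go (Cσ.two σ∈ p)
        where
        go : (∃₂ λ s t → 1 ≤ s × s < t × t < n × c σ s ∈ 𝓕 × c σ t ∈ 𝓕) → count (c σ) ≤ 1 + lower σ
        go (s , t , 1≤s , s<t , t<n , s∈ , t∈) = begin
          count (c σ)                          ≡⟨ count-split (c σ) 1≤t t<n ⟩
          x (c σ t) + (below′ + above′)        ≤⟨ +-mono-≤ (x≤1 (c σ t))
              (≤-reflexive (trans (cong (below′ +_) above≡0) (+-identityʳ below′))) ⟩
          1 + below′                           ≡⟨ cong (1 +_) (sym (trans (cong (_* below′) (Mid⇒μ mid)) (+-identityʳ below′))) ⟩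
          1 + μ (c σ t) * below′               ≤⟨ +-monoʳ-≤ 1 (∑-member S
              (λ s → μ (c σ s) * ∑[ t ∈ range 1 (s ∸ 1) ] x (c σ t)) (∈-inner⁺ 1≤t t<n)) ⟩
          1 + lower σ                          ∎
          where
          open ≤-Reasoning
          1≤t = ≤-trans 1≤s (<⇒≤ s<t)
          below′ = ∑[ u ∈ range 1 (t ∸ 1) ] x (c σ u)
          above′ = ∑[ u ∈ range (suc t) (n ∸ suc t) ] x (c σ u)
          t<⊤ : ∣ c σ t ∣ < ∣ ⊤ {n} ∣
          t<⊤ = subst₂ _<_ (sym (size-c σ∈ t (<⇒≤ t<n))) (sym (∣⊤∣≡n n)) t<n
          mid : Mid (c σ t)
          mid = t∈ , lose s∈ (map-⊆ σ (nest (<⇒≤ s<t)) , Cσ.size-< σ∈ s<t (<⇒≤ t<n)) , lose top (⊆⊤ , t<⊤)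
          above≡0 : above′ ≡ 0
          above≡0 = ∑-zero (range (suc t) (n ∸ suc t)) (λ {u} u∈ → ∉⇒x (not-above u (∈-range⁻ (suc t) (n ∸ suc t) u∈)))
            where
            not-above : ∀ u → suc t ≤ u × u < suc t + (n ∸ suc t) → ¬ (c σ u ∈ 𝓕)
            not-above u (t<u , u<) u∈ = <⇒≢ u<n (trans (sym (size-c σ∈ u (<⇒≤ u<n)))
              (trans (cong ∣_∣ (upper-unique mid u∈ top (map-⊆ σ (nest (<⇒≤ t<u)) , Cσ.size-< σ∈ t<u (<⇒≤ u<n))
                  (⊆⊤ , t<⊤))) (∣⊤∣≡n n)))
              where u<n = subst (u <_) (m+[n∸m]≡n t<n) u<

      -- A mid has size s ≥ 2, so by `∑-mid-below` the mean number of members below it on its chain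
      -- is at most 1/s ≤ 1/2.
      2∑lower≤∑mids : 2 * ∑ (Ω n) lower ≤ ∑[ σ ∈ Ω n ] mids (c σ)
      2∑lower≤∑mids = begin
        2 * ∑ (Ω n) lower     ≡⟨ cong (2 *_) (∑-swap (Ω n) S _) ⟩
        2 * ∑ S L             ≡⟨ ∑-*ˡ 2 S L ⟨
        ∑[ s ∈ S ] (2 * L s)  ≤⟨ ∑-mono S (λ {s} s∈ → each s (∈-inner⁻ s∈)) ⟩
        ∑ S U                 ≡⟨ ∑-mids ⟨
        ∑[ σ ∈ Ω n ] mids (c σ) ∎
        where
        open ≤-Reasoning
        L : ℕ → ℕ
        L s = ∑[ σ ∈ Ω n ] (μ (c σ s) * ∑[ t ∈ range 1 (s ∸ 1) ] x (c σ t))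
        each : ∀ s → 1 ≤ s × s < n → 2 * L s ≤ U s
        each s (1≤s , s<n) with 2 ≤? s
        ... | yes 2≤s = ≤-trans (*-monoˡ-≤ (L s) 2≤s) (∑-mid-below (I s) s (size-arc (o s) s (<⇒≤ s<n)) o (<⇒≤ s<n)
            (λ t t<s → nest (<⇒≤ t<s)))
        ... | no ¬p = ≤-trans (≤-reflexive (cong (2 *_) (∑-zero (Ω n) (λ {σ} σ∈ → cong (_* ∑[ t ∈ range 1 (s ∸ 1) ] x (c σ t))
                (U≡0 s (<⇒≤ s<n) (λ { mid refl → ¬p (mid-2≤ mid) }) σ∈))))) z≤n

      -- By `count-top` a chain has on average at most 3/2 inner members: one, and half a member
      -- more for each chain through a mid.
      2∑count≤3n! : 2 * ∑[ σ ∈ Ω n ] count (c σ) ≤ 3 * n !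
      2∑count≤3n! = begin
        2 * ∑[ σ ∈ Ω n ] count (c σ)             ≤⟨ *-monoʳ-≤ 2 (∑-mono (Ω n) count-top) ⟩
        2 * ∑[ σ ∈ Ω n ] (1 + lower σ)           ≡⟨ cong (2 *_) (trans (∑-+ (Ω n) (λ _ → 1) lower)
            (cong (_+ ∑ (Ω n) lower) (trans (∑-perms-const (rangeⱽ 0 n) 1) (*-identityʳ (n !))))) ⟩
        2 * (n ! + ∑ (Ω n) lower)                ≡⟨ *-distribˡ-+ 2 (n !) _ ⟩
        2 * n ! + 2 * ∑ (Ω n) lower              ≤⟨ +-monoʳ-≤ (2 * n !)
            (≤-trans 2∑lower≤∑mids (∑-mono (Ω n) (λ σ∈ → Cσ.mids≤1 σ∈))) ⟩
        2 * n ! + ∑[ σ ∈ Ω n ] 1                 ≡⟨ cong (2 * n ! +_) (trans (∑-perms-const (rangeⱽ 0 n) 1) (*-identityʳ (n !))) ⟩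
        2 * n ! + n !                            ≡⟨ +-comm (2 * n !) (n !) ⟩
        3 * n !                                  ∎
        where open ≤-Reasoning

  module PreSums = ChainSums (λ _ → 0) initial-nest
  module SufSums = ChainSums id final-nest

  with-top : ⊤ ∈ 𝓕 → ∀ b D → (∀ {σ} → σ ∈ Ω n → weight (pre σ) + weight (suf σ) ≤ b * (count (pre σ) + count (suf σ)) + D) →
             4 * properCount ≤ 6 * b + 2 * D
  with-top top b D h = *-cancel-≤-pos (n !) (!-pos n) (begin
    n ! * (4 * properCount)          ≡⟨ r₁ (n !) properCount ⟩
    2 * (2 * (n ! * properCount))    ≡⟨ cong (2 *_) (sym ∑-weights) ⟩
    2 * ∑[ σ ∈ Ω n ] (weight (pre σ) + weight (suf σ)) ≤⟨ *-monoʳ-≤ 2 (∑-mono (Ω n) h) ⟩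
    2 * ∑[ σ ∈ Ω n ] (b * (count (pre σ) + count (suf σ)) + D)
      ≡⟨ cong (2 *_) (trans (∑-+ (Ω n) _ _) (cong₂ _+_ (trans (∑-*ˡ b (Ω n) _)
          (cong (b *_) (∑-+ (Ω n) (count ∘ pre) (count ∘ suf)))) (∑-perms-const (rangeⱽ 0 n) D))) ⟩
    2 * (b * (X + Y) + n ! * D)      ≡⟨ r₂ b X Y (n !) D ⟩
    b * (2 * X + 2 * Y) + 2 * (n ! * D) ≤⟨ +-monoˡ-≤ (2 * (n ! * D)) (*-monoʳ-≤ b
        (+-mono-≤ (PreSums.2∑count≤3n! top) (SufSums.2∑count≤3n! top))) ⟩
    b * (3 * n ! + 3 * n !) + 2 * (n ! * D) ≡⟨ r₃ b (n !) D ⟩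
    n ! * (6 * b + 2 * D) ∎)
    where
    open ≤-Reasoning
    X = ∑[ σ ∈ Ω n ] count (pre σ)
    Y = ∑[ σ ∈ Ω n ] count (suf σ)
    r₁ : ∀ f P → f * (4 * P) ≡ 2 * (2 * (f * P))
    r₁ = solve-∀
    r₂ : ∀ b X Y f D → 2 * (b * (X + Y) + f * D) ≡ b * (2 * X + 2 * Y) + 2 * (f * D)
    r₂ = solve-∀
    r₃ : ∀ b f D → b * (3 * f + 3 * f) + 2 * (f * D) ≡ f * (6 * b + 2 * D)
    r₃ = solve-∀

  length-with-top : length 𝓕 ≤ properCount + 1
  length-with-top = begin
    length 𝓕                                             ≡⟨ trans (sym (*-identityʳ _)) (sym (∑-const 𝓕 1)) ⟩
    ∑[ A ∈ 𝓕 ] 1                                          ≤⟨ ∑-mono 𝓕 (λ {A} _ → each A) ⟩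
    ∑[ A ∈ 𝓕 ] (𝟙 (∣ A ∣ <? n) + 𝟙 (A ≟ˢ ⊤))              ≡⟨ ∑-+ 𝓕 _ _ ⟩
    properCount + ∑[ A ∈ 𝓕 ] 𝟙 (A ≟ˢ ⊤)                   ≡⟨ cong (properCount +_) (x-count ⊤) ⟨
    properCount + x ⊤                                     ≤⟨ +-monoʳ-≤ properCount (x≤1 ⊤) ⟩
    properCount + 1                                       ∎
    where
    open ≤-Reasoning
    each : ∀ A → 1 ≤ 𝟙 (∣ A ∣ <? n) + 𝟙 (A ≟ˢ ⊤)
    each A with ∣ A ∣ <? n
    ... | yes _ = s≤s z≤n
    ... | no ¬p = ≤-reflexive (sym (𝟙-yes (A ≟ˢ ⊤) (∣p∣≡n⇒p≡⊤ (≤-antisym (∣p∣≤n A) (≮⇒≥ ¬p)))))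

  no-top⇒proper : ¬ (⊤ ∈ 𝓕) → ∀ {B} → B ∈ 𝓕 → ∣ B ∣ < n
  no-top⇒proper ¬top {B} B∈ = ≤∧≢⇒< (∣p∣≤n B) (λ e → ¬top (subst (_∈ 𝓕) (∣p∣≡n⇒p≡⊤ e) B∈))

  proper⇒properCount : (∀ {B} → B ∈ 𝓕 → ∣ B ∣ < n) → properCount ≡ length 𝓕
  proper⇒properCount proper = trans (∑-cong 𝓕 (λ {A} A∈ → 𝟙-yes (∣ A ∣ <? n) (proper A∈))) (trans (∑-const 𝓕 1) (*-identityʳ _))

  ∑-at : ∀ c {s} → 1 ≤ s → s < n → ∑[ t ∈ S ] (𝟙 (s ≟ t) * x (c t)) ≡ x (c s)
  ∑-at c 1≤s s<n = ∑-𝟙≟ 1 (n ∸ 1) _ (x ∘ c) 1≤s (<⇒<-pred n s<n)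

-- Odd n: the bound, the extremal family and its size

module Odd {n : ℕ} .{{nz : NonZero n}} (p : ℕ) (n≡ : n ≡ suc (suc p + suc p)) (8≤p : 8 ≤ p)
           (𝓕 : List (Subset n)) (unique : Unique 𝓕)
           (intersecting : Intersecting 𝓕) (free : ButterflyFree 𝓕) where

  m = suc p
  a = n choose suc m
  b = n choose (2 + m)
  d = a ∸ b

  private
    n-m : n ∸ m ≡ suc m
    n-m = trans (cong (_∸ m) (trans n≡ (sym (+-suc m m)))) (m+n∸m≡n m (suc m))

    n-[1+m] : n ∸ suc m ≡ m
    n-[1+m] = trans (cong (_∸ suc m) n≡) (m+n∸m≡n (suc m) m)

    n-[2+m] : n ∸ (2 + m) ≡ p
    n-[2+m] = trans (cong (_∸ (2 + m)) (trans n≡ (cong suc (+-suc m p)))) (m+n∸m≡n (2 + m) p)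

    n≡p : n ≡ p + (2 + m)
    n≡p = trans n≡ (trans (cong suc (+-suc m p)) (+-comm (2 + m) p))

  18≤n : 18 ≤ n
  18≤n = subst (18 ≤_) (sym n≡p) (+-mono-≤ 8≤p (s≤s (s≤s (s≤s (≤-trans (m≤m+n 7 1) 8≤p)))))

  5≤n : 5 ≤ n
  5≤n = ≤-trans (m≤m+n 5 13) 18≤n

  open Line 5≤n 𝓕 unique intersecting free public

  2+m<n : 2 + m < n
  2+m<n = subst (2 + m <_) (sym n≡p) (m<n+m (2 + m) (≤-trans (s≤s z≤n) 8≤p))

  1+m<n : suc m < n
  1+m<n = <-trans (n<1+n _) 2+m<n

  m<n : m < n
  m<n = <-trans (n<1+n _) 1+m<n

  w-m : n choose m ≡ a
  w-m = trans (nCk≡nC[n∸k] (<⇒≤ m<n)) (cong (n choose_) n-m)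

  ratio : (2 + m) * b ≡ m * a
  ratio = trans ([k+1]C[k+1]≡[n-k]Ck n (suc m) 1+m<n) (cong (_* a) n-[1+m])

  b≤a : b ≤ a
  b≤a = *-cancel-≤-pos (2 + m) (s≤s z≤n) (≤-trans (≤-reflexive ratio) (*-monoˡ-≤ a (m≤n+m m 2)))

  a≡ : a ≡ b + d
  a≡ = sym (m+[n∸m]≡n b≤a)

  b>0 : 1 ≤ b
  b>0 = C-pos n (2 + m) (<⇒≤ 2+m<n)

  w-high : ∀ s → 3 + m ≤ s → s ≤ n → suc (n choose s) ≤ b
  w-high s h s≤n = ≤-trans (s≤s (C-anti-≤ n s≤n h (≤-trans (+-mono-≤ half half)
      (≤-trans (≤-reflexive (sym (cong (_∸ 1) n≡))) (≤-trans (m∸n≤m n 1) (n≤1+n n))))))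
    (≰⇒> λ b≤ → <⇒≱ (*-monoˡ-< b {{>-nonZero b>0}} {p} {3 + m} (m≤n+m (suc p) 3)) (≤-trans (*-monoʳ-≤ (3 + m) b≤) (≤-reflexive ratio₃)))
    where
    half : n ∸ (3 + m) ≤ m
    half = ≤-trans (∸-monoʳ-≤ n (m≤n+m (suc m) 2)) (≤-reflexive n-[1+m])
    ratio₃ : (3 + m) * (n choose (3 + m)) ≡ p * b
    ratio₃ = trans ([k+1]C[k+1]≡[n-k]Ck n (2 + m) 2+m<n) (cong (_* b) n-[2+m])

  w-low : ∀ s → s < p → suc (n choose s) ≤ b
  w-low s s<p = subst (λ z → suc z ≤ b) (sym (nCk≡nC[n∸k] s≤n)) (w-high (n ∸ s) (m+n≤o⇒m≤o∸n (3 + m)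
      (subst (3 + m + s ≤_) (sym n≡p) (≤-trans (≤-reflexive (cong suc (+-comm (2 + m) s))) (+-monoˡ-≤ (2 + m) s<p)))) (m∸n≤m n s))
    where s≤n = ≤-trans (<⇒≤ s<p) (≤-trans (m≤m+n p (2 + m)) (≤-reflexive (sym n≡p)))

  w-p : n choose p ≡ b
  w-p = trans (nCk≡nC[n∸k] (≤-trans (m≤m+n p (2 + m)) (≤-reflexive (sym n≡p))))
      (cong (n choose_) (trans (cong (_∸ p) n≡p) (m+n∸m≡n p (2 + m))))

  -- Sizes at which the weight is strictly below b; they must be empty in the case of equality.
  outer? : ∀ s → Dec (s < p ⊎ 3 + m ≤ s)
  outer? s = (s <? p) ⊎-dec (3 + m ≤? s)

  outer : ℕ → ℕ
  outer s = 𝟙 (outer? s)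

  w≤ : ∀ s → s < n → (n choose s) + outer s ≤ b + (d * 𝟙 (m ≟ s) + d * 𝟙 (suc m ≟ s))
  w≤ s s<n with outer? s
  ... | yes (inj₁ h) = ≤-trans (≤-reflexive (+-comm (n choose s) 1)) (≤-trans (w-low s h) (m≤m+n b _))
  ... | yes (inj₂ h) = ≤-trans (≤-reflexive (+-comm (n choose s) 1)) (≤-trans (w-high s h (<⇒≤ s<n)) (m≤m+n b _))
  ... | no ¬o with m ≟ s | suc m ≟ s
  ...   | yes refl | _ = ≤-trans (≤-reflexive (trans (+-identityʳ _) (trans w-m a≡)))
      (+-monoʳ-≤ b (≤-trans (≤-reflexive (sym (*-identityʳ d))) (m≤m+n _ _)))
  ...   | no _ | yes refl = ≤-trans (≤-reflexive (trans (+-identityʳ _) a≡))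
      (+-monoʳ-≤ b (≤-trans (≤-reflexive (sym (*-identityʳ d))) (m≤n+m _ _)))
  ...   | no ≢m | no ≢1+m with s ≟ p
  ...     | yes refl = ≤-trans (≤-reflexive (trans (+-identityʳ _) w-p)) (m≤m+n b _)
  ...     | no ≢p = ≤-trans (≤-reflexive (trans (+-identityʳ _) (cong (n choose_) s≡))) (m≤m+n b _)
    where
    s≡ : s ≡ 2 + m
    s≡ = ≤-antisym (≤-pred (≰⇒> (¬o ∘ inj₂))) (≤∧≢⇒< (≤∧≢⇒< (≤∧≢⇒< (≮⇒≥ (¬o ∘ inj₁)) (≢p ∘ sym)) ≢m) ≢1+m)

  outers : (ℕ → Subset n) → ℕ
  outers c = ∑[ s ∈ S ] (outer s * x (c s))

  weight≤ : ∀ c → weight c + outers c ≤ b * count c + d * (x (c m) + x (c (suc m)))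
  weight≤ c = begin
    weight c + outers c ≡⟨ ∑-+ S _ _ ⟨
    ∑[ s ∈ S ] ((n choose s) * x (c s) + outer s * x (c s))
      ≤⟨ ∑-mono S (λ {s} s∈ → ≤-trans (≤-reflexive (sym (*-distribʳ-+ (x (c s)) (n choose s) (outer s))))
          (*-monoˡ-≤ (x (c s)) (w≤ s (proj₂ (∈-inner⁻ s∈))))) ⟩
    ∑[ s ∈ S ] ((b + (d * 𝟙 (m ≟ s) + d * 𝟙 (suc m ≟ s))) * x (c s))
      ≡⟨ ∑-cong S (λ {s} _ → r b d (𝟙 (m ≟ s)) (𝟙 (suc m ≟ s)) (x (c s))) ⟩
    ∑[ s ∈ S ] (b * x (c s) + d * (𝟙 (m ≟ s) * x (c s) + 𝟙 (suc m ≟ s) * x (c s)))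
      ≡⟨ trans (∑-+ S _ _) (cong₂ _+_ (∑-*ˡ b S (x ∘ c)) (trans (∑-*ˡ d S _) (cong (d *_) (trans (∑-+ S _ _)
           (cong₂ _+_ (∑-at c (s≤s z≤n) m<n) (∑-at c (s≤s z≤n) 1+m<n)))))) ⟩
    b * count c + d * (x (c m) + x (c (suc m))) ∎
    where
    open ≤-Reasoning
    r : ∀ b d i j y → (b + (d * i + d * j)) * y ≡ b * y + d * (i * y + j * y)
    r = solve-∀

  private
    m+[1+m]≤n : m + suc m ≤ n
    m+[1+m]≤n = ≤-reflexive (trans (+-suc m m) (sym n≡))

  -- A surplus `d` is earned at sizes m and m + 1. The arc of size m on one chain and that of size m
  -- + 1 on the other are complementary, so the two chains together earn it at most twice.
  pair≤ : ∀ σ → weight (pre σ) + weight (suf σ) + (outers (pre σ) + outers (suf σ)) ≤ b * (count (pre σ) + count (suf σ)) + 2 * d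
  pair≤ σ = farkas 0 (+-mono-≤ (+-mono-≤ (weight≤ (pre σ)) (weight≤ (suf σ)))
      (*-monoʳ-≤ d (+-mono-≤ (exclusive σ {m} {suc m} m+[1+m]≤n) (exclusive σ {suc m} {m}
          (≤-trans (≤-reflexive (+-comm (suc m) m)) m+[1+m]≤n)))))
    (r (weight (pre σ)) (weight (suf σ)) (outers (pre σ)) (outers (suf σ)) b d (count (pre σ)) (count (suf σ))
       (x (pre σ m)) (x (pre σ (suc m))) (x (suf σ m)) (x (suf σ (suc m))))
    where
    r : ∀ W V E F b d X Y f g h i →
        W + V + (E + F) + (b * X + d * (f + g) + (b * Y + d * (h + i)) + d * 2) + 0 ≡ b * (X + Y) + 2 * d +
            (W + E + (V + F) + d * (f + i + (g + h)))
    r = solve-∀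

  -- Having on average three members on the two chains instead of four costs `b`, more than the full
  -- set itself adds.
  with-top-bound : ⊤ ∈ 𝓕 → length 𝓕 < a + b
  with-top-bound top = *-cancelˡ-< 4 _ _ (begin-strict
    4 * length 𝓕                  ≤⟨ *-monoʳ-≤ 4 length-with-top ⟩
    4 * (properCount + 1)         ≡⟨ *-distribˡ-+ 4 properCount 1 ⟩
    4 * properCount + 4           ≤⟨ +-monoˡ-≤ 4 (with-top top b (2 * d) (λ {σ} _ → ≤-trans (m≤m+n _ _) (pair≤ σ))) ⟩
    6 * b + 2 * (2 * d) + 4       <⟨ +-monoʳ-< (6 * b + 2 * (2 * d)) 4<2b ⟩
    6 * b + 2 * (2 * d) + 2 * b   ≡⟨ r b d ⟩
    4 * (b + d + b)               ≡⟨ cong (λ z → 4 * (z + b)) (sym a≡) ⟩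
    4 * (a + b)                   ∎)
    where
    open ≤-Reasoning
    n≤b : n ≤ b
    n≤b = subst₂ _≤_ (nC1≡n n) w-p (C-mono-≤ n (≤-trans (s≤s z≤n) 8≤p)
        (≤-trans (+-monoʳ-≤ p (m≤n+m p 3)) (≤-trans (≤-reflexive (sym n≡p)) (n≤1+n n))))
    4<2b : 4 < 2 * b
    4<2b = ≤-trans (≤-trans (m≤m+n 5 13) 18≤n) (≤-trans n≤b (m≤m+n b _))
    r : ∀ b d → 6 * b + 2 * (2 * d) + 2 * b ≡ 4 * (b + d + b)
    r = solve-∀

  module Proper (proper : ∀ {B} → B ∈ 𝓕 → ∣ B ∣ < n) where

    private
      H Y : Vec ℕ n → ℕ
      H σ = mids (pre σ) + mids (suf σ)
      Y σ = extra (pre σ) + extra (suf σ)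

      per : ∀ {σ} → σ ∈ Ω n → weight (pre σ) + weight (suf σ) + b * H σ ≤ 4 * b + 2 * d + b * Y σ
      per {σ} σ∈ = farkas (outers (pre σ) + outers (suf σ)) (+-mono-≤ (pair≤ σ)
          (*-monoʳ-≤ b (+-mono-≤ (Pre.count+mids σ∈) (Suf.count+mids σ∈))))
        (r (weight (pre σ) + weight (suf σ)) (outers (pre σ) + outers (suf σ)) b d (count (pre σ)) (count (suf σ))
            (mids (pre σ)) (mids (suf σ)) (extra (pre σ)) (extra (suf σ)))
        where
        r : ∀ W E b d X X′ M M′ Z Z′ → W + b * (M + M′) + (b * (X + X′) + 2 * d + b * (2 + Z + (2 + Z′))) + E
            ≡ 4 * b + 2 * d + b * (Z + Z′) + (W + E + b * (X + M + (X′ + M′)))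
        r = solve-∀

      ∑-left : ∑[ σ ∈ Ω n ] (weight (pre σ) + weight (suf σ) + b * H σ) ≡ 2 * (n ! * length 𝓕) + b * ∑ (Ω n) H
      ∑-left = trans (∑-+ (Ω n) _ _) (cong₂ _+_ (trans ∑-weights (cong (λ z → 2 * (n ! * z))
          (proper⇒properCount proper))) (∑-*ˡ b (Ω n) H))

      ∑-right : ∑[ σ ∈ Ω n ] (4 * b + 2 * d + b * Y σ) ≡ n ! * (4 * b + 2 * d) + b * ∑ (Ω n) Y
      ∑-right = trans (∑-+ (Ω n) _ _) (cong₂ _+_ (∑-perms-const (rangeⱽ 0 n) (4 * b + 2 * d)) (∑-*ˡ b (Ω n) Y))

      total : 2 * (n ! * length 𝓕) + b * ∑ (Ω n) H ≤ n ! * (4 * b + 2 * d) + b * ∑ (Ω n) Y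
      total = subst₂ _≤_ ∑-left ∑-right (∑-mono (Ω n) per)

      ∑H : ∑ (Ω n) H ≡ ∑ S PreSums.U + ∑ S SufSums.U
      ∑H = trans (∑-+ (Ω n) _ _) (cong₂ _+_ PreSums.∑-mids SufSums.∑-mids)

      ∑Y : ∑ (Ω n) Y ≡ ∑ S (PreSums.Z proper) + ∑ S (SufSums.Z proper)
      ∑Y = trans (∑-+ (Ω n) _ _) (cong₂ _+_ (PreSums.∑-extra proper) (SufSums.∑-extra proper))

      preZ≤U : ∑ S (PreSums.Z proper) ≤ ∑ S PreSums.U
      preZ≤U = ∑-mono S (λ s∈ → proj₁ (PreSums.Z≤U proper s∈))

      sufZ≤U : ∑ S (SufSums.Z proper) ≤ ∑ S SufSums.U
      sufZ≤U = ∑-mono S (λ s∈ → proj₁ (SufSums.Z≤U proper s∈))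

      Y≤H : ∑ (Ω n) Y ≤ ∑ (Ω n) H
      Y≤H = subst₂ _≤_ (sym ∑Y) (sym ∑H) (+-mono-≤ preZ≤U sufZ≤U)

    upper : length 𝓕 ≤ a + b
    upper = *-cancel-≤-pos 2 (s≤s z≤n) (*-cancel-≤-pos (n !) (!-pos n) (begin
      n ! * (2 * length 𝓕)      ≤⟨ farkas 0 (+-mono-≤ total (*-monoʳ-≤ b Y≤H)) (r₁ (n !) (length 𝓕) b d (∑ (Ω n) H) (∑ (Ω n) Y)) ⟩
      n ! * (4 * b + 2 * d)     ≡⟨ cong (n ! *_) (r₂ b d) ⟩
      n ! * (2 * (b + d + b))   ≡⟨ cong (λ z → n ! * (2 * (z + b))) (sym a≡) ⟩
      n ! * (2 * (a + b))       ∎))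
      where
      open ≤-Reasoning
      r₁ : ∀ f l b d H Y → f * (2 * l) + (f * (4 * b + 2 * d) + b * Y + b * H) + 0 ≡ f * (4 * b + 2 * d) +
          (2 * (f * l) + b * H + b * Y)
      r₁ = solve-∀
      r₂ : ∀ b d → 4 * b + 2 * d ≡ 2 * (b + d + b)
      r₂ = solve-∀

    module Extremal (extremal : length 𝓕 ≡ a + b) where

      private
        mass : 2 * (n ! * length 𝓕) ≡ n ! * (4 * b + 2 * d)
        mass = trans (cong (λ z → 2 * (n ! * z)) (trans extremal (cong (_+ b) a≡))) (r (n !) b d)
          where r : ∀ f b d → 2 * (f * (b + d + b)) ≡ f * (4 * b + 2 * d)
                r = solve-∀

        H≤Y : ∑ (Ω n) H ≤ ∑ (Ω n) Y
        H≤Y = *-cancel-≤-pos b b>0 (+-cancelˡ-≤ (n ! * (4 * b + 2 * d)) _ _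
            (subst (λ z → z + b * ∑ (Ω n) H ≤ n ! * (4 * b + 2 * d) + b * ∑ (Ω n) Y) mass total))

        U≤Z : ∑ S PreSums.U ≤ ∑ S (PreSums.Z proper)
        U≤Z = +-cancelʳ-≤ (∑ S SufSums.U) _ _ (≤-trans (subst₂ _≤_ ∑H ∑Y H≤Y) (+-monoʳ-≤ _ sufZ≤U))

      -- Comparing initial segments alone is enough, because every set is an initial segment of some
      -- ordering.
      no-mid : ∀ {M} → ¬ Mid M
      no-mid {M} mid = go (pre∈ M)
        where
        s = ∣ M ∣
        s∈ : s ∈ S
        s∈ = ∈-inner⁺ (∈𝓕⇒nonempty (proj₁ mid)) (proper (proj₁ mid))
        U≡0 : PreSums.U s ≡ 0
        U≡0 = proj₂ (PreSums.Z≤U proper s∈) (≤-reflexive (sym (∑-tight S (λ s∈ → proj₁ (PreSums.Z≤U proper s∈)) U≤Z s∈)))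
        go : (∃ λ σ → σ ∈ Ω n × M ≡ pre σ s) → ⊥
        go (σ , σ∈ , eq) = <⇒≱ (≤-trans (≤-reflexive (sym (trans (cong μ (sym eq)) (Mid⇒μ mid))))
            (∑-member (Ω n) (λ σ → μ (pre σ s)) σ∈)) (≤-reflexive U≡0)

      private
        mids≡0 : ∀ c → mids c ≡ 0
        mids≡0 c = ∑-zero S (λ _ → ¬Mid⇒μ no-mid)

        extra≡0 : ∀ c → extra c ≡ 0
        extra≡0 c = ∑-zero S (λ {s} _ → cong (_* rest c s) (¬Mid⇒μ no-mid))

        count≤2 : ∀ {σ} → σ ∈ Ω n → count (pre σ) ≤ 2 × count (suf σ) ≤ 2
        count≤2 {σ} σ∈ = subst₂ _≤_ (trans (cong (count (pre σ) +_) (mids≡0 (pre σ))) (+-identityʳ _))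
            (cong (2 +_) (extra≡0 (pre σ))) (Pre.count+mids σ∈) ,
                         subst₂ _≤_ (trans (cong (count (suf σ) +_) (mids≡0 (suf σ))) (+-identityʳ _))
                             (cong (2 +_) (extra≡0 (suf σ))) (Suf.count+mids σ∈)

        weights≡ : ∀ {σ} → σ ∈ Ω n → weight (pre σ) + weight (suf σ) ≡ 4 * b + 2 * d
        weights≡ = ∑-tight (Ω n) (λ {σ} σ∈ → ≤-trans (≤-trans (m≤m+n _ _) (pair≤ σ))
            (≤-trans (+-monoˡ-≤ (2 * d) (*-monoʳ-≤ b (+-mono-≤ (proj₁ (count≤2 σ∈)) (proj₂ (count≤2 σ∈)))))
            (≤-reflexive (cong (_+ 2 * d) (*-comm b 4)))))
          (≤-reflexive (trans (∑-perms-const (rangeⱽ 0 n) (4 * b + 2 * d))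
              (trans (sym mass) (sym (trans ∑-weights (cong (λ z → 2 * (n ! * z)) (proper⇒properCount proper)))))))

        tight : ∀ {σ} → σ ∈ Ω n → 2 ≤ count (pre σ) × 2 ≤ count (suf σ) × outers (pre σ) + outers (suf σ) ≡ 0
        tight {σ} σ∈ = +-cancelʳ-≤ 2 _ _ (≤-trans 4≤ (+-monoʳ-≤ _ (proj₂ (count≤2 σ∈)))) , +-cancelˡ-≤ 2 _ _
            (≤-trans 4≤ (+-monoˡ-≤ _ (proj₁ (count≤2 σ∈)))) ,
          n≤0⇒n≡0 (+-cancelˡ-≤ (4 * b + 2 * d) _ _ (≤-trans main (≤-trans
              (+-monoˡ-≤ (2 * d) (*-monoʳ-≤ b (+-mono-≤ (proj₁ (count≤2 σ∈)) (proj₂ (count≤2 σ∈)))))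
            (≤-reflexive (trans (cong (_+ 2 * d) (*-comm b 4)) (sym (+-identityʳ _)))))))
          where
          main : 4 * b + 2 * d + (outers (pre σ) + outers (suf σ)) ≤ b * (count (pre σ) + count (suf σ)) + 2 * d
          main = subst (λ z → z + (outers (pre σ) + outers (suf σ)) ≤ b * (count (pre σ) + count (suf σ)) + 2 * d)
              (weights≡ σ∈) (pair≤ σ)
          4≤ : 4 ≤ count (pre σ) + count (suf σ)
          4≤ = *-cancel-≤-pos b b>0 (+-cancelʳ-≤ (2 * d) _ _ (≤-trans (≤-reflexive (cong (_+ 2 * d) (*-comm b 4)))
              (≤-trans (m≤m+n _ _) main)))

        inner : ∀ c → outers c ≡ 0 → ∀ {s} → 1 ≤ s → s < n → c s ∈ 𝓕 → p ≤ s × s ≤ 2 + m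
        inner c o {s} 1≤s s<n s∈ = ≮⇒≥ (λ h → contra (inj₁ h)) , ≤-pred (≰⇒> (λ h → contra (inj₂ h)))
          where
          contra : ¬ (s < p ⊎ 3 + m ≤ s)
          contra h = <⇒≱ (≤-trans (≤-reflexive (sym (cong₂ _*_ (𝟙-yes (outer? s) h) (∈⇒x s∈))))
              (∑-member S (λ s → outer s * x (c s)) (∈-inner⁺ 1≤s s<n))) (≤-reflexive o)

        -- Each chain has exactly two members, of sizes at most m + 2, so the smaller final segment
        -- has size at most m + 1. An initial member of size at most m would be disjoint from it;
        -- the two initial members therefore have sizes m + 1 and m + 2.
        levels : ∀ {σ} → σ ∈ Ω n → pre σ (suc m) ∈ 𝓕 × pre σ (2 + m) ∈ 𝓕
        levels {σ} σ∈ = go (Pre.two σ∈ (proj₁ (tight σ∈))) (Suf.two σ∈ (proj₁ (proj₂ (tight σ∈))))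
          where
          o = proj₂ (proj₂ (tight σ∈))
          go : (∃₂ λ s t → 1 ≤ s × s < t × t < n × pre σ s ∈ 𝓕 × pre σ t ∈ 𝓕) →
              (∃₂ λ s t → 1 ≤ s × s < t × t < n × suf σ s ∈ 𝓕 × suf σ t ∈ 𝓕) → _
          go (s , t , 1≤s , s<t , t<n , s∈ , t∈) (s′ , t′ , 1≤s′ , s′<t′ , t′<n , s′∈ , t′∈) =
            subst (λ z → pre σ z ∈ 𝓕) (≤-antisym (≤-pred (≤-trans s<t t≤)) s≥) s∈ , subst (λ z → pre σ z ∈ 𝓕)
                (≤-antisym t≤ (≤-trans (s≤s s≥) s<t)) t∈
            where
            t≤ : t ≤ 2 + m
            t≤ = proj₂ (inner (pre σ) (m+n≡0⇒m≡0 _ o) (≤-trans 1≤s (<⇒≤ s<t)) t<n t∈)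
            t′≤ : t′ ≤ 2 + m
            t′≤ = proj₂ (inner (suf σ) (m+n≡0⇒n≡0 (outers (pre σ)) o) (≤-trans 1≤s′ (<⇒≤ s′<t′)) t′<n t′∈)
            s≥ : suc m ≤ s
            s≥ = ≰⇒> (λ s≤m → pre-suf σ {s} {s′} (≤-trans (+-mono-≤ s≤m (≤-pred (≤-trans s′<t′ t′≤))) m+[1+m]≤n) s∈ s′∈)

        as-pre : ∀ {A s} → ∣ A ∣ ≡ s → ∃ λ σ → σ ∈ Ω n × A ≡ pre σ s
        as-pre {A} refl = pre∈ A

      structure : ∀ A → (A ∈ 𝓕) ⇔ (∣ A ∣ ≡ suc m ⊎ ∣ A ∣ ≡ 2 + m)
      structure A = mk⇔ to from
        where
        from : ∣ A ∣ ≡ suc m ⊎ ∣ A ∣ ≡ 2 + m → A ∈ 𝓕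
        from (inj₁ e) with σ , σ∈ , refl ← as-pre {A} e = proj₁ (levels σ∈)
        from (inj₂ e) with σ , σ∈ , refl ← as-pre {A} e = proj₂ (levels σ∈)
        to : A ∈ 𝓕 → ∣ A ∣ ≡ suc m ⊎ ∣ A ∣ ≡ 2 + m
        to A∈ = go (pre∈ A)
          where
          s = ∣ A ∣
          go : (∃ λ σ → σ ∈ Ω n × A ≡ pre σ s) → s ≡ suc m ⊎ s ≡ 2 + m
          go (σ , σ∈ , eq) with s ≟ suc m | s ≟ 2 + m | suc m <? s
          ... | yes e | _ | _ = inj₁ e
          ... | no _ | yes e | _ = inj₂ e
          -- Both central levels are full: a smaller member would make the set of size m + 1 on its
          -- chain a mid, a larger one the set of size m + 2.
          ... | no ≢1 | no ≢2 | no ≯ = ⊥-elim (no-mid (Pre.mid-between σ∈ {s} {suc m} {2 + m} (≤∧≢⇒< (≮⇒≥ ≯) ≢1)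
              (n<1+n _) (<⇒≤ 2+m<n)
                  (subst (_∈ 𝓕) eq A∈) (proj₁ (levels σ∈)) (proj₂ (levels σ∈))))
          ... | no ≢1 | no ≢2 | yes > = ⊥-elim (no-mid (Pre.mid-between σ∈ {suc m} {2 + m} {s} (n<1+n _)
              (≤∧≢⇒< > (≢2 ∘ sym)) (∣p∣≤n A)
                  (proj₁ (levels σ∈)) (proj₂ (levels σ∈)) (subst (_∈ 𝓕) eq A∈)))

  -- With two full levels every chain of initial segments has weight a + b, and averaging turns this
  -- into the size.
  converse : (∀ A → (A ∈ 𝓕) ⇔ (∣ A ∣ ≡ suc m ⊎ ∣ A ∣ ≡ 2 + m)) → length 𝓕 ≡ a + b
  converse iff = *-cancel-pos (n !) (!-pos n) (begin
    n ! * length 𝓕            ≡⟨ cong (n ! *_) (proper⇒properCount proper) ⟨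
    n ! * properCount         ≡⟨ ∑-weight-pre ⟨
    ∑[ σ ∈ Ω n ] weight (pre σ) ≡⟨ ∑-cong (Ω n) weight≡ ⟩
    ∑[ σ ∈ Ω n ] (a + b)      ≡⟨ ∑-perms-const (rangeⱽ 0 n) (a + b) ⟩
    n ! * (a + b)             ∎)
    where
    open ≡-Reasoning
    open Equivalence
    proper : ∀ {B} → B ∈ 𝓕 → ∣ B ∣ < n
    proper {B} B∈ = [ (λ e → subst (_< n) (sym e) 1+m<n) , (λ e → subst (_< n) (sym e) 2+m<n) ]′ (to (iff B) B∈)
    x≡ : ∀ {σ} → σ ∈ Ω n → ∀ {s} → s < n → x (pre σ s) ≡ 𝟙 (suc m ≟ s) + 𝟙 (2 + m ≟ s)
    x≡ {σ} σ∈ {s} s<n with suc m ≟ s | 2 + m ≟ s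
    ... | yes refl | yes ()
    ... | yes refl | no _ = ∈⇒x (from (iff _) (inj₁ (size-pre σ∈ (suc m) (<⇒≤ s<n))))
    ... | no _ | yes refl = ∈⇒x (from (iff _) (inj₂ (size-pre σ∈ (2 + m) (<⇒≤ s<n))))
    ... | no ≢1 | no ≢2 = ∉⇒x (λ s∈ → [ (λ e → ≢1 (trans (sym e) (size-pre σ∈ s (<⇒≤ s<n)))) ,
        (λ e → ≢2 (trans (sym e) (size-pre σ∈ s (<⇒≤ s<n)))) ]′ (to (iff (pre σ s)) s∈))
    weight≡ : ∀ {σ} → σ ∈ Ω n → weight (pre σ) ≡ a + b
    weight≡ {σ} σ∈ = begin
      weight (pre σ) ≡⟨ ∑-cong S (λ {s} s∈ → trans (cong ((n choose s) *_) (x≡ σ∈ (proj₂ (∈-inner⁻ s∈))))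
          (r (n choose s) (𝟙 (suc m ≟ s)) (𝟙 (2 + m ≟ s)))) ⟩
      ∑[ s ∈ S ] (𝟙 (suc m ≟ s) * (n choose s) + 𝟙 (2 + m ≟ s) * (n choose s)) ≡⟨ ∑-+ S _ _ ⟩
      ∑[ s ∈ S ] (𝟙 (suc m ≟ s) * (n choose s)) + ∑[ s ∈ S ] (𝟙 (2 + m ≟ s) * (n choose s))
        ≡⟨ cong₂ _+_ (∑-𝟙≟ 1 (n ∸ 1) (suc m) (n choose_) (s≤s z≤n) (<⇒<-pred n 1+m<n))
            (∑-𝟙≟ 1 (n ∸ 1) (2 + m) (n choose_) (s≤s z≤n) (<⇒<-pred n 2+m<n)) ⟩
      a + b ∎
      where r : ∀ w i j → w * (i + j) ≡ i * w + j * w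
            r = solve-∀

-- Even n: the whole set as a member, and the size of the extremal families

module EvenTop {n : ℕ} .{{nz : NonZero n}} (q : ℕ) (n≡ : n ≡ (2 + q) + (2 + q)) (7≤q : 7 ≤ q)
               (𝓕 : List (Subset n)) (unique : Unique 𝓕)
               (intersecting : Intersecting 𝓕) (free : ButterflyFree 𝓕) where

  open EvenLevels n q n≡ 7≤q
  open Line (≤-trans (m≤m+n 5 13) 18≤n) 𝓕 unique intersecting free

  private
    D : ℕ
    D = w₀ ∸ w₁

    m<n : m < n
    m<n = ≤-trans (m≤n+m (suc m) 2) 3+m≤n

    w≤ : ∀ s → s < n → n choose s ≤ w₁ + D * 𝟙 (m ≟ s)
    w≤ s s<n with m ≟ s
    ... | yes refl = ≤-reflexive (sym (trans (cong (w₁ +_) (*-identityʳ D)) (m+[n∸m]≡n w₁≤w₀)))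
    ... | no m≢s with m <? s
    ...   | yes m<s = ≤-trans (C-anti-≤ n (<⇒≤ s<n) m<s (≤-trans (+-mono-≤ half half)
        (≤-trans (≤-reflexive (sym n≡)) (n≤1+n n)))) (m≤m+n w₁ _)
      where half : n ∸ suc m ≤ m
            half = ≤-trans (∸-monoʳ-≤ n (n≤1+n m)) (≤-reflexive (trans (cong (_∸ m) n≡) (m+n∸m≡n m m)))
    ...   | no m≮s = ≤-trans (C-mono-≤ n (≤-pred (≤∧≢⇒< (≮⇒≥ m≮s) (m≢s ∘ sym)))
              (≤-trans (+-mono-≤ (n≤1+n (suc q)) (n≤1+n (suc q))) (≤-trans (≤-reflexive (sym n≡)) (n≤1+n n))))
              (≤-trans (≤-reflexive (mirror 1 (suc q) refl)) (m≤m+n w₁ _))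

    weight≤ : ∀ c → weight c ≤ w₁ * count c + D * x (c m)
    weight≤ c = begin
      weight c ≤⟨ ∑-mono S (λ {s} s∈ → *-monoˡ-≤ (x (c s)) (w≤ s (proj₂ (∈-inner⁻ s∈)))) ⟩
      ∑[ s ∈ S ] ((w₁ + D * 𝟙 (m ≟ s)) * x (c s)) ≡⟨ ∑-cong S (λ {s} _ → r w₁ D (𝟙 (m ≟ s)) (x (c s))) ⟩
      ∑[ s ∈ S ] (w₁ * x (c s) + D * (𝟙 (m ≟ s) * x (c s)))
        ≡⟨ trans (∑-+ S _ _) (cong₂ _+_ (∑-*ˡ w₁ S (x ∘ c)) (trans (∑-*ˡ D S _) (cong (D *_) (∑-at c (s≤s z≤n) m<n)))) ⟩
      w₁ * count c + D * x (c m) ∎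
      where
      open ≤-Reasoning
      r : ∀ w d i y → (w + d * i) * y ≡ w * y + d * (i * y)
      r = solve-∀

    pair≤ : ∀ σ → weight (pre σ) + weight (suf σ) ≤ w₁ * (count (pre σ) + count (suf σ)) + D
    pair≤ σ = farkas 0 (+-mono-≤ (+-mono-≤ (weight≤ (pre σ)) (weight≤ (suf σ)))
        (*-monoʳ-≤ D (exclusive σ {m} {m} (≤-reflexive (sym n≡)))))
      (r (weight (pre σ)) (weight (suf σ)) w₁ D (count (pre σ)) (count (suf σ)) (x (pre σ m)) (x (suf σ m)))
      where
      r : ∀ W V w d X Y f g → W + V + (w * X + d * f + (w * Y + d * g) + d * 1) + 0 ≡ w * (X + Y) + d + (W + V + d * (f + g))
      r = solve-∀

  -- On average three members on two chains give `m * w₀ + n * w₁`; the full set adds `n`, which is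
  -- less than the remaining `q * w₂`.
  with-top-bound : ⊤ ∈ 𝓕 → n * length 𝓕 < m * w₀ + n * w₁ + q * w₂
  with-top-bound top = *-cancelˡ-< 4 _ _ (begin-strict
    4 * (n * length 𝓕)              ≤⟨ *-monoʳ-≤ 4 (*-monoʳ-≤ n length-with-top) ⟩
    4 * (n * (properCount + 1))     ≡⟨ r₁ n properCount ⟩
    n * (4 * properCount) + 4 * n   ≤⟨ +-monoˡ-≤ (4 * n) (*-monoʳ-≤ n (with-top top w₁ D (λ {σ} _ → pair≤ σ))) ⟩
    n * (6 * w₁ + 2 * D) + 4 * n    ≡⟨ cong (λ z → z * (6 * w₁ + 2 * D) + 4 * n) n≡ ⟩
    (m + m) * (6 * w₁ + 2 * D) + 4 * n ≡⟨ r₂ m w₁ D n ⟩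
    4 * (m * (w₁ + D) + (m + m) * w₁) + 4 * n <⟨ +-monoʳ-< (4 * (m * (w₁ + D) + (m + m) * w₁)) (*-monoʳ-< 4 n<qw₂) ⟩
    4 * (m * (w₁ + D) + (m + m) * w₁) + 4 * (q * w₂) ≡⟨ r₃ (m * (w₁ + D)) ((m + m) * w₁) (q * w₂) ⟩
    4 * (m * (w₁ + D) + (m + m) * w₁ + q * w₂) ≡⟨ cong₂ (λ y z → 4 * (m * y + z * w₁ + q * w₂)) (m+[n∸m]≡n w₁≤w₀) (sym n≡) ⟩
    4 * (m * w₀ + n * w₁ + q * w₂) ∎)
    where
    open ≤-Reasoning
    r₁ : ∀ n P → 4 * (n * (P + 1)) ≡ n * (4 * P) + 4 * n
    r₁ = solve-∀
    r₂ : ∀ m w D n → (m + m) * (6 * w + 2 * D) + 4 * n ≡ 4 * (m * (w + D) + (m + m) * w) + 4 * n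
    r₂ = solve-∀
    r₃ : ∀ a b c → 4 * (a + b) + 4 * c ≡ 4 * (a + b + c)
    r₃ = solve-∀
    n≤w₂ : n ≤ w₂
    n≤w₂ = ≤-trans (≤-reflexive (sym (nC1≡n n))) (≤-trans (m≤m+n (n choose 1) _) (2w-small 1 (s≤s z≤n)))
    n<qw₂ : n < q * w₂
    n<qw₂ = ≤-<-trans n≤w₂ (≤-trans (≤-trans (m<m+n w₂ w₂>0) (≤-reflexive (cong (w₂ +_) (sym (+-identityʳ w₂)))))
        (*-monoˡ-≤ w₂ (≤-trans (m≤m+n 2 5) 7≤q)))

module EvenConverse {n : ℕ} .{{nz : NonZero n}} (q : ℕ) (n≡ : n ≡ (2 + q) + (2 + q)) (7≤q : 7 ≤ q)
            (𝓕 : List (Subset n)) (unique : Unique 𝓕)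
            (intersecting : Intersecting 𝓕) (free : ButterflyFree 𝓕) (proper : ∀ {B} → B ∈ 𝓕 → ∣ B ∣ < n) where

  open Even q n≡ 7≤q 𝓕 unique intersecting free proper

  private
    K = range 0 n
    S = range 1 (n ∸ 1)

    2+m<n : 2 + m < n
    2+m<n = 3+m≤n
    1+m<n : suc m < n
    1+m<n = <-trans (n<1+n _) 2+m<n
    m<n : m < n
    m<n = <-trans (n<1+n _) 1+m<n

  module _ (z : Fin n) (iff : ∀ A → (A ∈ 𝓕) ⇔ Star m z A) where

    private
      open Equivalence

      hits : Vec ℕ n → ℕ → ℕ → ℕ
      hits σ k s = 𝟙 (z ∈ˢ? grid σ k s)

      misses : Vec ℕ n → ℕ → ℕ → ℕ
      misses σ k s = 1 ∸ hits σ k s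

      x≡ : ∀ {σ} → σ ∈ Ω n → ∀ k {s} → s < n →
           x (grid σ k s) ≡ 𝟙 (m ≟ s) * hits σ k s + 𝟙 (suc m ≟ s) * 1 + 𝟙 (2 + m ≟ s) * misses σ k s
      x≡ {σ} σ∈ k {s} s<n = go (m ≟ s) (suc m ≟ s) (2 + m ≟ s) (z ∈ˢ? grid σ k s)
        where
        sz : ∣ grid σ k s ∣ ≡ s
        sz = size-grid σ∈ k s (<⇒≤ s<n)
        go : (d₀ : Dec (m ≡ s)) (d₁ : Dec (suc m ≡ s)) (d₂ : Dec (2 + m ≡ s)) (d : Dec (z ∈ˢ grid σ k s)) →
             x (grid σ k s) ≡ 𝟙 d₀ * 𝟙 d + 𝟙 d₁ * 1 + 𝟙 d₂ * (1 ∸ 𝟙 d)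
        go (yes refl) (yes ()) _ _
        go (yes refl) (no _) (yes ()) _
        go (no _) (yes refl) (yes ()) _
        go (yes e) (no _) (no _) (yes i) = ∈⇒x (from (iff _) (inj₁ (trans sz (sym e) , i)))
        go (no _) (yes e) (no _) _ = ∈⇒x (from (iff _) (inj₂ (inj₁ (trans sz (sym e)))))
        go (no _) (no _) (yes e) (no o) = ∈⇒x (from (iff _) (inj₂ (inj₂ (trans sz (sym e) , o))))
        go (yes e) (no ≢1) (no ≢2) (no o) = ∉⇒x (λ A∈ → [ (λ p → o (proj₂ p)) ,
            [ (λ p → ≢1 (trans (sym p) sz)) , (λ p → ≢2 (trans (sym (proj₁ p)) sz)) ]′ ]′ (to (iff _) A∈))
        go (no ≢0) (no ≢1) (yes e) (yes i) = ∉⇒x (λ A∈ → [ (λ p → ≢0 (trans (sym (proj₁ p)) sz)) ,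
            [ (λ p → ≢1 (trans (sym p) sz)) , (λ p → proj₂ p i) ]′ ]′ (to (iff _) A∈))
        go (no ≢0) (no ≢1) (no ≢2) d = ∉⇒x (λ A∈ → [ (λ p → ≢0 (trans (sym (proj₁ p)) sz)) ,
            [ (λ p → ≢1 (trans (sym p) sz)) , (λ p → ≢2 (trans (sym (proj₁ p)) sz)) ]′ ]′ (to (iff _) A∈))

      -- The position of `z` lies in exactly `s` of the `n` rotations of an arc of length `s`.
      ∑-hits : ∀ {σ} → σ ∈ Ω n → ∀ s → s ≤ n → ∑[ k ∈ K ] hits σ k s ≡ s
      ∑-hits {σ} σ∈ s s≤n = trans (∑-cong K (λ {k} _ → 𝟙-cong (z ∈ˢ? grid σ k s) ((k + (lookup σ z + offset s)) % n <? s)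
          (λ i → subst (λ v → v % n < s) (comm (lookup σ z) k (offset s)) (arc⁻ {a = k + offset s} {p = lookup σ z} (∈-map⁻ σ i)))
          (λ lt → ∈-map σ (arc⁺ {a = k + offset s} {p = lookup σ z} (subst (λ v → v % n < s)
              (sym (comm (lookup σ z) k (offset s))) lt)))))
        (∑-arc (lookup σ z + offset s) s s≤n)
        where comm : ∀ p k o → p + (k + o) ≡ k + (p + o)
              comm = solve-∀

      ∑-misses : ∀ {σ} → σ ∈ Ω n → ∑[ k ∈ K ] misses σ k (2 + m) ≡ q
      ∑-misses {σ} σ∈ = +-cancelˡ-≡ (2 + m) _ _ (begin
        2 + m + ∑[ k ∈ K ] misses σ k (2 + m)                              ≡⟨ cong (_+ ∑[ k ∈ K ] misses σ k (2 + m))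
            (∑-hits σ∈ (2 + m) (<⇒≤ 2+m<n)) ⟨
        ∑[ k ∈ K ] hits σ k (2 + m) + ∑[ k ∈ K ] misses σ k (2 + m)        ≡⟨ ∑-+ K _ _ ⟨
        ∑[ k ∈ K ] (hits σ k (2 + m) + (1 ∸ hits σ k (2 + m)))             ≡⟨ ∑-cong K
            (λ {k} _ → m+[n∸m]≡n (𝟙≤1 (z ∈ˢ? grid σ k (2 + m)))) ⟩
        ∑[ k ∈ K ] 1                                                        ≡⟨ trans (∑-const K 1)
            (trans (*-identityʳ _) (length-range 0 n)) ⟩
        n                                                                   ≡⟨ trans n≡ (r q) ⟩
        2 + m + q                                                           ∎)
        where
        open ≡-Reasoning
        r : ∀ q → (2 + q) + (2 + q) ≡ 2 + (2 + q) + q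
        r = solve-∀

      chain-weight : ∀ {σ} → σ ∈ Ω n → ∀ k → ∑[ s ∈ S ] ((n choose s) * x
          (grid σ k s)) ≡ w₀ * hits σ k m + w₁ * 1 + w₂ * misses σ k (2 + m)
      chain-weight {σ} σ∈ k = begin
        ∑[ s ∈ S ] ((n choose s) * x (grid σ k s))
          ≡⟨ ∑-cong S (λ {s} s∈ → trans (cong ((n choose s) *_) (x≡ σ∈ k (proj₂ (∈-inner⁻ s∈))))
               (r (n choose s) (𝟙 (m ≟ s)) (hits σ k s) (𝟙 (suc m ≟ s)) (𝟙 (2 + m ≟ s)) (misses σ k s))) ⟩
        ∑[ s ∈ S ] (𝟙 (m ≟ s) * ((n choose s) * hits σ k s) + 𝟙 (suc m ≟ s) * ((n choose s) * 1) + 𝟙 (2 + m ≟ s) *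
            ((n choose s) * misses σ k s))
          ≡⟨ trans (∑-+ S _ _) (cong₂ _+_ (trans (∑-+ S _ _) (cong₂ _+_
              (at m (λ s → (n choose s) * hits σ k s) (s≤s z≤n) m<n) (at (suc m) (λ s → (n choose s) * 1) (s≤s z≤n) 1+m<n)))
               (at (2 + m) (λ s → (n choose s) * misses σ k s) (s≤s z≤n) 2+m<n)) ⟩
        w₀ * hits σ k m + w₁ * 1 + w₂ * misses σ k (2 + m) ∎
        where
        open ≡-Reasoning
        r : ∀ w a h b c g → w * (a * h + b * 1 + c * g) ≡ a * (w * h) + b * (w * 1) + c * (w * g)
        r = solve-∀
        at : ∀ c (f : ℕ → ℕ) → 1 ≤ c → c < n → ∑[ s ∈ S ] (𝟙 (c ≟ s) * f s) ≡ f c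
        at c f 1≤c c<n = ∑-𝟙≟ 1 (n ∸ 1) c f 1≤c (<⇒<-pred n c<n)

      -- On every circle `z` lies in m of the m-arcs and is missed by n - (m + 2) = q of the arcs of
      -- size m + 2, so the sum does not depend on the ordering.
      weightsum≡ : ∀ {σ} → σ ∈ Ω n → weightsum σ ≡ m * w₀ + n * w₁ + q * w₂
      weightsum≡ {σ} σ∈ = begin
        weightsum σ ≡⟨ ∑-cong K (λ {k} _ → chain-weight σ∈ k) ⟩
        ∑[ k ∈ K ] (w₀ * hits σ k m + w₁ * 1 + w₂ * misses σ k (2 + m))
          ≡⟨ trans (∑-+ K _ _) (cong₂ _+_ (trans (∑-+ K _ _) (cong₂ _+_ (∑-*ˡ w₀ K _) (∑-*ˡ w₁ K (λ _ → 1)))) (∑-*ˡ w₂ K _)) ⟩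
        w₀ * ∑[ k ∈ K ] hits σ k m + w₁ * ∑[ k ∈ K ] 1 + w₂ * ∑[ k ∈ K ] misses σ k (2 + m)
          ≡⟨ cong₂ _+_ (cong₂ (λ a b → w₀ * a + w₁ * b) (∑-hits σ∈ m (<⇒≤ m<n))
              (trans (∑-const K 1) (trans (*-identityʳ _) (length-range 0 n)))) (cong (w₂ *_) (∑-misses σ∈)) ⟩
        w₀ * m + w₁ * n + w₂ * q
          ≡⟨ cong₂ _+_ (cong₂ _+_ (*-comm w₀ m) (*-comm w₁ n)) (*-comm w₂ q) ⟩
        m * w₀ + n * w₁ + q * w₂ ∎
        where open ≡-Reasoning

    converse : n * length 𝓕 ≡ m * w₀ + n * w₁ + q * w₂
    converse = *-cancel-pos (n !) (!-pos n) (begin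
      n ! * (n * length 𝓕)                         ≡⟨ r (n !) n (length 𝓕) ⟩
      n * (n ! * length 𝓕)                         ≡⟨ ∑-weightsum ⟨
      ∑ (Ω n) weightsum                            ≡⟨ ∑-cong (Ω n) weightsum≡ ⟩
      ∑[ σ ∈ Ω n ] (m * w₀ + n * w₁ + q * w₂)      ≡⟨ ∑-perms-const (rangeⱽ 0 n) _ ⟩
      n ! * (m * w₀ + n * w₁ + q * w₂)             ∎)
      where
      open ≡-Reasoning
      r : ∀ f n l → f * (n * l) ≡ n * (f * l)
      r = solve-∀

-- The two parities and the final statement

private
  9≤ : ∀ m → 17 ≤ m + m → 9 ≤ m
  9≤ m h with 9 ≤? m
  ... | yes p = p
  ... | no ¬p = ⊥-elim (<⇒≱ h (+-mono-≤ (≤-pred (≰⇒> ¬p)) (≤-pred (≰⇒> ¬p))))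

  ∃-suc : ∀ {a m} → suc a ≤ m → ∃ λ p → m ≡ suc p × a ≤ p
  ∃-suc (s≤s h) = _ , refl , h

  2m+1≡ : ∀ m → 2 * m + 1 ≡ suc (m + m)
  2m+1≡ = solve-∀

  2m≡ : ∀ m → 2 * m ≡ m + m
  2m≡ = solve-∀

odd-case : ∀ {n} p → n ≡ suc (suc p + suc p) → 8 ≤ p → (𝓕 : List (Subset n)) →
  Unique 𝓕 → Intersecting 𝓕 → ButterflyFree 𝓕 →
  (length 𝓕 ≤ (n choose suc (suc p)) + (n choose (3 + p))) ×
  ((length 𝓕 ≡ (n choose suc (suc p)) + (n choose (3 + p))) ⇔ (∀ A → (A ∈ 𝓕) ⇔ (∣ A ∣ ≡ suc (suc p) ⊎ ∣ A ∣ ≡ 3 + p)))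
odd-case {n} p n≡ 8≤p 𝓕 unique intersecting free = go (DecMembership._∈?_ _≟ˢ_ ⊤ 𝓕)
  where
  instance nz : NonZero n
           nz = >-nonZero (subst (0 <_) (sym n≡) (s≤s z≤n))
  module O = Odd p n≡ 8≤p 𝓕 unique intersecting free
  go : Dec (⊤ ∈ 𝓕) → (length 𝓕 ≤ (n choose suc (suc p)) + (n choose (3 + p))) ×
       ((length 𝓕 ≡ (n choose suc (suc p)) + (n choose (3 + p))) ⇔ (∀ A → (A ∈ 𝓕) ⇔ (∣ A ∣ ≡ suc (suc p) ⊎ ∣ A ∣ ≡ 3 + p)))
  go (yes top) = <⇒≤ (O.with-top-bound top) , mk⇔ (λ e → ⊥-elim (<-irrefl e (O.with-top-bound top))) O.converse
  go (no ¬top) = P.upper , mk⇔ (λ e → P.Extremal.structure e) O.converse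
    where module P = O.Proper (O.no-top⇒proper ¬top)

even-case : ∀ {n} q (n≡ : n ≡ (2 + q) + (2 + q)) → 7 ≤ q → (𝓕 : List (Subset n)) →
  Unique 𝓕 → Intersecting 𝓕 → ButterflyFree 𝓕 →
  let m = 2 + q
      bound = ((n ∸ 1) choose suc q) + ((n choose suc m) + 0) + ((n ∸ 1) choose (2 + m)) in
  (length 𝓕 ≤ bound) ×
  ((length 𝓕 ≡ bound) ⇔ ∃ λ z → ∀ A → (A ∈ 𝓕) ⇔ Star m z A)
even-case {n} q n≡ 7≤q 𝓕 unique intersecting free = go (DecMembership._∈?_ _≟ˢ_ ⊤ 𝓕)
  where
  instance nz : NonZero n
           nz = >-nonZero (subst (0 <_) (sym n≡) (s≤s z≤n))
  open EvenLevels n q n≡ 7≤q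
  bound : ℕ
  bound = ((n ∸ 1) choose suc q) + ((n choose suc m) + 0) + ((n ∸ 1) choose (2 + m))

  1≤n : 1 ≤ n
  1≤n = ≤-trans (s≤s z≤n) 18≤n

  n-1 : suc (n ∸ 1) ≡ n
  n-1 = m+[n∸m]≡n 1≤n

  absorb : ∀ k j → k + j ≡ n → k < n → n * ((n ∸ 1) choose k) ≡ j * (n choose k)
  absorb k j e k<n = trans (cong (_* ((n ∸ 1) choose k)) (sym n-1)) (trans
      ([n+1]Ck≡[n+1-k]C (n ∸ 1) k (≤-pred (subst (k <_) (sym n-1) k<n)))
    (cong₂ (λ a b → a * (b choose k)) (trans (cong (_∸ k) (trans n-1 (sym e))) (m+n∸m≡n k j)) n-1))

  -- `absorb` trades the binomials of n - 1 for those of `n`. The first then stands at level m - 1,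
  -- which equals level m + 1 by symmetry, and `ratio₁` turns it into `m * w₀`.
  n*bound : n * bound ≡ m * w₀ + n * w₁ + q * w₂
  n*bound = begin
    n * bound ≡⟨ trans (*-distribˡ-+ n _ ((n ∸ 1) choose (2 + m))) (cong₂ _+_ (*-distribˡ-+ n ((n ∸ 1) choose suc q) _) refl) ⟩
    n * ((n ∸ 1) choose suc q) + n * (w₁ + 0) + n * ((n ∸ 1) choose (2 + m))
      ≡⟨ cong₂ _+_ (cong₂ _+_ (absorb (suc q) (suc m) (trans (shift q) (sym n≡)) sq<n) (cong (n *_) (+-identityʳ w₁)))
                   (absorb (2 + m) q (trans (shift′ q) (sym n≡)) 3+m≤n) ⟩
    suc m * (n choose suc q) + n * w₁ + q * w₂ ≡⟨ cong (λ z → z + n * w₁ + q * w₂)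
        (trans (cong (suc m *_) (mirror 1 (suc q) refl)) ratio₁) ⟩
    m * w₀ + n * w₁ + q * w₂ ∎
    where
    open ≡-Reasoning
    shift : ∀ q → suc q + suc (2 + q) ≡ (2 + q) + (2 + q)
    shift = solve-∀
    shift′ : ∀ q → 2 + (2 + q) + q ≡ (2 + q) + (2 + q)
    shift′ = solve-∀
    sq<n : suc q < n
    sq<n = ≤-trans (m≤n+m m 3) 3+m≤n

  -- The circle estimate is exact: `4 * w₂` is the doubled loss of two lossy chains.
  capacity≡ : 2 * (n * bound) + 4 * w₂ ≡ m * (8 * w₂ + 2 * d₀ + 4 * d₁)
  capacity≡ = trans (cong (λ z → 2 * z + 4 * w₂) (trans n*bound (trans (cong (λ z → m * w₀ + z * w₁ + q * w₂) n≡)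
      (cong₂ (λ y z → m * y + (m + m) * z + q * w₂) w₀≡ w₁≡)))) (r q w₂ d₀ d₁)
    where
    r : ∀ q w d₀ d₁ → 2 * ((2 + q) * (w + d₀) + ((2 + q) + (2 + q)) * (w + d₁) + q * w) + 4 * w ≡ (2 + q) *
        (8 * w + 2 * d₀ + 4 * d₁)
    r = solve-∀

  star-proper : ∀ {z} → (∀ A → (A ∈ 𝓕) ⇔ Star m z A) → ∀ {B} → B ∈ 𝓕 → ∣ B ∣ < n
  star-proper iff {B} B∈ = [ (λ e → subst (_< n) (sym (proj₁ e)) (≤-trans (m≤n+m (suc m) 2) 3+m≤n)) ,
    [ (λ e → subst (_< n) (sym e) (≤-trans (n≤1+n _) 3+m≤n)) , (λ e → subst (_< n) (sym (proj₁ e)) 3+m≤n) ]′ ]′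
        (Equivalence.to (iff B) B∈)

  converse : (∃ λ z → ∀ A → (A ∈ 𝓕) ⇔ Star m z A) → length 𝓕 ≡ bound
  converse (z , iff) = *-cancel-pos n 1≤n (trans (EvenConverse.converse q n≡ 7≤q 𝓕 unique intersecting free
      (star-proper iff) z iff) (sym n*bound))

  go : Dec (⊤ ∈ 𝓕) → (length 𝓕 ≤ bound) × ((length 𝓕 ≡ bound) ⇔ ∃ λ z → ∀ A → (A ∈ 𝓕) ⇔ Star m z A)
  go (yes top) = <⇒≤ lt , mk⇔ (λ e → ⊥-elim (<-irrefl e lt)) converse
    where
    lt : length 𝓕 < bound
    lt = *-cancelˡ-< n _ _ (subst (n * length 𝓕 <_) (sym n*bound) (EvenTop.with-top-bound q n≡ 7≤q 𝓕 unique intersecting free top))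
  go (no ¬top) = *-cancel-≤-pos n 1≤n (*-cancel-≤-pos 2 (s≤s z≤n) (+-cancelʳ-≤ (4 * w₂) _ _
                   (≤-trans (Even.upper q n≡ 7≤q 𝓕 unique intersecting free proper) (≤-reflexive (sym capacity≡))))) ,
                 mk⇔ (λ e → EvenStructure.structure q n≡ 7≤q 𝓕 unique intersecting free proper
                     (trans (cong (λ l → 2 * (n * l) + 4 * w₂) e) capacity≡)) converse
    where
    proper : ∀ {B} → B ∈ 𝓕 → ∣ B ∣ < n
    proper {B} B∈ = ≤∧≢⇒< (∣p∣≤n B) (λ e → ¬top (subst (_∈ 𝓕) (∣p∣≡n⇒p≡⊤ e) B∈))

theorem9 : (∀ (m : ℕ) → 18 ≤ 2 * m + 1 → (𝓕 : List (Subset (2 * m + 1))) →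
    Unique 𝓕 → Intersecting 𝓕 → ButterflyFree 𝓕 →
    (length 𝓕 ≤ ΣI-odd m 2) ×
    ((length 𝓕 ≡ ΣI-odd m 2) ⇔ (∀ A → (A ∈F 𝓕) ⇔ H-odd m A)))
    ×
    (∀ (m : ℕ) → 18 ≤ 2 * m → (𝓕 : List (Subset (2 * m))) →
    Unique 𝓕 → Intersecting 𝓕 → ButterflyFree 𝓕 →
    (length 𝓕 ≤ ΣI-even m 2) ×
    ((length 𝓕 ≡ ΣI-even m 2) ⇔ ∃ λ (x : Fin (2 * m)) → ∀ A → (A ∈F 𝓕) ⇔ H-even m x A))
theorem9 = odd , even′
  where
  odd : ∀ m → 18 ≤ 2 * m + 1 → (𝓕 : List (Subset (2 * m + 1))) → Unique 𝓕 → Intersecting 𝓕 → ButterflyFree 𝓕 →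
        (length 𝓕 ≤ ΣI-odd m 2) × ((length 𝓕 ≡ ΣI-odd m 2) ⇔ (∀ A → (A ∈F 𝓕) ⇔ H-odd m A))
  odd m 18≤ 𝓕 u i f with p , refl , 8≤p ← ∃-suc (9≤ m (≤-pred (subst (18 ≤_) (2m+1≡ m) 18≤)))
    -- This brings sums such as m + 1 into successor form and removes the 0 that ends `binomSum`.
    rewrite +-comm p 1 | +-comm p 2 | +-identityʳ ((2 * suc p + 1) choose (3 + p)) = odd-case p (2m+1≡ (suc p)) 8≤p 𝓕 u i f
  even′ : ∀ m → 18 ≤ 2 * m → (𝓕 : List (Subset (2 * m))) → Unique 𝓕 → Intersecting 𝓕 → ButterflyFree 𝓕 →
          (length 𝓕 ≤ ΣI-even m 2) × ((length 𝓕 ≡ ΣI-even m 2) ⇔ ∃ λ (x : Fin (2 * m)) → ∀ A → (A ∈F 𝓕) ⇔ H-even m x A)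
  even′ m 18≤ 𝓕 u i f with p , refl , 8≤p ← ∃-suc (9≤ m (≤-trans (m≤m+n 17 1) (subst (18 ≤_) (2m≡ m) 18≤)))
    with q , refl , 7≤q ← ∃-suc 8≤p
    rewrite +-comm q 1 | +-comm q 2 = even-case q (2m≡ (2 + q)) 7≤q 𝓕 u i f
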